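{- For the ordinal matroid secretary problem on arbitrary matroids of rank $\rho$, there exists an $O(\log\log\rho)$ ordinal-competitive algorithm and there exists an $O(\log\rho)$ probability-competitive algorithm.
   Context: Ordinal MSP: $\mathcal{M}=(R,\mathcal{I})$ is a matroid with $|R|=n$ and rank $\rho$, $\succ$ a total order on $R$. For $Q\subseteq R$, $\mathrm{OPT}(Q)$ is the greedy (lexicographically maximum w.r.t. $\succ$) base of $Q$ and $\mathrm{OPT}=\mathrm{OPT}(R)$. Elements arrive in uniformly random order; the algorithm knows $n$, can only compare revealed elements under $\succ$ and query independence of sets of revealed elements, and must irrevocably accept or reject each element on arrival, keeping the accepted set $\mathrm{ALG}$ independent. An algorithm is $\alpha$ ordinal-competitive if for every weight function $w:R\to\mathbb{R}_{\ge0}$ compatible with $\succ$ (i.e. $r\succ r'\Rightarrow w(r)\ge w(r')$), $\mathbb{E}[w(\mathrm{ALG})]\ge w(\mathrm{OPT})/\alpha$. It is $\alpha$ probability-competitive if $\Pr(e\in\mathrm{ALG})\ge1/\alpha$ for every $e\in\mathrm{OPT}$.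
   Formalization: In the definition of ordinal-competitive, the compatible nonnegative weight functions take rational values instead of real values. -}

module Defs where

open import Data.Bool using (Bool; true; false; if_then_else_; _∧_)
open import Data.Nat as ℕ using (ℕ; zero; suc)
open import Data.Nat.Logarithm using (⌊log₂_⌋)
open import Data.Fin using (Fin; toℕ)
open import Data.Fin.Subset using (Subset; _∈_; _∉_; _⊆_; ∣_∣; ⁅_⁆; _∪_; ⊥)
open import Data.Fin.Subset.Properties using (_∈?_)
open import Data.Fin.Permutation using (Permutation′; _⟨$⟩ʳ_; _⟨$⟩ˡ_)
open import Data.List using (List; []; _∷_; _++_; [_]; map; concatMap; length; foldl; foldr; lookup; allFin)
open import Data.Vec using (_∷_; [])
open import Data.Integer using (+_)
open import Data.Rational using (ℚ; 0ℚ; 1ℚ; _+_; _*_; _/_; _≤_)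
open import Data.Product using (Σ; Σ-syntax; _×_; _,_)
open import Relation.Nullary using (does)
open import Relation.Binary.PropositionalEquality using (_≡_)

-- Matroids on the ground set R = Fin n.  Independence is a Boolean
-- oracle (it is queried by the algorithm).

record Matroid (n : ℕ) : Set where
  field
    indep     : Subset n → Bool
    indep-∅   : indep ⊥ ≡ true
    indep-⊆   : ∀ {A B} → A ⊆ B → indep B ≡ true → indep A ≡ true
    indep-aug : ∀ {A B} → indep A ≡ true → indep B ≡ true → ∣ A ∣ ℕ.< ∣ B ∣ →
                Σ[ e ∈ Fin n ] (e ∈ B × e ∉ A × indep (A ∪ ⁅ e ⁆) ≡ true)
open Matroid public

HasRank : ∀ {n} → Matroid n → ℕ → Set
HasRank {n} M ρ =
  Σ[ B ∈ Subset n ] (indep M B ≡ true × ∣ B ∣ ≡ ρ)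
  × (∀ (A : Subset n) → indep M A ≡ true → ∣ A ∣ ℕ.≤ ρ)

-- The total order ≻ on R, given by a permutation σ listing R from best
-- to worst: σ ⟨$⟩ʳ 0 is the ≻-largest element.  pos e = σ⁻¹ e.

pos : ∀ {n} → Permutation′ n → Fin n → ℕ
pos σ e = toℕ (σ ⟨$⟩ˡ e)

_≻[_]_ : ∀ {n} → Fin n → Permutation′ n → Fin n → Set
e ≻[ σ ] f = pos σ e ℕ.< pos σ f

OPT : ∀ {n} → Matroid n → Permutation′ n → Subset n
OPT {n} M σ = foldl step ⊥ (map (σ ⟨$⟩ʳ_) (allFin n))
  where
  step : Subset n → Fin n → Subset n
  step S e = if indep M (S ∪ ⁅ e ⁆) then S ∪ ⁅ e ⁆ else S

-- Online algorithms.  At the arrival of the k-th element the algorithm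
-- sees (besides n and its random seed) only:
--  * the comparisons under ≻ among the k revealed elements, indexed by
--    arrival position (the last one, index k-1, is the new element);
--  * the independence oracle restricted to subsets of revealed elements.
-- It returns whether it wants to accept the new element. Its own past
-- decisions are determined by earlier views, so they need not be passed.

Decider : Set
Decider = (k : ℕ) → (Fin k → Fin k → Bool) → (Subset k → Bool) → Bool

-- A randomized algorithm: for each n, a uniformly random seed among
-- suc (seeds n) values, independent of the arrival order.
record Algorithm : Set where
  field
    seeds : ℕ → ℕ
    run   : (n : ℕ) → Fin (suc (seeds n)) → Decider
open Algorithm public

image : ∀ {n} (p : List (Fin n)) → Subset (length p) → Subset n
image []      []      = ⊥
image (x ∷ p) (b ∷ S) = if b then ⁅ x ⁆ ∪ image p S else image p S

cmpView : ∀ {n} → Permutation′ n → (p : List (Fin n)) → Fin (length p) → Fin (length p) → Bool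
cmpView σ p i j = does (pos σ (lookup p i) ℕ.<? pos σ (lookup p j))

indView : ∀ {n} → Matroid n → (p : List (Fin n)) → Subset (length p) → Bool
indView M p S = indep M (image p S)

-- Run a decider on an arrival sequence; returns ALG.  An acceptance that
-- would violate independence is not performed (so ALG is independent).
execute : ∀ {n} → Matroid n → Permutation′ n → Decider → List (Fin n) → Subset n
execute {n} M σ D arr = go [] arr ⊥
  where
  go : List (Fin n) → List (Fin n) → Subset n → Subset n
  go seen []         A = A
  go seen (e ∷ rest) A =
    let p = seen ++ [ e ]
        acc = D (length p) (cmpView σ p) (indView M p) ∧ indep M (A ∪ ⁅ e ⁆)
    in go p rest (if acc then A ∪ ⁅ e ⁆ else A)

insertions : ∀ {A : Set} → A → List A → List (List A)
insertions x []       = [ x ∷ [] ]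
insertions x (y ∷ ys) = (x ∷ y ∷ ys) ∷ map (y ∷_) (insertions x ys)

perms : ∀ {A : Set} → List A → List (List A)
perms []       = [ [] ]
perms (x ∷ xs) = concatMap (insertions x) (perms xs)

sumℚ : List ℚ → ℚ
sumℚ = foldr _+_ 0ℚ

mean : List ℚ → ℚ
mean []       = 0ℚ
mean (x ∷ xs) = sumℚ (x ∷ xs) * (+ 1 / suc (length xs))

ℕ→ℚ : ℕ → ℚ
ℕ→ℚ m = + m / 1

𝔼 : ∀ {n} → Algorithm → Matroid n → Permutation′ n → (Subset n → ℚ) → ℚ
𝔼 {n} A M σ X =
  mean (concatMap (λ s → map (λ arr → X (execute M σ (run A n s) arr))
                              (perms (allFin n)))
                  (allFin (suc (seeds A n))))

weight : ∀ {n} → (Fin n → ℚ) → Subset n → ℚ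
weight {n} w S = sumℚ (map (λ e → if does (e ∈? S) then w e else 0ℚ) (allFin n))

indicator : ∀ {n} → Fin n → Subset n → ℚ
indicator e S = if does (e ∈? S) then 1ℚ else 0ℚ

OrdinalCompetitive : ∀ {n} → Matroid n → Permutation′ n → Algorithm → ℚ → Set
OrdinalCompetitive {n} M σ A α =
  (w : Fin n → ℚ) → (∀ e → 0ℚ ≤ w e) → (∀ e f → e ≻[ σ ] f → w f ≤ w e) →
  weight w (OPT M σ) ≤ α * 𝔼 A M σ (weight w)

ProbabilityCompetitive : ∀ {n} → Matroid n → Permutation′ n → Algorithm → ℚ → Set
ProbabilityCompetitive {n} M σ A α =
  (e : Fin n) → e ∈ OPT M σ → 1ℚ ≤ α * 𝔼 A M σ (indicator e)

-- the growth functions (base-2, rounded down; +1 handles small ρ)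
loglog₂ : ℕ → ℕ
loglog₂ ρ = ⌊log₂ ⌊log₂ ρ ⌋ ⌋

module Submission where

-- Colour the elements independently at random: most form a sample Q, the rest is split fairly into
-- a second sample S and candidates T, which arrive last.  The level of x counts the elements of
-- OPT(Q) better than x.  At a random dyadic scale the levels are cut into blocks; the flats spanned by
-- S up to the ends of the blocks form a chain, and the candidates from the lower half of a block that
-- lie in the flat at its end are selected greedily in the minor between consecutive flats.
-- Fix e in OPT and T, and let g(m) be the probability that the part of S of level below m spans e.
-- Exchanging S and T beyond the start of its block shows that at a given scale e is hindered by other
-- candidates with probability at most g(middle), whereas e is reached by the flat with probability
-- g(end), so it is accepted with probability at least g(end) - g(middle).  The end of a block is the
-- middle at the next scale where e is in a lower half, so the sum over all scales telescopes to
-- 1 - g(level of e + 1).  The subtracted term vanishes once Q contains the first element that closes a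
-- circuit with e: with O(log ρ) scales this is the probability-competitive bound.
-- Merging levels into geometrically growing classes leaves O(log log ρ) scales; an element spanned
-- by S within the classes up to its own is then paid for, for each prefix of the order, by counting
-- the greedy selection inside a single class, and Abel summation over the prefixes concludes.

open import Defs
open import Data.Bool using (Bool; true; false; if_then_else_; _∧_; _∨_; not; _xor_)
open import Data.Nat using (ℕ; zero; suc; _+_; _*_; _∸_; _^_; _≤_; _<_; z≤n; s≤s; ⌊_/2⌋; _/_)
open import Data.Nat.Properties
open import Data.List using (List; []; _∷_; _++_; map; concatMap; length; zip; replicate; filterᵇ; allFin; foldr; [_]; foldl; downFrom)
open import Data.Vec using (Vec; []; _∷_; lookup; zipWith; tabulate; _[_]≔_)
open import Data.Product using (Σ-syntax; _×_; _,_; proj₁; proj₂)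
open import Function using (_∘_; id; mk⇔)
open import Data.List.Relation.Unary.All using (All; []; _∷_)
open import Data.List.Relation.Binary.Permutation.Propositional using (_↭_; prep; swap; ↭-sym; ↭⇒↭ₛ) renaming (refl to ↭refl; trans to ↭trans)
open import Data.List.Relation.Binary.Permutation.Propositional.Properties using (↭-length; shift; ∈-resp-↭)
open import Relation.Binary.PropositionalEquality using (_≡_; _≢_; refl; sym; trans; cong; cong₂; subst; module ≡-Reasoning; setoid)
open import Data.Bool.Properties using (∨-assoc; ∨-comm; ∨-identityʳ)
open import Data.Fin using (Fin; zero; suc; toℕ; fromℕ; fromℕ<)
open import Data.List.Properties using (map-tabulate; tabulate-lookup; ++-assoc; length-tabulate; ++-identityʳ; map-∘; map-cong; concatMap-cong; concatMap-map; map-concatMap; length-map)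
open import Data.Vec.Properties using (lookup∘update; lookup∘update′; tabulate∘lookup; tabulate-cong; lookup∘tabulate; []=⇒lookup; lookup⇒[]=; lookup-zipWith)
open import Relation.Nullary using (does; ¬_; Dec; yes; no; contradiction)
open import Data.Fin.Subset using (Subset; _∈_; _∉_; _⊆_; ∣_∣; ⁅_⁆; _∪_; ⊥)
open import Data.Fin.Subset.Properties using (_∈?_; ∉⊥; x∈⁅x⁆; x∈⁅y⁆⇒x≡y; p⊆q⇒∣p∣≤∣q∣; p⊂q⇒∣p∣<∣q∣; x∈p∪q⁻; x∈p∪q⁺; p⊆p∪q; q⊆p∪q; ∪-comm; ∪-identityʳ; ∪-assoc; ∪-idem; ∪-identityˡ; nonempty?; ∣p∣≤n; Empty-unique; ∣⊥∣≡0)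
open import Data.List.Membership.Propositional using () renaming (_∈_ to _∈ˡ_; _∉_ to _∉ˡ_)
open import Data.List.Membership.Propositional.Properties using (∈-allFin; ∈-++⁺ˡ; ∈-++⁺ʳ; ∈-++⁻; ∈-map⁺)
open import Data.List.Relation.Unary.Any using (here; there)
open import Data.Sum using (_⊎_; inj₁; inj₂)
open import Data.Empty using (⊥-elim)
open import Relation.Nullary.Decidable using (_×-dec_)
open import Data.Nat.DivMod using (_%_; [m+n]%n≡m%n; m<n⇒m%n≡m; m≡m%n+[m/n]*n; m%n<n; m/n*n≤m; m/n≤m; /-monoˡ-≤; m≥n⇒m/n>0; m<n*o⇒m/o<n; m*n/n≡m)
open import Data.Nat.Logarithm using (⌊log₂_⌋; ⌊log₂⌋-mono-≤; ⌊log₂⌊n/2⌋⌋≡⌊log₂n⌋∸1; ⌊log₂[2*b]⌋≡1+⌊log₂b⌋; ⌊log₂[2^n]⌋≡n)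
open import Data.Fin.Permutation using (Permutation′; _⟨$⟩ʳ_; inverseʳ; _⟨$⟩ˡ_; inverseˡ)
open import Data.List.Relation.Unary.AllPairs using ([]; _∷_)
open import Data.List.Relation.Unary.Unique.Propositional using (Unique)
open import Data.List.Relation.Unary.Unique.Propositional.Properties using (allFin⁺; map⁺)
open import Data.Nat.Induction using (<-wellFounded)
open import Induction.WellFounded using (Acc; acc)
open import Data.Nat.Tactic.RingSolver using (solve-∀)
open import Data.Rational as ℚ using (ℚ; 0ℚ; 1ℚ; toℚᵘ)
open import Data.List.Membership.Propositional.Properties.WithK using (unique∧set⇒bag)
open import Data.List.Relation.Binary.BagAndSetEquality using (∼bag⇒↭)
import Data.List.Relation.Unary.All.Properties as Allₚ
import Data.List.Relation.Unary.All as Allₘ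
import Data.Fin as Fin
import Data.List as List
import Data.Bool as Bool
import Data.Nat as ℕ
import Data.Empty as Empty
import Data.Fin.Properties as Finₚ
import Data.List.Relation.Binary.Permutation.Setoid.Properties as PermSetoid
import Data.Integer as ℤ
import Data.Integer.Properties as ℤₚ
import Data.Rational.Properties as ℚₚ
import Data.Rational.Unnormalised as ℚᵘ
import Data.Rational.Unnormalised.Properties as ℚᵘₚ

-- There are two samples because the exchange of S and T must leave the blocks in place: levels are
-- read off Q alone, and the bits that split the rest are independent of Q, so flipping any set of
-- them preserves the distribution. The rank is not revealed. The number of scales is therefore read
-- off Q as well, and a seed drawn beforehand is reduced modulo it. Past decisions are not part of
-- the view either, so a candidate is blocked by all earlier eligible candidates instead of the
-- accepted ones; together with the earlier part of S both span the same flat. A lower bound for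
-- acceptance may then ignore arrival times and depend on colours alone. For geometric classes the
-- argument with the circuit-closing element fails, since later elements may share the class of e.
-- The counting that replaces it loses twice the rank of a set spanning the earlier classes; the
-- base 1024 of the classes makes this loss half of what is owed to a prefix. Probabilities are
-- counted without normalisation in `ℕ`, over all colour words, seeds and orders; rationals enter
-- only at the end.

-- Sums over lists

⟦_⟧ : Bool → ℕ
⟦ true ⟧ = 1
⟦ false ⟧ = 0

+-leftComm : ∀ a b c → a + (b + c) ≡ b + (a + c)
+-leftComm a b c = trans (sym (+-assoc a b c)) (trans (cong (_+ c) (+-comm a b)) (+-assoc b a c))

∑ : {A : Set} → List A → (A → ℕ) → ℕ
∑ []       f = 0
∑ (x ∷ xs) f = f x + ∑ xs f

module _ {A : Set} where

  ∑-cong : (xs : List A) {f g : A → ℕ} → (∀ x → f x ≡ g x) → ∑ xs f ≡ ∑ xs g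
  ∑-cong []       e = refl
  ∑-cong (x ∷ xs) e = cong₂ _+_ (e x) (∑-cong xs e)

  ∑-mono : (xs : List A) {f g : A → ℕ} → (∀ x → f x ≤ g x) → ∑ xs f ≤ ∑ xs g
  ∑-mono []       e = z≤n
  ∑-mono (x ∷ xs) e = +-mono-≤ (e x) (∑-mono xs e)

  ∑-congAll : {P : A → Set} {xs : List A} {f g : A → ℕ} → All P xs →
              (∀ x → P x → f x ≡ g x) → ∑ xs f ≡ ∑ xs g
  ∑-congAll []       e = refl
  ∑-congAll (p ∷ ps) e = cong₂ _+_ (e _ p) (∑-congAll ps e)

  ∑-monoAll : {P : A → Set} {xs : List A} {f g : A → ℕ} → All P xs →
              (∀ x → P x → f x ≤ g x) → ∑ xs f ≤ ∑ xs g
  ∑-monoAll []       e = z≤n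
  ∑-monoAll (p ∷ ps) e = +-mono-≤ (e _ p) (∑-monoAll ps e)

  ∑-+ : (xs : List A) (f g : A → ℕ) → ∑ xs (λ x → f x + g x) ≡ ∑ xs f + ∑ xs g
  ∑-+ []       f g = refl
  ∑-+ (x ∷ xs) f g = begin
    (f x + g x) + ∑ xs (λ y → f y + g y) ≡⟨ cong ((f x + g x) +_) (∑-+ xs f g) ⟩
    (f x + g x) + (∑ xs f + ∑ xs g)      ≡⟨ +-assoc (f x) (g x) _ ⟩
    f x + (g x + (∑ xs f + ∑ xs g))      ≡⟨ cong (f x +_) (+-leftComm (g x) (∑ xs f) (∑ xs g)) ⟩
    f x + (∑ xs f + (g x + ∑ xs g))      ≡⟨ sym (+-assoc (f x) (∑ xs f) _) ⟩
    (f x + ∑ xs f) + (g x + ∑ xs g)      ∎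
    where open ≡-Reasoning

  ∑-*ˡ : (k : ℕ) (xs : List A) (f : A → ℕ) → ∑ xs (λ x → k * f x) ≡ k * ∑ xs f
  ∑-*ˡ k []       f = sym (*-zeroʳ k)
  ∑-*ˡ k (x ∷ xs) f = trans (cong (k * f x +_) (∑-*ˡ k xs f)) (sym (*-distribˡ-+ k (f x) (∑ xs f)))

  ∑-*ʳ : (k : ℕ) (xs : List A) (f : A → ℕ) → ∑ xs (λ x → f x * k) ≡ ∑ xs f * k
  ∑-*ʳ k xs f = trans (∑-cong xs (λ x → *-comm (f x) k)) (trans (∑-*ˡ k xs f) (*-comm k (∑ xs f)))

  ∑-const : (xs : List A) (k : ℕ) → ∑ xs (λ _ → k) ≡ length xs * k
  ∑-const []       k = refl
  ∑-const (x ∷ xs) k = cong (k +_) (∑-const xs k)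

  ∑-zero : (xs : List A) → ∑ xs (λ _ → 0) ≡ 0
  ∑-zero xs = trans (∑-const xs 0) (*-zeroʳ (length xs))

  ∑-++ : (xs ys : List A) (f : A → ℕ) → ∑ (xs ++ ys) f ≡ ∑ xs f + ∑ ys f
  ∑-++ []       ys f = refl
  ∑-++ (x ∷ xs) ys f = trans (cong (f x +_) (∑-++ xs ys f)) (sym (+-assoc (f x) _ _))

  ∑-↭ : {xs ys : List A} (f : A → ℕ) → xs ↭ ys → ∑ xs f ≡ ∑ ys f
  ∑-↭ f ↭refl          = refl
  ∑-↭ f (prep x p)     = cong (f x +_) (∑-↭ f p)
  ∑-↭ f (swap x y p)   = trans (cong (λ t → f x + (f y + t)) (∑-↭ f p))
    (+-leftComm (f x) (f y) _)
  ∑-↭ f (↭trans p q)   = trans (∑-↭ f p) (∑-↭ f q)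

∑-map : {A B : Set} (g : A → B) (xs : List A) (f : B → ℕ) → ∑ (map g xs) f ≡ ∑ xs (f ∘ g)
∑-map g []       f = refl
∑-map g (x ∷ xs) f = cong (f (g x) +_) (∑-map g xs f)

∑-concatMap : {A B : Set} (g : A → List B) (xs : List A) (f : B → ℕ) →
              ∑ (concatMap g xs) f ≡ ∑ xs (λ x → ∑ (g x) f)
∑-concatMap g []       f = refl
∑-concatMap g (x ∷ xs) f = trans (∑-++ (g x) (concatMap g xs) f) (cong (∑ (g x) f +_) (∑-concatMap g xs f))

∑-swap : {A B : Set} (xs : List A) (ys : List B) (f : A → B → ℕ) →
         ∑ xs (λ x → ∑ ys (f x)) ≡ ∑ ys (λ y → ∑ xs (λ x → f x y))
∑-swap []       ys f = sym (∑-zero ys)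
∑-swap (x ∷ xs) ys f = trans (cong (∑ ys (f x) +_) (∑-swap xs ys f)) (sym (∑-+ ys (f x) (λ y → ∑ xs (λ x → f x y))))

length≡∑ : {A : Set} (xs : List A) → length xs ≡ ∑ xs (λ _ → 1)
length≡∑ xs = sym (trans (∑-const xs 1) (*-identityʳ (length xs)))

-- Uniform arrival orders and independent colours

picks : {C : Set} → List C → List (C × List C)
picks []       = []
picks (c ∷ cs) = (c , cs) ∷ map (λ (d , r) → (d , c ∷ r)) (picks cs)

∑-picks-∷ : {C : Set} (c : C) (cs : List C) (G : C × List C → ℕ) →
            ∑ (picks (c ∷ cs)) G ≡ G (c , cs) + ∑ (picks cs) (λ (d , r) → G (d , c ∷ r))
∑-picks-∷ c cs G = cong (G (c , cs) +_) (∑-map _ (picks cs) G)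

picks-length : {C : Set} (cs : List C) → All (λ (d , r) → suc (length r) ≡ length cs) (picks cs)
picks-length []       = []
picks-length (c ∷ cs) = refl ∷ Allₚ.map⁺ (Allₘ.map (cong suc) (picks-length cs))

-- Invariance of `G` is asked only for remainders of the right length, because that is all the
-- induction in `∑-perms-↭` can supply.
picks-↭ : {C : Set} {cs cs′ : List C} (G : C × List C → ℕ) →
          (∀ d {r r′} → suc (length r) ≡ length cs → r ↭ r′ → G (d , r) ≡ G (d , r′)) →
          cs ↭ cs′ → ∑ (picks cs) G ≡ ∑ (picks cs′) G
picks-↭ G inv ↭refl = refl
picks-↭ {cs = c ∷ cs} {c ∷ cs′} G inv (prep .c p) = begin
  ∑ (picks (c ∷ cs)) G                                     ≡⟨ ∑-picks-∷ c cs G ⟩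
  G (c , cs) + ∑ (picks cs) (λ (d , r) → G (d , c ∷ r))    ≡⟨ cong₂ _+_ (inv c refl p)
     (picks-↭ _ (λ d l q → inv d (cong suc l) (prep c q)) p) ⟩
  G (c , cs′) + ∑ (picks cs′) (λ (d , r) → G (d , c ∷ r))  ≡⟨ sym (∑-picks-∷ c cs′ G) ⟩
  ∑ (picks (c ∷ cs′)) G                                    ∎
  where open ≡-Reasoning
picks-↭ {cs = x ∷ y ∷ cs} {y ∷ x ∷ cs′} G inv (swap .x .y p) = begin
  ∑ (picks (x ∷ y ∷ cs)) G
    ≡⟨ expand x y cs ⟩
  G (x , y ∷ cs) + (G (y , x ∷ cs) + ∑ (picks cs) (λ (d , r) → G (d , x ∷ y ∷ r)))
    ≡⟨ cong₂ _+_ (inv x refl (prep y p)) (cong₂ _+_ (inv y refl (prep x p))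
       (trans (∑-congAll (picks-length cs) (λ (d , r) l → inv d (cong (2 +_) l) (swap x y ↭refl)))
              (picks-↭ _ (λ d l q → inv d (cong (2 +_) l) (prep y (prep x q))) p))) ⟩
  G (x , y ∷ cs′) + (G (y , x ∷ cs′) + ∑ (picks cs′) (λ (d , r) → G (d , y ∷ x ∷ r)))
    ≡⟨ +-leftComm (G (x , y ∷ cs′)) (G (y , x ∷ cs′)) _ ⟩
  G (y , x ∷ cs′) + (G (x , y ∷ cs′) + ∑ (picks cs′) (λ (d , r) → G (d , y ∷ x ∷ r)))
    ≡⟨ sym (expand y x cs′) ⟩
  ∑ (picks (y ∷ x ∷ cs′)) G ∎
  where
  open ≡-Reasoning
  expand : ∀ x y cs → ∑ (picks (x ∷ y ∷ cs)) G ≡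
           G (x , y ∷ cs) + (G (y , x ∷ cs) + ∑ (picks cs) (λ (d , r) → G (d , x ∷ y ∷ r)))
  expand x y cs = trans (∑-picks-∷ x (y ∷ cs) G) (cong (G (x , y ∷ cs) +_) (∑-picks-∷ y cs _))
picks-↭ G inv (↭trans p q) =
  trans (picks-↭ G inv p) (picks-↭ G (λ d l → inv d (trans l (sym (↭-length p)))) q)

-- Change of viewpoint: inserting `x` at a position of `π` against a fixed colour word means that
-- `x` takes the colour of that position and `π` receives the others in order.
∑-insertions : {A C : Set} (F : List (A × C) → ℕ) → (∀ {l l′} → l ↭ l′ → F l ≡ F l′) →
               ∀ x (π : List A) (cs : List C) → length cs ≡ suc (length π) →
               ∑ (insertions x π) (λ π′ → F (zip π′ cs)) ≡ ∑ (picks cs) (λ (d , r) → F ((x , d) ∷ zip π r))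
∑-insertions F inv x []      (c ∷ [])     l = refl
∑-insertions F inv x (y ∷ π) (c ∷ cs)     l = begin
  F ((x , c) ∷ zip (y ∷ π) cs) + ∑ (map (y ∷_) (insertions x π)) (λ π′ → F (zip π′ (c ∷ cs)))
    ≡⟨ cong₂ _+_ refl (∑-map (y ∷_) (insertions x π) _) ⟩
  F ((x , c) ∷ zip (y ∷ π) cs) + ∑ (insertions x π) (λ π′ → F ((y , c) ∷ zip π′ cs))
    ≡⟨ cong₂ _+_ refl (∑-insertions (λ l → F ((y , c) ∷ l)) (λ p → inv (prep _ p)) x π cs (suc-injective l)) ⟩
  F ((x , c) ∷ zip (y ∷ π) cs) + ∑ (picks cs) (λ (d , r) → F ((y , c) ∷ (x , d) ∷ zip π r))
    ≡⟨ cong₂ _+_ refl (∑-cong (picks cs) (λ (d , r) → inv (swap _ _ ↭refl))) ⟩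
  F ((x , c) ∷ zip (y ∷ π) cs) + ∑ (picks cs) (λ (d , r) → F ((x , d) ∷ zip (y ∷ π) (c ∷ r)))
    ≡⟨ sym (∑-picks-∷ c cs _) ⟩
  ∑ (picks (c ∷ cs)) (λ (d , r) → F ((x , d) ∷ zip (y ∷ π) r)) ∎
  where open ≡-Reasoning

insertions-↭ : {A : Set} (x : A) (ys : List A) → All (_↭ x ∷ ys) (insertions x ys)
insertions-↭ x []       = ↭refl ∷ []
insertions-↭ x (y ∷ ys) = ↭refl ∷ Allₚ.map⁺ (Allₘ.map (λ p → ↭trans (prep y p) (swap y x ↭refl)) (insertions-↭ x ys))

concatMap-All : {A B : Set} {P : A → Set} {R : B → Set} (g : A → List B) {xs : List A} → All P xs →
                (∀ x → P x → All R (g x)) → All R (concatMap g xs)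
concatMap-All g []       h = []
concatMap-All g (p ∷ ps) h = Allₚ.++⁺ (h _ p) (concatMap-All g ps h)

perms-↭ : {A : Set} (xs : List A) → All (_↭ xs) (perms xs)
perms-↭ []       = ↭refl ∷ []
perms-↭ (x ∷ xs) = concatMap-All (insertions x) (perms-↭ xs)
  (λ ys p → Allₘ.map (λ q → ↭trans q (prep x p)) (insertions-↭ x ys))

∑-perms-∷ : {A C : Set} (F : List (A × C) → ℕ) → (∀ {l l′} → l ↭ l′ → F l ≡ F l′) →
            ∀ x (xs : List A) (cs : List C) → length cs ≡ suc (length xs) →
            ∑ (perms (x ∷ xs)) (λ π → F (zip π cs)) ≡
            ∑ (picks cs) (λ (d , r) → ∑ (perms xs) (λ π → F ((x , d) ∷ zip π r)))
∑-perms-∷ F inv x xs cs l = begin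
  ∑ (perms (x ∷ xs)) (λ π → F (zip π cs))
    ≡⟨ ∑-concatMap (insertions x) (perms xs) _ ⟩
  ∑ (perms xs) (λ π → ∑ (insertions x π) (λ π′ → F (zip π′ cs)))
    ≡⟨ ∑-congAll (perms-↭ xs) (λ π p → ∑-insertions F inv x π cs (trans l (cong suc (sym (↭-length p))))) ⟩
  ∑ (perms xs) (λ π → ∑ (picks cs) (λ (d , r) → F ((x , d) ∷ zip π r)))
    ≡⟨ ∑-swap (perms xs) (picks cs) _ ⟩
  ∑ (picks cs) (λ (d , r) → ∑ (perms xs) (λ π → F ((x , d) ∷ zip π r))) ∎
  where open ≡-Reasoning

-- By `∑-perms-∷` the first element draws a colour uniformly from the word and the rest is
-- inductive, so only the multiset of colours matters.
∑-perms-↭ : {A C : Set} (F : List (A × C) → ℕ) → (∀ {l l′} → l ↭ l′ → F l ≡ F l′) →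
            ∀ (xs : List A) {cs cs′ : List C} → length cs ≡ length xs → cs ↭ cs′ →
            ∑ (perms xs) (λ π → F (zip π cs)) ≡ ∑ (perms xs) (λ π → F (zip π cs′))
∑-perms-↭ F inv []       l p = refl
∑-perms-↭ F inv (x ∷ xs) {cs} {cs′} l p = begin
  ∑ (perms (x ∷ xs)) (λ π → F (zip π cs))
    ≡⟨ ∑-perms-∷ F inv x xs cs l ⟩
  ∑ (picks cs) (λ (d , r) → ∑ (perms xs) (λ π → F ((x , d) ∷ zip π r)))
    ≡⟨ picks-↭ _ (λ d l′ q → ∑-perms-↭ (λ t → F ((x , d) ∷ t)) (λ q′ → inv (prep _ q′)) xs
          (suc-injective (trans l′ l)) q) p ⟩
  ∑ (picks cs′) (λ (d , r) → ∑ (perms xs) (λ π → F ((x , d) ∷ zip π r)))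
    ≡⟨ sym (∑-perms-∷ F inv x xs cs′ (trans (sym (↭-length p)) l)) ⟩
  ∑ (perms (x ∷ xs)) (λ π → F (zip π cs′)) ∎
  where open ≡-Reasoning

words : {C : Set} → List C → ℕ → List (List C)
words ps zero    = [] ∷ []
words ps (suc n) = concatMap (λ p → map (p ∷_) (words ps n)) ps

∑-words-suc : {C : Set} (ps : List C) (n : ℕ) (f : List C → ℕ) →
              ∑ (words ps (suc n)) f ≡ ∑ ps (λ p → ∑ (words ps n) (λ c → f (p ∷ c)))
∑-words-suc ps n f = trans (∑-concatMap _ ps f) (∑-cong ps (λ p → ∑-map (p ∷_) (words ps n) f))

words-length : {C : Set} (ps : List C) (n : ℕ) → All (λ c → length c ≡ n) (words ps n)
words-length ps zero    = refl ∷ []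
words-length ps (suc n) = concatMap-All {P = λ p → p ≡ p} (λ p → map (p ∷_) (words ps n)) (Allₘ.universal (λ _ → refl) ps)
  (λ p _ → Allₚ.map⁺ (Allₘ.map (cong suc) (words-length ps n)))

∑-words-↭ : {A C : Set} (ps : List C) {π xs : List A} → π ↭ xs →
            (F : List (A × C) → ℕ) → (∀ {l l′} → l ↭ l′ → F l ≡ F l′) →
            ∑ (words ps (length π)) (λ c → F (zip π c)) ≡ ∑ (words ps (length xs)) (λ c → F (zip xs c))
∑-words-↭ ps ↭refl F inv = refl
∑-words-↭ ps {x ∷ π} {x ∷ xs} (prep .x p) F inv = begin
  ∑ (words ps (suc (length π))) (λ c → F (zip (x ∷ π) c))
    ≡⟨ ∑-words-suc ps (length π) _ ⟩
  ∑ ps (λ d → ∑ (words ps (length π)) (λ c → F ((x , d) ∷ zip π c)))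
    ≡⟨ ∑-cong ps (λ d → ∑-words-↭ ps p (λ l → F ((x , d) ∷ l)) (λ q → inv (prep _ q))) ⟩
  ∑ ps (λ d → ∑ (words ps (length xs)) (λ c → F ((x , d) ∷ zip xs c)))
    ≡⟨ sym (∑-words-suc ps (length xs) _) ⟩
  ∑ (words ps (suc (length xs))) (λ c → F (zip (x ∷ xs) c)) ∎
  where open ≡-Reasoning
∑-words-↭ {A} {C} ps {x ∷ y ∷ π} {y ∷ x ∷ xs} (swap .x .y p) F inv = begin
  ∑ (words ps (2 + length π)) (λ c → F (zip (x ∷ y ∷ π) c))
    ≡⟨ expand x y π ⟩
  ∑ ps (λ d → ∑ ps (λ d′ → ∑ (words ps (length π)) (λ c → F ((x , d) ∷ (y , d′) ∷ zip π c))))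
    ≡⟨ ∑-swap ps ps _ ⟩
  ∑ ps (λ d′ → ∑ ps (λ d → ∑ (words ps (length π)) (λ c → F ((x , d) ∷ (y , d′) ∷ zip π c))))
    ≡⟨ ∑-cong ps (λ d′ → ∑-cong ps (λ d → trans
         (∑-cong (words ps (length π)) (λ c → inv (swap _ _ ↭refl)))
         (∑-words-↭ ps p (λ l → F ((y , d′) ∷ (x , d) ∷ l)) (λ q → inv (prep _ (prep _ q)))))) ⟩
  ∑ ps (λ d′ → ∑ ps (λ d → ∑ (words ps (length xs)) (λ c → F ((y , d′) ∷ (x , d) ∷ zip xs c))))
    ≡⟨ sym (expand y x xs) ⟩
  ∑ (words ps (2 + length xs)) (λ c → F (zip (y ∷ x ∷ xs) c)) ∎
  where
  open ≡-Reasoning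
  expand : ∀ x y (π : List A) → ∑ (words ps (2 + length π)) (λ c → F (zip (x ∷ y ∷ π) c)) ≡
           ∑ ps (λ d → ∑ ps (λ d′ → ∑ (words ps (length π)) (λ c → F ((x , d) ∷ (y , d′) ∷ zip π c))))
  expand x y π = trans (∑-words-suc ps (suc (length π)) _) (∑-cong ps (λ d → ∑-words-suc ps (length π) _))
∑-words-↭ ps (↭trans p q) F inv = trans (∑-words-↭ ps p F inv) (∑-words-↭ ps q F inv)

-- Colours may be drawn independently in advance and then dealt out in any rearranged order: the
-- uniform arrival order undoes the rearrangement, and the coloured elements are again independent.
-- This is what permits candidates to come last.
∑-words-perms : {A C : Set} (ps : List C) (xs : List A) (srt : List C → List C) → (∀ c → c ↭ srt c) →
                (F : List (A × C) → ℕ) → (∀ {l l′} → l ↭ l′ → F l ≡ F l′) →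
                ∑ (words ps (length xs)) (λ c → ∑ (perms xs) (λ π → F (zip π (srt c)))) ≡
                length (perms xs) * ∑ (words ps (length xs)) (λ c → F (zip xs c))
∑-words-perms ps xs srt srt-↭ F inv = begin
  ∑ (words ps (length xs)) (λ c → ∑ (perms xs) (λ π → F (zip π (srt c))))
    ≡⟨ ∑-congAll (words-length ps (length xs)) (λ c l → sym (∑-perms-↭ F inv xs l (srt-↭ c))) ⟩
  ∑ (words ps (length xs)) (λ c → ∑ (perms xs) (λ π → F (zip π c)))
    ≡⟨ ∑-swap (words ps (length xs)) (perms xs) _ ⟩
  ∑ (perms xs) (λ π → ∑ (words ps (length xs)) (λ c → F (zip π c)))
    ≡⟨ ∑-congAll (perms-↭ xs) (λ π p → trans
         (cong (λ m → ∑ (words ps m) (λ c → F (zip π c))) (sym (↭-length p)))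
         (∑-words-↭ ps p F inv)) ⟩
  ∑ (perms xs) (λ _ → ∑ (words ps (length xs)) (λ c → F (zip xs c)))
    ≡⟨ ∑-const (perms xs) _ ⟩
  length (perms xs) * ∑ (words ps (length xs)) (λ c → F (zip xs c)) ∎
  where open ≡-Reasoning

-- Colourings as vectors of independent bits

vecs : {P : Set} → List P → (n : ℕ) → List (Vec P n)
vecs ps zero    = [] ∷ []
vecs ps (suc n) = concatMap (λ p → map (p ∷_) (vecs ps n)) ps

∑-vecs-suc : {P : Set} (ps : List P) (n : ℕ) (f : Vec P (suc n) → ℕ) →
             ∑ (vecs ps (suc n)) f ≡ ∑ ps (λ p → ∑ (vecs ps n) (λ v → f (p ∷ v)))
∑-vecs-suc ps n f = trans (∑-concatMap _ ps f) (∑-cong ps (λ p → ∑-map (p ∷_) (vecs ps n) f))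

pairs : {A B : Set} → List A → List B → List (A × B)
pairs as bs = concatMap (λ a → map (a ,_) bs) as

∑-pairs : {A B : Set} (as : List A) (bs : List B) (f : A × B → ℕ) →
          ∑ (pairs as bs) f ≡ ∑ as (λ a → ∑ bs (λ b → f (a , b)))
∑-pairs as bs f = trans (∑-concatMap _ as f) (∑-cong as (λ a → ∑-map (a ,_) bs f))

-- The disjunction makes the colour of an element invariant under reordering.
look : ∀ {n} {C : Set} → (C → Bool) → Fin n → List (Fin n × C) → Bool
look f e []             = false
look f e ((x , c) ∷ al) = (does (e Fin.≟ x) ∧ f c) ∨ look f e al

paint : ∀ {n} {C : Set} → (C → Bool) → List (Fin n × C) → Vec Bool n
paint f al = tabulate (λ e → look f e al)

look-↭ : ∀ {n} {C : Set} (f : C → Bool) (e : Fin n) {al al′} → al ↭ al′ → look f e al ≡ look f e al′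
look-↭ f e ↭refl = refl
look-↭ f e (prep (x , c) p) = cong ((does (e Fin.≟ x) ∧ f c) ∨_) (look-↭ f e p)
look-↭ f e {_ ∷ _ ∷ al} {_ ∷ _ ∷ al′} (swap (x , c) (y , d) p) = begin
  a ∨ (b ∨ look f e al)  ≡⟨ sym (∨-assoc a b _) ⟩
  (a ∨ b) ∨ look f e al  ≡⟨ cong₂ _∨_ (∨-comm a b) (look-↭ f e p) ⟩
  (b ∨ a) ∨ look f e al′ ≡⟨ ∨-assoc b a _ ⟩
  b ∨ (a ∨ look f e al′) ∎
  where
  open ≡-Reasoning
  a = does (e Fin.≟ x) ∧ f c
  b = does (e Fin.≟ y) ∧ f d
look-↭ f e (↭trans p q) = trans (look-↭ f e p) (look-↭ f e q)

paint-↭ : ∀ {n} {C : Set} (f : C → Bool) {al al′ : List (Fin n × C)} → al ↭ al′ → paint f al ≡ paint f al′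
paint-↭ f p = tabulate-cong (λ e → look-↭ f e p)

-- The padding with `false` agrees with `look`, which returns `false` for an element without a
-- colour, so that `look-allFin` holds for words of every length.
toVec : {C : Set} → (C → Bool) → (n : ℕ) → List C → Vec Bool n
toVec f zero    cs       = []
toVec f (suc n) []       = false ∷ toVec f n []
toVec f (suc n) (c ∷ cs) = f c ∷ toVec f n cs

zip-mapˡ : {A B C : Set} (g : A → B) (xs : List A) (ys : List C) →
           zip (map g xs) ys ≡ map (λ (x , y) → (g x , y)) (zip xs ys)
zip-mapˡ g []       ys       = refl
zip-mapˡ g (x ∷ xs) []       = refl
zip-mapˡ g (x ∷ xs) (y ∷ ys) = cong (_ ∷_) (zip-mapˡ g xs ys)

look-zero-map : ∀ {n} {C : Set} (f : C → Bool) (al : List (Fin n × C)) →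
                look f zero (map (λ (x , y) → (suc x , y)) al) ≡ false
look-zero-map f []       = refl
look-zero-map f (_ ∷ al) = look-zero-map f al

look-suc-map : ∀ {n} {C : Set} (f : C → Bool) (e : Fin n) (al : List (Fin n × C)) →
               look f (suc e) (map (λ (x , y) → (suc x , y)) al) ≡ look f e al
look-suc-map f e []             = refl
look-suc-map f e ((x , c) ∷ al) = cong ((does (e Fin.≟ x) ∧ f c) ∨_) (look-suc-map f e al)

look-allFin : ∀ {C : Set} (f : C → Bool) (n : ℕ) (c : List C) (e : Fin n) →
              look f e (zip (allFin n) c) ≡ lookup (toVec f n c) e
look-allFin f (suc n) []       zero    = refl
look-allFin f (suc n) []       (suc e) = trans (sym (nil (allFin n))) (look-allFin f n [] e)
  where
  nil : (xs : List (Fin n)) → look f e (zip xs []) ≡ false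
  nil []       = refl
  nil (_ ∷ xs) = refl
look-allFin f (suc n) (c ∷ cs) e = trans
  (cong (λ l → look f e ((zero , c) ∷ l))
    (trans (cong (λ l → zip l cs) (sym (map-tabulate id suc))) (zip-mapˡ suc (allFin n) cs)))
  (split e)
  where
  split : ∀ e → look f e ((zero , c) ∷ map (λ (x , y) → (suc x , y)) (zip (allFin n) cs)) ≡ lookup (f c ∷ toVec f n cs) e
  split zero    = trans (cong (f c ∨_) (look-zero-map f (zip (allFin n) cs))) (∨-identityʳ (f c))
  split (suc e) = trans (look-suc-map f e (zip (allFin n) cs)) (look-allFin f n cs e)

paint-allFin : ∀ {C : Set} (f : C → Bool) (n : ℕ) (c : List C) → paint f (zip (allFin n) c) ≡ toVec f n c
paint-allFin f n c = trans (tabulate-cong (look-allFin f n c)) (tabulate∘lookup (toVec f n c))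

∑-words-vecs : (us bs : List Bool) (n : ℕ) (F : Vec Bool n → Vec Bool n → ℕ) →
               ∑ (words (pairs us bs) n) (λ c → F (toVec proj₁ n c) (toVec proj₂ n c)) ≡
               ∑ (vecs us n) (λ U → ∑ (vecs bs n) (F U))
∑-words-vecs us bs zero    F = sym (+-identityʳ _)
∑-words-vecs us bs (suc n) F = begin
  ∑ (words (pairs us bs) (suc n)) (λ c → F (toVec proj₁ (suc n) c) (toVec proj₂ (suc n) c))
    ≡⟨ ∑-words-suc (pairs us bs) n _ ⟩
  ∑ (pairs us bs) (λ (u , b) → ∑ (words (pairs us bs) n) (λ c → F (u ∷ toVec proj₁ n c) (b ∷ toVec proj₂ n c)))
    ≡⟨ ∑-pairs us bs _ ⟩
  ∑ us (λ u → ∑ bs (λ b → ∑ (words (pairs us bs) n) (λ c → F (u ∷ toVec proj₁ n c) (b ∷ toVec proj₂ n c))))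
    ≡⟨ ∑-cong us (λ u → ∑-cong bs (λ b → ∑-words-vecs us bs n (λ U θ → F (u ∷ U) (b ∷ θ)))) ⟩
  ∑ us (λ u → ∑ bs (λ b → ∑ (vecs us n) (λ U → ∑ (vecs bs n) (λ θ → F (u ∷ U) (b ∷ θ)))))
    ≡⟨ ∑-cong us (λ u → ∑-swap bs (vecs us n) _) ⟩
  ∑ us (λ u → ∑ (vecs us n) (λ U → ∑ bs (λ b → ∑ (vecs bs n) (λ θ → F (u ∷ U) (b ∷ θ)))))
    ≡⟨ ∑-cong us (λ u → ∑-cong (vecs us n) (λ U → sym (∑-vecs-suc bs n (F (u ∷ U))))) ⟩
  ∑ us (λ u → ∑ (vecs us n) (λ U → ∑ (vecs bs (suc n)) (F (u ∷ U))))
    ≡⟨ sym (∑-vecs-suc us n _) ⟩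
  ∑ (vecs us (suc n)) (λ U → ∑ (vecs bs (suc n)) (F U)) ∎
  where open ≡-Reasoning

coin : List Bool
coin = false ∷ true ∷ []

-- Flipping the fair bits of a fixed set permutes the cube. This is the measure-preserving exchange
-- of S and T.
∑-coin-xor : ∀ {n} (z : Vec Bool n) (f : Vec Bool n → ℕ) →
             ∑ (vecs coin n) (λ θ → f (zipWith _xor_ z θ)) ≡ ∑ (vecs coin n) f
∑-coin-xor {zero}  []      f = refl
∑-coin-xor {suc n} (b ∷ z) f = begin
  ∑ (vecs coin (suc n)) (λ θ → f (zipWith _xor_ (b ∷ z) θ))
    ≡⟨ ∑-vecs-suc coin n _ ⟩
  ∑ coin (λ c → ∑ (vecs coin n) (λ θ → f ((b xor c) ∷ zipWith _xor_ z θ)))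
    ≡⟨ ∑-cong coin (λ c → ∑-coin-xor z (λ θ → f ((b xor c) ∷ θ))) ⟩
  ∑ coin (λ c → ∑ (vecs coin n) (λ θ → f ((b xor c) ∷ θ)))
    ≡⟨ flip b ⟩
  ∑ coin (λ c → ∑ (vecs coin n) (λ θ → f (c ∷ θ)))
    ≡⟨ sym (∑-vecs-suc coin n f) ⟩
  ∑ (vecs coin (suc n)) f ∎
  where
  open ≡-Reasoning
  flip : ∀ b → ∑ coin (λ c → ∑ (vecs coin n) (λ θ → f ((b xor c) ∷ θ))) ≡
               ∑ coin (λ c → ∑ (vecs coin n) (λ θ → f (c ∷ θ)))
  flip false = refl
  flip true  = +-leftComm (∑ (vecs coin n) (λ θ → f (true ∷ θ))) (∑ (vecs coin n) (λ θ → f (false ∷ θ))) 0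

-- Redrawing one coordinate preserves the uniform distribution; the factor counts the redraws.
∑-resample : ∀ {P : Set} (ps : List P) {n} (e : Fin n) (f : Vec P n → ℕ) →
             ∑ (vecs ps n) (λ v → ∑ ps (λ p → f (v [ e ]≔ p))) ≡ length ps * ∑ (vecs ps n) f
∑-resample ps {suc n} zero f = begin
  ∑ (vecs ps (suc n)) (λ v → ∑ ps (λ p → f (v [ zero ]≔ p)))
    ≡⟨ ∑-vecs-suc ps n _ ⟩
  ∑ ps (λ _ → ∑ (vecs ps n) (λ v → ∑ ps (λ p → f (p ∷ v))))
    ≡⟨ ∑-const ps _ ⟩
  length ps * ∑ (vecs ps n) (λ v → ∑ ps (λ p → f (p ∷ v)))
    ≡⟨ cong (length ps *_) (trans (∑-swap (vecs ps n) ps _) (sym (∑-vecs-suc ps n f))) ⟩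
  length ps * ∑ (vecs ps (suc n)) f ∎
  where open ≡-Reasoning
∑-resample ps {suc n} (suc e) f = begin
  ∑ (vecs ps (suc n)) (λ v → ∑ ps (λ p → f (v [ suc e ]≔ p)))
    ≡⟨ ∑-vecs-suc ps n _ ⟩
  ∑ ps (λ q → ∑ (vecs ps n) (λ v → ∑ ps (λ p → f (q ∷ (v [ e ]≔ p)))))
    ≡⟨ ∑-cong ps (λ q → ∑-resample ps e (λ v → f (q ∷ v))) ⟩
  ∑ ps (λ q → length ps * ∑ (vecs ps n) (λ v → f (q ∷ v)))
    ≡⟨ ∑-*ˡ (length ps) ps _ ⟩
  length ps * ∑ ps (λ q → ∑ (vecs ps n) (λ v → f (q ∷ v)))
    ≡⟨ cong (length ps *_) (sym (∑-vecs-suc ps n f)) ⟩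
  length ps * ∑ (vecs ps (suc n)) f ∎
  where open ≡-Reasoning

∑-independent : ∀ {P : Set} (ps : List P) {n} (e : Fin n) (φ : P → ℕ) (g : Vec P n → ℕ) →
                (∀ v p → g (v [ e ]≔ p) ≡ g v) →
                length ps * ∑ (vecs ps n) (λ v → φ (lookup v e) * g v) ≡ ∑ ps φ * ∑ (vecs ps n) g
∑-independent ps {n} e φ g inv = begin
  length ps * ∑ (vecs ps n) (λ v → φ (lookup v e) * g v)
    ≡⟨ sym (∑-resample ps e _) ⟩
  ∑ (vecs ps n) (λ v → ∑ ps (λ p → φ (lookup (v [ e ]≔ p) e) * g (v [ e ]≔ p)))
    ≡⟨ ∑-cong (vecs ps n) (λ v → trans
         (∑-cong ps (λ p → cong₂ _*_ (cong φ (lookup∘update e v p)) (inv v p))) (∑-*ʳ (g v) ps φ)) ⟩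
  ∑ (vecs ps n) (λ v → ∑ ps φ * g v)
    ≡⟨ ∑-*ˡ (∑ ps φ) (vecs ps n) g ⟩
  ∑ ps φ * ∑ (vecs ps n) g ∎
  where open ≡-Reasoning

-- Booleans and finite subsets

∧-true : ∀ {a b} → a ∧ b ≡ true → a ≡ true × b ≡ true
∧-true {true} {true} _ = refl , refl

∧₁ : ∀ {a b} → a ∧ b ≡ true → a ≡ true
∧₁ e = proj₁ (∧-true e)

∧₂ : ∀ {a b} → a ∧ b ≡ true → b ≡ true
∧₂ {a} e = proj₂ (∧-true {a} e)

∧-intro : ∀ {a b} → a ≡ true → b ≡ true → a ∧ b ≡ true
∧-intro refl refl = refl

∨-true : ∀ {a b} → a ∨ b ≡ true → a ≡ true ⊎ b ≡ true
∨-true {true}  _ = inj₁ refl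
∨-true {false} e = inj₂ e

∨-introˡ : ∀ {a b} → a ≡ true → a ∨ b ≡ true
∨-introˡ refl = refl

∨-introʳ : ∀ a {b} → b ≡ true → a ∨ b ≡ true
∨-introʳ true  _    = refl
∨-introʳ false refl = refl

not-true : ∀ {a} → not a ≡ true → a ≡ false
not-true {false} _ = refl

true≢false : ∀ {a} → a ≡ true → a ≡ false → {A : Set} → A
true≢false refl ()

bool-cases : ∀ b → (b ≡ true) ⊎ (b ≡ false)
bool-cases true  = inj₁ refl
bool-cases false = inj₂ refl

≡-from-⇔ : ∀ {a b} → (a ≡ true → b ≡ true) → (b ≡ true → a ≡ true) → a ≡ b
≡-from-⇔ {true}  {b}     f g = sym (f refl)
≡-from-⇔ {false} {true}  f g = g refl
≡-from-⇔ {false} {false} f g = refl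

does-true : ∀ {A : Set} (d : Dec A) → does d ≡ true → A
does-true (yes a) _ = a

true-does : ∀ {A : Set} (d : Dec A) → A → does d ≡ true
true-does (yes _) _ = refl
true-does (no ¬a) a = contradiction a ¬a

⟦⟧-mono : ∀ {a b} → (a ≡ true → b ≡ true) → ⟦ a ⟧ ≤ ⟦ b ⟧
⟦⟧-mono {false} f = z≤n
⟦⟧-mono {true}  f rewrite f refl = ≤-refl

module _ {n : ℕ} where

  ⁅_∣⁆ : (Fin n → Bool) → Subset n
  ⁅ f ∣⁆ = tabulate f

  ∈-comp⁺ : ∀ {f x} → f x ≡ true → x ∈ ⁅ f ∣⁆
  ∈-comp⁺ {f} {x} e = lookup⇒[]= x (tabulate f) (trans (lookup∘tabulate f x) e)

  ∈-comp⁻ : ∀ {f x} → x ∈ ⁅ f ∣⁆ → f x ≡ true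
  ∈-comp⁻ {f} {x} m = trans (sym (lookup∘tabulate f x)) ([]=⇒lookup m)

  ∈⇒lookup : ∀ {x} {p : Subset n} → x ∈ p → lookup p x ≡ true
  ∈⇒lookup = []=⇒lookup

  lookup⇒∈ : ∀ {x} {p : Subset n} → lookup p x ≡ true → x ∈ p
  lookup⇒∈ {x} {p} = lookup⇒[]= x p

  ∪⁅⁆-⊆ : ∀ {A C : Subset n} {x} → A ⊆ C → x ∈ C → A ∪ ⁅ x ⁆ ⊆ C
  ∪⁅⁆-⊆ {A} {C} {x} s m {y} y∈ with x∈p∪q⁻ A ⁅ x ⁆ y∈
  ... | inj₁ a = s a
  ... | inj₂ b rewrite x∈⁅y⁆⇒x≡y x b = m

  fromList : List (Fin n) → Subset n
  fromList = foldr (λ x S → ⁅ x ⁆ ∪ S) ⊥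

  ∈-fromList⁻ : ∀ {x} xs → x ∈ fromList xs → x ∈ˡ xs
  ∈-fromList⁻ []       m = ⊥-elim (∉⊥ m)
  ∈-fromList⁻ (y ∷ xs) m with x∈p∪q⁻ ⁅ y ⁆ (fromList xs) m
  ... | inj₁ a = here (x∈⁅y⁆⇒x≡y y a)
  ... | inj₂ b = there (∈-fromList⁻ xs b)

  ∈-fromList⁺ : ∀ {x xs} → x ∈ˡ xs → x ∈ fromList xs
  ∈-fromList⁺ (here refl) = x∈p∪q⁺ (inj₁ (x∈⁅x⁆ _))
  ∈-fromList⁺ (there m)   = x∈p∪q⁺ (inj₂ (∈-fromList⁺ m))

∣∣≡∑ : ∀ {n} (p : Subset n) → ∣ p ∣ ≡ ∑ (allFin n) (λ x → ⟦ lookup p x ⟧)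
∣∣≡∑ {n} p = go p id (λ _ → refl)
  where
  go : ∀ {m} (q : Subset m) {B : Set} {f : B → ℕ} (ι : Fin m → B) → (∀ x → f (ι x) ≡ ⟦ lookup q x ⟧) →
       ∣ q ∣ ≡ ∑ (Data.List.tabulate ι) f
  go []          ι h = refl
  go (true ∷ q)  ι h = cong₂ _+_ (sym (h zero)) (go q (ι ∘ suc) (h ∘ suc))
  go (false ∷ q) ι h = cong₂ _+_ (sym (h zero)) (go q (ι ∘ suc) (h ∘ suc))

∣∪⁅⁆∣ : ∀ {n} (A : Subset n) x → x ∉ A → ∣ A ∪ ⁅ x ⁆ ∣ ≡ suc ∣ A ∣
∣∪⁅⁆∣ (true ∷ A)  zero    m = contradiction (lookup⇒∈ refl) m
∣∪⁅⁆∣ (false ∷ A) zero    m = cong (λ S → suc ∣ S ∣) (∪-identityʳ A)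
∣∪⁅⁆∣ (true ∷ A)  (suc x) m = cong suc (∣∪⁅⁆∣ A x (λ k → m (Data.Vec.there k)))
∣∪⁅⁆∣ (false ∷ A) (suc x) m = ∣∪⁅⁆∣ A x (λ k → m (Data.Vec.there k))

-- Matroid spans

module _ {A : Set} (ind : List A → Bool) (xs : List A) where

  basis : (A → Bool) → List A
  basis Z = foldr (λ x B → if Z x ∧ ind (x ∷ B) then x ∷ B else B) [] xs

  -- The first disjunct takes care of the members of the basis itself: adding such an `x` again
  -- leaves the set independent.
  spanᵇ : (A → Bool) → A → Bool
  spanᵇ Z x = Z x ∨ not (ind (x ∷ basis Z))

module Span {n : ℕ} (M : Matroid n) where

  Ind : Subset n → Set
  Ind A = indep M A ≡ true

  ind? : ∀ A → Dec (Ind A)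
  ind? A = indep M A Bool.≟ true

  indList : List (Fin n) → Bool
  indList I = indep M (fromList I)

  -- Closure with an arbitrary independent witness. Monotonicity is immediate in this form, whereas
  -- `spanᵇ` commits to one particular basis.
  Spanned : (Fin n → Set) → Fin n → Set
  Spanned Z x = Z x ⊎ Σ[ I ∈ Subset n ] ((∀ {y} → y ∈ I → Z y) × Ind I × ¬ Ind (I ∪ ⁅ x ⁆))

  span-mono : ∀ {Z Z′ : Fin n → Set} {x} → (∀ {y} → Z y → Z′ y) → Spanned Z x → Spanned Z′ x
  span-mono s (inj₁ z)                 = inj₁ (s z)
  span-mono s (inj₂ (I , I⊆Z , i , d)) = inj₂ (I , (λ m → s (I⊆Z m)) , i , d)

  extend : ∀ d {I J} → Ind I → Ind J → d + ∣ I ∣ ≡ ∣ J ∣ →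
           Σ[ I′ ∈ Subset n ] (I ⊆ I′ × (∀ {y} → y ∈ I′ → y ∈ I ⊎ y ∈ J) × Ind I′ × ∣ I′ ∣ ≡ ∣ J ∣)
  extend zero    {I} i j e = I , id , inj₁ , i , e
  extend (suc d) {I} {J} i j e
    with indep-aug M i j (≤-trans (s≤s (m≤n+m ∣ I ∣ d)) (≤-reflexive e))
  ... | x , x∈J , x∉I , ix
    with extend d ix j (trans (cong (d +_) (∣∪⁅⁆∣ I x x∉I)) (trans (+-suc d ∣ I ∣) e))
  ... | I′ , s , t , i′ , e′ = I′ , (λ m → s (p⊆p∪q ⁅ x ⁆ m)) , back , i′ , e′
    where
    back : ∀ {y} → y ∈ I′ → y ∈ I ⊎ y ∈ J
    back m with t m
    ... | inj₂ b = inj₂ b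
    ... | inj₁ a with x∈p∪q⁻ I ⁅ x ⁆ a
    ... | inj₁ a′ = inj₁ a′
    ... | inj₂ b rewrite x∈⁅y⁆⇒x≡y x b = inj₂ x∈J

  record Basis (Z : Fin n → Set) (B : Subset n) : Set where
    field
      within  : ∀ {y} → y ∈ B → Z y
      indepᴮ  : Ind B
      maximal : ∀ {y} → Z y → y ∉ B → ¬ Ind (B ∪ ⁅ y ⁆)
  open Basis

  basis-size : ∀ {Z B I} → Basis Z B → Ind I → (∀ {y} → y ∈ I → Z y) → ∣ I ∣ ≤ ∣ B ∣
  basis-size {Z} {B} {I} b i s = ≮⇒≥ λ lt →
    let (x , x∈I , x∉B , ix) = indep-aug M (indepᴮ b) i lt in maximal b (s x∈I) x∉B ix

  -- Augment `I` from the independent set `B ∪ ⁅ y ⁆` up to its size. If `y` enters, then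
  -- `I ∪ ⁅ y ⁆` is independent; otherwise the result lies in `Z` and is larger than `B`.
  extend-by : ∀ {Z : Fin n → Set} {B I} y → Ind I → Ind (B ∪ ⁅ y ⁆) → y ∉ B → ¬ Ind (I ∪ ⁅ y ⁆) →
              (∀ {J} → Ind J → (∀ {z} → z ∈ J → Z z) → ∣ J ∣ ≤ ∣ B ∣) →
              (∀ {z} → z ∈ I → Z z) → (∀ {z} → z ∈ B → Z z) → Empty.⊥
  extend-by {Z} {B} {I} y i iy y∉B dep small I⊆ B⊆
    with extend (∣ B ∪ ⁅ y ⁆ ∣ ∸ ∣ I ∣) i iy
           (m∸n+n≡m (≤-trans (small i I⊆) (≤-trans (n≤1+n ∣ B ∣) (≤-reflexive (sym (∣∪⁅⁆∣ B y y∉B))))))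
  ... | I′ , s , t , i′ , e with y ∈? I′
  ... | yes y∈ = dep (indep-⊆ M (∪⁅⁆-⊆ s y∈) i′)
  ... | no y∉  = 1+n≰n (≤-trans (≤-reflexive (sym (trans e (∣∪⁅⁆∣ B y y∉B)))) (small i′ sub))
    where
    sub : ∀ {z} → z ∈ I′ → Z z
    sub {z} m with t m
    ... | inj₁ a = I⊆ a
    ... | inj₂ b with x∈p∪q⁻ B ⁅ y ⁆ b
    ... | inj₁ b′ = B⊆ b′
    ... | inj₂ c rewrite x∈⁅y⁆⇒x≡y y c = ⊥-elim (y∉ m)

  basis-dependent : ∀ {Z B y} → Basis Z B → Spanned Z y → y ∉ B → ¬ Ind (B ∪ ⁅ y ⁆)
  basis-dependent b (inj₁ z) y∉B iy = maximal b z y∉B iy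
  basis-dependent {Z} {B} {y} b (inj₂ (I , I⊆Z , i , d)) y∉B iy =
    extend-by {Z} y i iy y∉B d (basis-size b) I⊆Z (within b)

  span-size : ∀ {Z B I} → Basis Z B → Ind I → (∀ {y} → y ∈ I → Spanned Z y) → ∣ I ∣ ≤ ∣ B ∣
  span-size {Z} {B} {I} b i s = ≮⇒≥ λ lt →
    let (x , x∈I , x∉B , ix) = indep-aug M (indepᴮ b) i lt in basis-dependent b (s x∈I) x∉B ix

  -- Transitivity of closure: by `span-size` the closure of `Z` has no independent set larger than
  -- `B`, so `extend-by` applies to the closure in place of `Z`.
  basis-trans : ∀ {Z Z′ B x} → Basis Z B → (∀ {y} → Z′ y → Spanned Z y) → Spanned Z′ x → Spanned Z x
  basis-trans b s (inj₁ z) = s z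
  basis-trans {Z} {Z′} {B} {x} b s (inj₂ (I , I⊆ , i , d)) with ind? (B ∪ ⁅ x ⁆) | x ∈? B
  ... | no ¬i | _      = inj₂ (B , within b , indepᴮ b , ¬i)
  ... | yes _ | yes x∈ = inj₁ (within b x∈)
  ... | yes ix | no x∉ = ⊥-elim (extend-by {Spanned Z} x i ix x∉ d (span-size b) (λ m → s (I⊆ m)) (λ m → inj₁ (within b m)))

  module _ (xs : List (Fin n)) (Z : Fin n → Bool) (supp : ∀ {y} → Z y ≡ true → y ∈ˡ xs) where

    private
      step : Fin n → List (Fin n) → List (Fin n)
      step x B = if Z x ∧ indList (x ∷ B) then x ∷ B else B

    basis-isBasis : Basis (λ y → Z y ≡ true) (fromList (basis indList xs Z))
    basis-isBasis = record
      { within = proj₁ (go xs) ; indepᴮ = proj₁ (proj₂ (go xs)) ; maximal = λ z y∉ → proj₂ (proj₂ (go xs)) (supp z) z y∉ }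
      where
      go : ∀ ys → let B = fromList (foldr step [] ys) in
           (∀ {y} → y ∈ B → Z y ≡ true) × Ind B × (∀ {y} → y ∈ˡ ys → Z y ≡ true → y ∉ B → ¬ Ind (B ∪ ⁅ y ⁆))
      go [] = (λ m → ⊥-elim (∉⊥ m)) , indep-∅ M , λ ()
      go (x ∷ ys) with go ys | bool-cases (Z x ∧ indList (x ∷ foldr step [] ys))
      ... | w , i , mx | inj₁ e rewrite e = w′ , ∧₂ e , mx′
        where
        B = fromList (foldr step [] ys)
        w′ : ∀ {y} → y ∈ ⁅ x ⁆ ∪ B → Z y ≡ true
        w′ {y} m with x∈p∪q⁻ ⁅ x ⁆ B m
        ... | inj₁ a rewrite x∈⁅y⁆⇒x≡y x a = ∧₁ e
        ... | inj₂ b = w b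
        mx′ : ∀ {y} → y ∈ˡ (x ∷ ys) → Z y ≡ true → y ∉ ⁅ x ⁆ ∪ B → ¬ Ind ((⁅ x ⁆ ∪ B) ∪ ⁅ y ⁆)
        mx′ (here refl) z y∉ iy = y∉ (p⊆p∪q B (x∈⁅x⁆ x))
        mx′ {y} (there m) z y∉ iy = mx m z (λ k → y∉ (q⊆p∪q ⁅ x ⁆ B k))
          (indep-⊆ M (∪⁅⁆-⊆ (λ k → p⊆p∪q ⁅ y ⁆ (q⊆p∪q ⁅ x ⁆ B k)) (q⊆p∪q (⁅ x ⁆ ∪ B) ⁅ y ⁆ (x∈⁅x⁆ y))) iy)
      ... | w , i , mx | inj₂ e rewrite e = w , i , mx′
        where
        B = fromList (foldr step [] ys)
        mx′ : ∀ {y} → y ∈ˡ (x ∷ ys) → Z y ≡ true → y ∉ B → ¬ Ind (B ∪ ⁅ y ⁆)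
        mx′ (here refl) z y∉ iy = true≢false (∧-intro z (trans (cong (indep M) (∪-comm ⁅ x ⁆ B)) iy)) e
        mx′ (there m) = mx m

    spanᵇ⇒ : ∀ {x} → spanᵇ indList xs Z x ≡ true → Spanned (λ y → Z y ≡ true) x
    spanᵇ⇒ {x} e with ∨-true {Z x} e
    ... | inj₁ z = inj₁ z
    ... | inj₂ d = inj₂ (_ , within basis-isBasis , indepᴮ basis-isBasis ,
            λ i → true≢false (trans (cong (indep M) (∪-comm ⁅ x ⁆ _)) i) (not-true d))

    ⇒spanᵇ : ∀ {x} → Spanned (λ y → Z y ≡ true) x → spanᵇ indList xs Z x ≡ true
    ⇒spanᵇ {x} s with bool-cases (Z x) | bool-cases (indList (x ∷ basis indList xs Z))
    ... | inj₁ z | _      = ∨-introˡ z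
    ... | inj₂ _ | inj₂ d = ∨-introʳ (Z x) (cong not d)
    ... | inj₂ z | inj₁ i = ⊥-elim (basis-dependent basis-isBasis s
      (λ m → true≢false (within basis-isBasis m) z) (trans (cong (indep M) (∪-comm _ ⁅ x ⁆)) i))

  ∈all : ∀ {Z : Fin n → Bool} {y} → Z y ≡ true → y ∈ˡ allFin n
  ∈all {y = y} _ = ∈-allFin y

  span : (Fin n → Bool) → Fin n → Bool
  span = spanᵇ indList (allFin n)

  span⇒ : ∀ {Z x} → span Z x ≡ true → Spanned (λ y → Z y ≡ true) x
  span⇒ {Z} = spanᵇ⇒ (allFin n) Z (∈all {Z})

  ⇒span : ∀ {Z x} → Spanned (λ y → Z y ≡ true) x → span Z x ≡ true
  ⇒span {Z} = ⇒spanᵇ (allFin n) Z (∈all {Z})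

  span-⊆ : ∀ {Z Z′ x} → (∀ {y} → Z y ≡ true → Z′ y ≡ true) → span Z x ≡ true → span Z′ x ≡ true
  span-⊆ s e = ⇒span (span-mono s (span⇒ e))

  span-trans : ∀ {Z Z′ x} → (∀ {y} → Z′ y ≡ true → span Z y ≡ true) → span Z′ x ≡ true → span Z x ≡ true
  span-trans {Z} {Z′} s e = ⇒span (basis-trans (basis-isBasis (allFin n) Z (∈all {Z})) (λ z → span⇒ (s z)) (span⇒ e))

  spanned-size : ∀ {I J} → Ind I → (∀ {y} → y ∈ I → span (lookup J) y ≡ true) → ∣ I ∣ ≤ ∣ J ∣
  spanned-size {I} {J} i s = ≤-trans
    (span-size b i (λ m → span⇒ (s m))) (p⊆q⇒∣p∣≤∣q∣ (λ m → lookup⇒∈ {p = J} (within b m)))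
    where b = basis-isBasis (allFin n) (lookup J) (∈all {lookup J})

  module _ (A : Fin n → Bool) (key : Fin n → ℕ)
           (inj : ∀ {x y} → A x ≡ true → A y ≡ true → key x ≡ key y → x ≡ y)
           (free : ∀ {x} → A x ≡ true → ¬ Spanned (λ y → A y ≡ true × key y < key x) x) where

    below : ℕ → Fin n → Bool
    below k y = A y ∧ does (key y ℕ.<? k)

    -- At most one element `x` has key `k`. If adding it destroyed independence, the elements of
    -- smaller key would span it, contrary to `free`.
    independent-step : ∀ k → Ind ⁅ below k ∣⁆ → Ind ⁅ below (suc k) ∣⁆
    independent-step k ih with Finₚ.any? (λ x → (A x Bool.≟ true) ×-dec (key x ℕ.≟ k))
    ... | no none = indep-⊆ M (λ m → ∈-comp⁺ (drop (∈-comp⁻ m))) ih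
      where
      drop : ∀ {y} → below (suc k) y ≡ true → below k y ≡ true
      drop {y} e = let (a , l) = ∧-true e in ∧-intro a (true-does (key y ℕ.<? k)
        (≤∧≢⇒< (≤-pred (does-true (key y ℕ.<? suc k) l)) (λ q → none (y , a , q))))
    ... | yes (x , a , refl) with ind? (⁅ below (key x) ∣⁆ ∪ ⁅ x ⁆)
    ... | no d = ⊥-elim (free a (inj₂ (⁅ below (key x) ∣⁆ , (λ {y} m → let (a′ , l) = ∧-true {A y} (∈-comp⁻ m) in
                   a′ , does-true (key y ℕ.<? key x) l) , ih , d)))
    ... | yes i = indep-⊆ M (λ m → sub (∈-comp⁻ m)) i
      where
      sub : ∀ {y} → below (suc (key x)) y ≡ true → y ∈ ⁅ below (key x) ∣⁆ ∪ ⁅ x ⁆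
      sub {y} e with ∧-true {A y} e | key y ℕ.≟ key x
      ... | a′ , l | yes q rewrite inj a′ a q = x∈p∪q⁺ (inj₂ (x∈⁅x⁆ x))
      ... | a′ , l | no ¬q = x∈p∪q⁺ (inj₁ (∈-comp⁺ (∧-intro a′ (true-does (key y ℕ.<? key x)
              (≤∧≢⇒< (≤-pred (does-true (key y ℕ.<? suc (key x)) l)) ¬q)))))

    independent-below : ∀ k → Ind ⁅ below k ∣⁆
    independent-below zero = indep-⊆ M (λ m → ⊥-elim (bad (∈-comp⁻ m))) (indep-∅ M)
      where
      bad : ∀ {y} → ¬ (below zero y ≡ true)
      bad {y} e with does-true (key y ℕ.<? zero) (∧₂ e)
      ... | ()
    independent-below (suc k) = independent-step k (independent-below k)

    independent : (K : ℕ) → (∀ {x} → A x ≡ true → key x < K) → Ind ⁅ A ∣⁆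
    independent K b = indep-⊆ M (λ {y} m → ∈-comp⁺ (∧-intro (∈-comp⁻ m) (true-does (key y ℕ.<? K) (b (∈-comp⁻ m)))))
                        (independent-below K)

-- Dyadic blocks and the acceptance rule

halve : ℕ → ℕ → ℕ
halve zero    a = a
halve (suc s) a = ⌊ halve s a /2⌋

even : ℕ → Bool
even zero          = true
even (suc zero)    = false
even (suc (suc a)) = even a

-- The acceptance rule.  A sampled element is in Q when nonQ fails; the others are split by the fair
-- bit into a second sample S and the candidates T.  Levels are measured by Q, spans by S.

module Levels {A : Set} (λ̂ : ℕ → ℕ) (items : List A) (ind : List A → Bool) (cmp : A → A → Bool) (nonQ : A → Bool) where

  greedy : A → Bool
  greedy y = not (nonQ y) ∧ not (spanᵇ ind items (λ z → not (nonQ z) ∧ cmp z y) y)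

  count : A → ℕ
  count x = ∑ items (λ y → ⟦ greedy y ∧ cmp y x ⟧)

  total : ℕ
  total = ∑ items (λ y → ⟦ greedy y ⟧)

  level : A → ℕ
  level x = λ̂ (count x)

  top : ℕ
  top = suc (λ̂ total)

  -- Chosen so that `halve scales top` is 0: at this scale there is a single block, and it counts as
  -- the last one.
  scales : ℕ
  scales = suc ⌊log₂ top ⌋

-- At scale s the blocks are the dyadic intervals of levels of length 2^s, and candidates come from
-- their lower halves; a candidate must be spanned by S up to the end of its block, unless the block is the last.

module Rule {A : Set} (λ̂ : ℕ → ℕ) (items : List A) (ind : List A → Bool) (cmp : A → A → Bool) (nonQ : A → Bool)
            (bit : A → Bool) (early : A → A → Bool) where
  open Levels λ̂ items ind cmp nonQ public

  isS isT : A → Bool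
  isS y = nonQ y ∧ not (bit y)
  isT y = nonQ y ∧ bit y

  block : ℕ → A → ℕ
  block s x = halve s (level x)

  -- At scale 0 a block is a single level, which has no halves, so all of it is used.
  lower : ℕ → A → Bool
  lower zero    x = true
  lower (suc s) x = even (block s x)

  sampleUpTo sampleBelow : ℕ → A → A → Bool
  sampleUpTo  s x y = isS y ∧ does (block s y ℕ.≤? block s x)
  sampleBelow s x y = isS y ∧ does (block s y ℕ.<? block s x)

  eligible : ℕ → A → Bool
  eligible s x = isT x ∧ (lower s x ∧ (spanᵇ ind items (sampleUpTo s x) x ∨ does (halve s top ℕ.≤? block s x)))

  -- Eligible instead of accepted: a rejected eligible element is spanned by what blocked it, so the
  -- flat is the same, and eligibility can be computed from the view without recalling past
  -- decisions.
  rivals : ℕ → A → A → Bool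
  rivals s x y = eligible s y ∧ (early y x ∧ does (block s y ℕ.≟ block s x))

  accept : ℕ → A → Bool
  accept s x = eligible s x ∧ not (spanᵇ ind items (λ y → sampleBelow s x y ∨ rivals s x y) x)

  -- The number of scales is known only after Q has arrived, while the seed `j` is fixed before; the
  -- scales in use are 0 up to and including `scales`.
  decide : ℕ → A → Bool
  decide j x = accept (j % suc scales) x

-- The rule only sees independence, comparisons and colours, so it is invariant under reindexing.

module Reindex {A B : Set} (ι : A → B) (λ̂ : ℕ → ℕ) (xs : List A) (indA : List A → Bool) (indB : List B → Bool)
  (cmpA : A → A → Bool) (cmpB : B → B → Bool) (nonQA bitA : A → Bool) (nonQB bitB : B → Bool)
  (earlyA : A → A → Bool) (earlyB : B → B → Bool)
  (hind : ∀ I → indB (map ι I) ≡ indA I) (hcmp : ∀ x y → cmpB (ι x) (ι y) ≡ cmpA x y)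
  (hQ : ∀ x → nonQB (ι x) ≡ nonQA x) (hbit : ∀ x → bitB (ι x) ≡ bitA x)
  (hearly : ∀ x y → earlyB (ι x) (ι y) ≡ earlyA x y) where

  private
    module RA = Rule λ̂ xs indA cmpA nonQA bitA earlyA
    module RB = Rule λ̂ (map ι xs) indB cmpB nonQB bitB earlyB

  basis-map : ∀ {Z′ Z} → (∀ x → Z′ (ι x) ≡ Z x) → ∀ ys → basis indB (map ι ys) Z′ ≡ map ι (basis indA ys Z)
  basis-map h []       = refl
  basis-map {Z′} {Z} h (y ∷ ys) with basis indB (map ι ys) Z′ | basis-map {Z′} {Z} h ys
  ... | _ | refl rewrite h y | hind (y ∷ basis indA ys Z) with Z y ∧ indA (y ∷ basis indA ys Z)
  ... | true  = refl
  ... | false = refl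

  span-map : ∀ {Z′ Z} x → (∀ x → Z′ (ι x) ≡ Z x) → spanᵇ indB (map ι xs) Z′ (ι x) ≡ spanᵇ indA xs Z x
  span-map {Z′} {Z} x h rewrite basis-map {Z′} {Z} h xs = cong₂ _∨_ (h x) (cong not (hind (x ∷ basis indA xs Z)))

  greedy-map : ∀ y → RB.greedy (ι y) ≡ RA.greedy y
  greedy-map y = cong₂ _∧_ (cong not (hQ y))
    (cong not (span-map y (λ z → cong₂ _∧_ (cong not (hQ z)) (hcmp z y))))

  count-map : ∀ x → RB.count (ι x) ≡ RA.count x
  count-map x = trans (∑-map ι xs _) (∑-cong xs (λ y → cong ⟦_⟧ (cong₂ _∧_ (greedy-map y) (hcmp y x))))

  total-map : RB.total ≡ RA.total
  total-map = trans (∑-map ι xs _) (∑-cong xs (λ y → cong ⟦_⟧ (greedy-map y)))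

  top-map : RB.top ≡ RA.top
  top-map = cong (λ t → suc (λ̂ t)) total-map

  block-map : ∀ s x → RB.block s (ι x) ≡ RA.block s x
  block-map s x = cong (λ t → halve s (λ̂ t)) (count-map x)

  lower-map : ∀ s x → RB.lower s (ι x) ≡ RA.lower s x
  lower-map zero    x = refl
  lower-map (suc s) x = cong even (block-map s x)

  isS-map : ∀ x → RB.isS (ι x) ≡ RA.isS x
  isS-map x = cong₂ (λ a b → a ∧ not b) (hQ x) (hbit x)

  eligible-map : ∀ s x → RB.eligible s (ι x) ≡ RA.eligible s x
  eligible-map s x = cong₂ _∧_ (cong₂ _∧_ (hQ x) (hbit x)) (cong₂ _∧_ (lower-map s x) (cong₂ _∨_
    (span-map x (λ y → cong₂ _∧_ (isS-map y) (cong₂ (λ a b → does (a ℕ.≤? b)) (block-map s y) (block-map s x))))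
    (cong₂ (λ a b → does (halve s a ℕ.≤? b)) top-map (block-map s x))))

  accept-map : ∀ s x → RB.accept s (ι x) ≡ RA.accept s x
  accept-map s x = cong₂ _∧_ (eligible-map s x) (cong not (span-map x (λ y → cong₂ _∨_
    (cong₂ _∧_ (isS-map y) (cong₂ (λ a b → does (a ℕ.<? b)) (block-map s y) (block-map s x)))
    (cong₂ _∧_ (eligible-map s y) (cong₂ _∧_ (hearly y x)
      (cong₂ (λ a b → does (a ℕ.≟ b)) (block-map s y) (block-map s x)))))))

  decide-map : ∀ j x → RB.decide j (ι x) ≡ RA.decide j x
  decide-map j x = trans (accept-map (j % suc RB.scales) x)
    (cong (λ t → RA.accept (j % suc (suc ⌊log₂ t ⌋)) x) top-map)

-- The rule on the revealed elements

module Restrict {n : ℕ} (M : Matroid n) (λ̂ : ℕ → ℕ) (p : List (Fin n)) (cmp : Fin n → Fin n → Bool)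
  (nonQ bit : Fin n → Bool) (early : Fin n → Fin n → Bool)
  (∑-seen : ∀ f → (∀ y → y ∉ˡ p → f y ≡ 0) → ∑ p f ≡ ∑ (allFin n) f)
  (seenQ : ∀ {y} → nonQ y ≡ false → y ∈ˡ p) (seenS : ∀ {y} → nonQ y ≡ true → bit y ≡ false → y ∈ˡ p) where

  open Span M
  private
    module RP = Rule λ̂ p indList cmp nonQ bit early
    module RA = Rule λ̂ (allFin n) indList cmp nonQ bit early

  -- Scanning the prefix or the whole ground set may produce different bases of `Z`, but both decide
  -- the same closure `Spanned`.
  span-restrict : ∀ {Z Z′} x → (∀ y → Z y ≡ Z′ y) → (∀ {y} → Z y ≡ true → y ∈ˡ p) →
                  spanᵇ indList p Z x ≡ span Z′ x
  span-restrict {Z} {Z′} x e supp = ≡-from-⇔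
    (λ h → ⇒span (span-mono (λ {y} z → trans (sym (e y)) z) (spanᵇ⇒ p Z supp h)))
    (λ h → ⇒spanᵇ p Z supp (span-mono (λ {y} z → trans (e y) z) (span⇒ h)))

  seenQ′ : ∀ {y b} → not (nonQ y) ∧ b ≡ true → y ∈ˡ p
  seenQ′ {y} e = seenQ (not-true (∧₁ {not (nonQ y)} e))

  greedy-restrict : ∀ y → RP.greedy y ≡ RA.greedy y
  greedy-restrict y = cong (λ t → not (nonQ y) ∧ not t) (span-restrict y (λ _ → refl) seenQ′)

  unseen : ∀ {y b} → y ∉ˡ p → ⟦ RP.greedy y ∧ b ⟧ ≡ 0
  unseen {y} {b} y∉ with bool-cases (RP.greedy y ∧ b)
  ... | inj₁ e = contradiction (seenQ′ {y} (∧₁ {RP.greedy y} e)) y∉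
  ... | inj₂ e rewrite e = refl

  count-restrict : ∀ x → RP.count x ≡ RA.count x
  count-restrict x = trans (∑-seen _ (λ y y∉ → unseen {y} {cmp y x} y∉))
    (∑-cong (allFin n) (λ y → cong (λ t → ⟦ t ∧ cmp y x ⟧) (greedy-restrict y)))

  total-restrict : RP.total ≡ RA.total
  total-restrict = trans (∑-seen _ unseen′) (∑-cong (allFin n) (λ y → cong ⟦_⟧ (greedy-restrict y)))
    where
    unseen′ : ∀ y → y ∉ˡ p → ⟦ RP.greedy y ⟧ ≡ 0
    unseen′ y y∉ with bool-cases (RP.greedy y)
    ... | inj₁ e = contradiction (seenQ′ {y} e) y∉
    ... | inj₂ e rewrite e = refl

  top-restrict : RP.top ≡ RA.top
  top-restrict = cong (λ t → suc (λ̂ t)) total-restrict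

  block-restrict : ∀ s x → RP.block s x ≡ RA.block s x
  block-restrict s x = cong (λ t → halve s (λ̂ t)) (count-restrict x)

  lower-restrict : ∀ s x → RP.lower s x ≡ RA.lower s x
  lower-restrict zero    x = refl
  lower-restrict (suc s) x = cong even (block-restrict s x)

  seenS′ : ∀ {y b} → RP.isS y ∧ b ≡ true → y ∈ˡ p
  seenS′ {y} e = let (s , _) = ∧-true {RP.isS y} e ; (u , t) = ∧-true {nonQ y} s in seenS u (not-true t)

  eligible-restrict : ∀ s x → RP.eligible s x ≡ RA.eligible s x
  eligible-restrict s x = cong (RP.isT x ∧_) (cong₂ _∧_ (lower-restrict s x) (cong₂ _∨_
    (span-restrict x (λ y → cong (RP.isS y ∧_) (cong₂ (λ a b → does (a ℕ.≤? b)) (block-restrict s y) (block-restrict s x))) seenS′)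
    (cong₂ (λ a b → does (halve s a ℕ.≤? b)) top-restrict (block-restrict s x))))

  -- All sets whose spans the rule consults consist of revealed elements: Q and S lie in `p`, and so
  -- do the elements earlier than `x`.
  accept-restrict : ∀ s x → (∀ {y} → early y x ≡ true → y ∈ˡ p) → RP.accept s x ≡ RA.accept s x
  accept-restrict s x seenE = cong₂ _∧_ (eligible-restrict s x) (cong not (span-restrict x (λ y → cong₂ _∨_
      (cong (RP.isS y ∧_) (cong₂ (λ a b → does (a ℕ.<? b)) (block-restrict s y) (block-restrict s x)))
      (cong₂ _∧_ (eligible-restrict s y) (cong (early y x ∧_)
        (cong₂ (λ a b → does (a ℕ.≟ b)) (block-restrict s y) (block-restrict s x)))))
    supp))
    where
    supp : ∀ {y} → RP.sampleBelow s x y ∨ RP.rivals s x y ≡ true → y ∈ˡ p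
    supp {y} e with ∨-true {RP.sampleBelow s x y} e
    ... | inj₁ a = seenS′ a
    ... | inj₂ b = seenE (∧₁ (∧₂ {RP.eligible s y} b))

  decide-restrict : ∀ j x → (∀ {y} → early y x ≡ true → y ∈ˡ p) → RP.decide j x ≡ RA.decide j x
  decide-restrict j x seenE = trans (accept-restrict (j % suc RP.scales) x seenE)
    (cong (λ t → RA.accept (j % suc (suc ⌊log₂ t ⌋)) x) top-restrict)

-- The decider and the dealing of colours

Colour : Set
Colour = Bool × Bool

candidate : Colour → Bool
candidate (u , b) = u ∧ b

nth : List Colour → ℕ → Colour
nth []       _       = false , false
nth (c ∷ cs) zero    = c
nth (c ∷ cs) (suc i) = nth cs i

-- The seed holds colours in random order; they are sorted only when dealt out, which
-- `∑-words-perms` allows.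
arrange : List Colour → List Colour
arrange c = filterᵇ (not ∘ candidate) c ++ filterᵇ candidate c

arrange-↭ : ∀ c → c ↭ arrange c
arrange-↭ []      = ↭refl
arrange-↭ (d ∷ c) with candidate d
... | false = prep d (arrange-↭ c)
... | true  = ↭trans (prep d (arrange-↭ c)) (↭-sym (shift d (filterᵇ (not ∘ candidate) c) (filterᵇ candidate c)))

filterᵇ-All : ∀ (f : Colour → Bool) c → All (λ d → f d ≡ true) (filterᵇ f c)
filterᵇ-All f []      = []
filterᵇ-All f (d ∷ c) with f d in eq
... | true  = eq ∷ filterᵇ-All f c
... | false = filterᵇ-All f c

nth-All : ∀ {f : Colour → Bool} {ys} → All (λ d → f d ≡ true) ys → ∀ {i} → i < length ys → f (nth ys i) ≡ true
nth-All (p ∷ ps) {zero}  l = p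
nth-All (p ∷ ps) {suc i} l = nth-All ps (≤-pred l)

suffix-candidate : ∀ {xs ys} → All (λ d → not (candidate d) ≡ true) xs → All (λ d → candidate d ≡ true) ys →
                   ∀ {i j} → i ≤ j → j < length (xs ++ ys) → candidate (nth (xs ++ ys) i) ≡ true →
                   candidate (nth (xs ++ ys) j) ≡ true
suffix-candidate []       q _ l e = nth-All q l
suffix-candidate (p ∷ ps) q {zero}  _ l e = true≢false e (not-true p)
suffix-candidate (p ∷ ps) q {suc i} {suc j} i≤j l e = suffix-candidate ps q (≤-pred i≤j) (≤-pred l) e

-- The bound on `j` excludes the default colour of `nth`, which is not a candidate.
arrange-suffix : ∀ c {i j} → i ≤ j → j < length (arrange c) → candidate (nth (arrange c) i) ≡ true →
                 candidate (nth (arrange c) j) ≡ true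
arrange-suffix c = suffix-candidate (filterᵇ-All (not ∘ candidate) c) (filterᵇ-All candidate c)

viewRule : (ℕ → ℕ) → List Colour → ℕ → (k : ℕ) → (Fin k → Fin k → Bool) → (Subset k → Bool) → Fin k → Bool
viewRule λ̂ c j k cmp ind = Rule.decide λ̂ (allFin k) (λ I → ind (fromList I)) cmp
  (λ i → proj₁ (nth (arrange c) (toℕ i))) (λ i → proj₂ (nth (arrange c) (toℕ i)))
  (λ i i′ → does (toℕ i ℕ.<? toℕ i′)) j

decider : (ℕ → ℕ) → List Colour → ℕ → Decider
decider λ̂ c j zero    cmp ind = false
decider λ̂ c j (suc k) cmp ind = viewRule λ̂ c j (suc k) cmp ind (fromℕ k)

decider-last : ∀ λ̂ c j {k} (cmp : Fin k → Fin k → Bool) (ind : Subset k → Bool) (x : Fin k) → suc (toℕ x) ≡ k →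
               decider λ̂ c j k cmp ind ≡ viewRule λ̂ c j k cmp ind x
decider-last λ̂ c j {suc k} cmp ind x e =
  cong (viewRule λ̂ c j (suc k) cmp ind) (Finₚ.toℕ-injective (trans (Finₚ.toℕ-fromℕ k) (sym (suc-injective e))))

image-⁅⁆∪ : ∀ {n} (p : List (Fin n)) i (S : Subset (length p)) →
            image p (⁅ i ⁆ ∪ S) ≡ ⁅ List.lookup p i ⁆ ∪ image p S
image-⁅⁆∪ (x ∷ p) zero (true ∷ S) = begin
  ⁅ x ⁆ ∪ image p (⊥ ∪ S)     ≡⟨ cong (λ T → ⁅ x ⁆ ∪ image p T) (∪-identityˡ S) ⟩
  ⁅ x ⁆ ∪ image p S           ≡⟨ cong (_∪ image p S) (sym (∪-idem ⁅ x ⁆)) ⟩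
  (⁅ x ⁆ ∪ ⁅ x ⁆) ∪ image p S ≡⟨ ∪-assoc ⁅ x ⁆ ⁅ x ⁆ (image p S) ⟩
  ⁅ x ⁆ ∪ (⁅ x ⁆ ∪ image p S) ∎
  where open ≡-Reasoning
image-⁅⁆∪ (x ∷ p) zero (false ∷ S) = cong (λ T → ⁅ x ⁆ ∪ image p T) (∪-identityˡ S)
image-⁅⁆∪ (x ∷ p) (suc i) (true ∷ S) = begin
  ⁅ x ⁆ ∪ image p (⁅ i ⁆ ∪ S) ≡⟨ cong (⁅ x ⁆ ∪_) (image-⁅⁆∪ p i S) ⟩
  ⁅ x ⁆ ∪ (y ∪ image p S)     ≡⟨ sym (∪-assoc ⁅ x ⁆ y (image p S)) ⟩
  (⁅ x ⁆ ∪ y) ∪ image p S     ≡⟨ cong (_∪ image p S) (∪-comm ⁅ x ⁆ y) ⟩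
  (y ∪ ⁅ x ⁆) ∪ image p S     ≡⟨ ∪-assoc y ⁅ x ⁆ (image p S) ⟩
  y ∪ (⁅ x ⁆ ∪ image p S)     ∎
  where
  open ≡-Reasoning
  y = ⁅ List.lookup p i ⁆
image-⁅⁆∪ (x ∷ p) (suc i) (false ∷ S) = image-⁅⁆∪ p i S

image-⊥ : ∀ {n} (p : List (Fin n)) → image p ⊥ ≡ ⊥
image-⊥ []      = refl
image-⊥ (x ∷ p) = image-⊥ p

image-fromList : ∀ {n} (p : List (Fin n)) I → image p (fromList I) ≡ fromList (map (List.lookup p) I)
image-fromList p []      = image-⊥ p
image-fromList p (i ∷ I) = trans (image-⁅⁆∪ p i (fromList I)) (cong (⁅ List.lookup p i ⁆ ∪_) (image-fromList p I))

map-lookup-allFin : ∀ {A : Set} (p : List A) → map (List.lookup p) (allFin (length p)) ≡ p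
map-lookup-allFin p = trans (map-tabulate id (List.lookup p)) (tabulate-lookup p)

last-index : ∀ {A : Set} (seen : List A) e → Σ[ x ∈ Fin (length (seen ++ [ e ])) ]
             (List.lookup (seen ++ [ e ]) x ≡ e × suc (toℕ x) ≡ length (seen ++ [ e ]))
last-index []         e = zero , refl , refl
last-index (y ∷ seen) e = let (x , a , b) = last-index seen e in suc x , a , cong suc b

module _ {n : ℕ} where

  arrival : List (Fin n) → Fin n → ℕ
  arrival []      e = 0
  arrival (x ∷ π) e = if does (e Fin.≟ x) then 0 else suc (arrival π e)

  arrival-< : ∀ {π e} → e ∈ˡ π → arrival π e < length π
  arrival-< {x ∷ π} {e} m with e Fin.≟ x
  ... | yes _ = s≤s z≤n
  arrival-< {x ∷ π} {e} (here q)  | no ¬q = contradiction q ¬q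
  arrival-< {x ∷ π} {e} (there m) | no ¬q = s≤s (arrival-< m)

  arrival-inj : ∀ {π e f} → e ∈ˡ π → f ∈ˡ π → arrival π e ≡ arrival π f → e ≡ f
  arrival-inj {x ∷ π} {e} {f} me mf q with e Fin.≟ x | f Fin.≟ x
  ... | yes a | yes b = trans a (sym b)
  arrival-inj {x ∷ π} (here a)   mf        q | no ¬a | no ¬b = contradiction a ¬a
  arrival-inj {x ∷ π} (there me) (here b)  q | no ¬a | no ¬b = contradiction b ¬b
  arrival-inj {x ∷ π} (there me) (there mf) q | no ¬a | no ¬b = arrival-inj me mf (suc-injective q)

  arrival-lookup : ∀ p rest → Unique (p ++ rest) → ∀ i → arrival (p ++ rest) (List.lookup p i) ≡ toℕ i
  arrival-lookup (x ∷ p) rest (u ∷ us) zero with x Fin.≟ x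
  ... | yes _ = refl
  ... | no ¬q = contradiction refl ¬q
  arrival-lookup (x ∷ p) rest (u ∷ us) (suc i) with List.lookup p i Fin.≟ x
  ... | yes q = contradiction (sym q) (Allₘ.lookup u (∈-++⁺ˡ (lookup-∈ p i)))
    where
    lookup-∈ : ∀ (p : List (Fin n)) i → List.lookup p i ∈ˡ p
    lookup-∈ (x ∷ p) zero    = here refl
    lookup-∈ (x ∷ p) (suc i) = there (lookup-∈ p i)
  ... | no _  = cong suc (arrival-lookup p rest us i)

  arrival-prefix : ∀ p {rest y} → y ∈ˡ p ++ rest → arrival (p ++ rest) y < length p → y ∈ˡ p
  arrival-prefix (x ∷ p) {y = y} m l with y Fin.≟ x
  ... | yes q = here q
  arrival-prefix (x ∷ p) (here q)  l | no ¬q = contradiction q ¬q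
  arrival-prefix (x ∷ p) (there m) l | no ¬q = there (arrival-prefix p m (≤-pred l))

  look-∉ : ∀ {C : Set} (f : C → Bool) {e : Fin n} {π} → e ∉ˡ π → ∀ w → look f e (zip π w) ≡ false
  look-∉ f {e} {[]}    m w       = refl
  look-∉ f {e} {x ∷ π} m []      = refl
  look-∉ f {e} {x ∷ π} m (c ∷ w) with e Fin.≟ x
  ... | yes q = contradiction (here q) m
  ... | no _  = look-∉ f (m ∘ there) w

  look-arrival : ∀ (f : Colour → Bool) {π} w → Unique π → length w ≡ length π → ∀ {e} → e ∈ˡ π →
                 look f e (zip π w) ≡ f (nth w (arrival π e))
  look-arrival f {x ∷ π} (c ∷ w) (u ∷ us) l {e} m with e Fin.≟ x
  ... | yes refl = trans (cong (f c ∨_) (look-∉ f (λ k → Allₘ.lookup u k refl) w)) (∨-identityʳ (f c))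
  look-arrival f {x ∷ π} (c ∷ w) (u ∷ us) l (here q)  | no ¬q = contradiction q ¬q
  look-arrival f {x ∷ π} (c ∷ w) (u ∷ us) l (there m) | no ¬q = look-arrival f w us (suc-injective l) m

-- Independence of the accepted set

halve-mono : ∀ s {a b} → a ≤ b → halve s a ≤ halve s b
halve-mono zero    l = l
halve-mono (suc s) l = ⌊n/2⌋-mono (halve-mono s l)

module Outcome {n : ℕ} (M : Matroid n) (σ : Permutation′ n) (λ̂ : ℕ → ℕ) (λ-mono : ∀ {a b} → a ≤ b → λ̂ a ≤ λ̂ b)
               (U θ : Vec Bool n) (arr : Fin n → ℕ) where

  open Span M

  better earlier : Fin n → Fin n → Bool
  better  y x = does (pos σ y ℕ.<? pos σ x)
  earlier y x = does (arr y ℕ.<? arr x)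

  open Rule λ̂ (allFin n) indList better (lookup U) (lookup θ) earlier public

  level<top : ∀ x → level x < top
  level<top x = s≤s (λ-mono (∑-mono (allFin n) (λ y → ⟦⟧-mono {greedy y ∧ better y x} (λ e → ∧₁ e))))

  blocked : ℕ → Fin n → Fin n → Bool
  blocked s x y = sampleBelow s x y ∨ rivals s x y

  accept-free : ∀ {s x} → accept s x ≡ true → ¬ (span (blocked s x) x ≡ true)
  accept-free {s} {x} a e = true≢false e (not-true (∧₂ {eligible s x} a))

  -- The flats form a chain: what is eligible in an earlier block already lies in the flat
  -- contracted for a later one. The exemption of the last block cannot apply to `y`, since the
  -- block of `x` comes after it.
  eligible-span : ∀ {s x y} → eligible s y ≡ true → block s y < block s x → span (sampleBelow s x) y ≡ true
  eligible-span {s} {x} {y} e l with ∨-true {span (sampleUpTo s y) y} (∧₂ {lower s y} (∧₂ {isT y} e))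
  ... | inj₁ sp = span-⊆ {sampleUpTo s y} {sampleBelow s x} (λ {z} h → let (a , b) = ∧-true {isS z} h in
          ∧-intro {isS z} {does (block s z ℕ.<? block s x)} a (true-does (block s z ℕ.<? block s x) (≤-<-trans (does-true (block s z ℕ.≤? block s y) b) l))) sp
  ... | inj₂ t = contradiction (≤-trans (halve-mono s (<⇒≤ (level<top x))) (does-true (halve s top ℕ.≤? block s y) t)) (<⇒≱ l)

  module _ (arr-inj : ∀ {x y} → arr x ≡ arr y → x ≡ y) (arr-< : ∀ x → arr x < n) where

    -- The lexicographic order of block and arrival time in one number, as arrival times are below
    -- `n`.
    key : ℕ → Fin n → ℕ
    key s x = block s x * n + arr x

    key-block : ∀ s {x y} → key s y ≤ key s x → block s y ≤ block s x
    key-block s {x} {y} l = ≮⇒≥ λ b → <⇒≱ (begin-strict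
      block s x * n + arr x <⟨ +-monoʳ-< (block s x * n) (arr-< x) ⟩
      block s x * n + n     ≡⟨ +-comm (block s x * n) n ⟩
      suc (block s x) * n   ≤⟨ *-monoˡ-≤ n b ⟩
      block s y * n         ≤⟨ m≤m+n _ (arr y) ⟩
      key s y ∎) l
      where open ≤-Reasoning

    key-inj : ∀ s {x y} → key s x ≡ key s y → x ≡ y
    key-inj s {x} {y} e = arr-inj (+-cancelˡ-≡ (block s x * n) (arr x) (arr y)
      (trans e (cong (λ b → b * n + arr y) (≤-antisym (key-block s {x} {y} (≤-reflexive (sym e))) (key-block s {y} {x} (≤-reflexive e))))))

    -- Accepted elements of smaller key lie in the span of `blocked s x`, those of earlier blocks by
    -- `eligible-span` and those of the same block as rivals; an accepted `x` avoids that span.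
    accept-indep : ∀ s → Ind ⁅ accept s ∣⁆
    accept-indep s = independent (accept s) (key s) (λ _ _ → key-inj s) free (suc (halve s top) * n) bound
      where
      free : ∀ {x} → accept s x ≡ true → ¬ Spanned (λ y → accept s y ≡ true × key s y < key s x) x
      free {x} a sp = accept-free {s} {x} a (span-trans {blocked s x} {earlierAccepted}
          (λ {y} h → let (ay , l) = ∧-true {accept s y} h in inBlocked y ay (does-true (key s y ℕ.<? key s x) l))
          (⇒span (span-mono (λ {y} (ay , l) → ∧-intro {accept s y} {does (key s y ℕ.<? key s x)} ay (true-does (key s y ℕ.<? key s x) l)) sp)))
        where
        earlierAccepted : Fin n → Bool
        earlierAccepted y = accept s y ∧ does (key s y ℕ.<? key s x)
        inBlocked : ∀ y → accept s y ≡ true → key s y < key s x → span (blocked s x) y ≡ true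
        inBlocked y ay l with block s y ℕ.≟ block s x
        ... | no ¬q = span-⊆ {sampleBelow s x} {blocked s x} (λ {z} → ∨-introˡ {sampleBelow s x z}) (eligible-span {s} {x} {y} (∧₁ {eligible s y} ay)
                        (≤∧≢⇒< (key-block s {x} {y} (<⇒≤ l)) ¬q))
        ... | yes q = ∨-introˡ {blocked s x y} (∨-introʳ (sampleBelow s x y) {rivals s x y}
                        (∧-intro {eligible s y} {earlier y x ∧ does (block s y ℕ.≟ block s x)} (∧₁ {eligible s y} ay)
                          (∧-intro {earlier y x} {does (block s y ℕ.≟ block s x)}
                            (true-does (arr y ℕ.<? arr x) (+-cancelˡ-< (block s x * n) (arr y) (arr x)
                               (subst (λ b → b * n + arr y < key s x) q l)))
                            (true-does (block s y ℕ.≟ block s x) q))))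
      bound : ∀ {x} → accept s x ≡ true → key s x < suc (halve s top) * n
      bound {x} _ = begin-strict
        block s x * n + arr x   <⟨ +-monoʳ-< (block s x * n) (arr-< x) ⟩
        block s x * n + n       ≡⟨ +-comm (block s x * n) n ⟩
        suc (block s x) * n     ≤⟨ *-monoˡ-≤ n (s≤s (halve-mono s (<⇒≤ (level<top x)))) ⟩
        suc (halve s top) * n   ∎
        where open ≤-Reasoning

-- Execution of a decider

module _ {n : ℕ} (M : Matroid n) (σ : Permutation′ n) (D : Decider) where

  accepts : List (Fin n) → Fin n → Bool
  accepts p e = D (length p) (cmpView σ p) (indView M p)

  next : List (Fin n) → Subset n → Fin n → Subset n
  next p A e = if accepts p e ∧ indep M (A ∪ ⁅ e ⁆) then A ∪ ⁅ e ⁆ else A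

  run-from : List (Fin n) → List (Fin n) → Subset n → Subset n
  run-from seen []         A = A
  run-from seen (e ∷ rest) A = run-from (seen ++ [ e ]) rest (next (seen ++ [ e ]) A e)

  run-from-unique : (g : List (Fin n) → List (Fin n) → List (Fin n) → Subset n → Subset n) →
        (∀ z s A → g z s [] A ≡ A) →
        (∀ z s e r A → g z s (e ∷ r) A ≡ g z (s ++ [ e ]) r (next (s ++ [ e ]) A e)) →
        ∀ z s r A → g z s r A ≡ run-from s r A
  run-from-unique g g0 g1 z s []      A = g0 z s A
  run-from-unique g g0 g1 z s (e ∷ r) A = trans (g1 z s e r A) (run-from-unique g g0 g1 z (s ++ [ e ]) r _)

  -- The local loop of execute cannot be named: it is found by unification, once its
  -- arguments have been abstracted to distinct variables.
  mutual
    execute-loop : List (Fin n) → List (Fin n) → List (Fin n) → Subset n → Subset n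
    execute-loop = _

    execute≡run-from : ∀ arr → execute M σ D arr ≡ run-from [] arr ⊥
    execute≡run-from [] = refl
    execute≡run-from (x ∷ xs) with D 1 (cmpView σ (x ∷ [])) (indView M (x ∷ [])) ∧ indep M (⊥ ∪ ⁅ x ⁆)
    ... | b with (if b then ⊥ ∪ ⁅ x ⁆ else ⊥)
    ... | A with x ∷ xs | [ x ]
    ... | z | s = run-from-unique execute-loop (λ _ _ _ → refl) (λ _ _ _ _ _ → refl) z s xs A

  -- Since the good elements form an independent set and `A` consists of good ones, the independence
  -- test never refuses an acceptance. Hence `A` always contains every good element seen so far.
  run-from-accepts : (good : Fin n → Bool) → indep M ⁅ good ∣⁆ ≡ true → ∀ seen rest A →
    (∀ s e r → s ++ e ∷ r ≡ seen ++ rest → accepts (s ++ [ e ]) e ≡ good e) →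
    (∀ {y} → y ∈ A → good y ≡ true) → (∀ {y} → y ∈ˡ seen → good y ≡ true → y ∈ A) →
    ∀ {y} → y ∈ˡ seen ++ rest → good y ≡ true → y ∈ run-from seen rest A
  run-from-accepts good i seen []         A h I₁ I₂ {y} m g = I₂ (subst (y ∈ˡ_) (++-identityʳ seen) m) g
  run-from-accepts good i seen (e ∷ rest) A h I₁ I₂ {y} m g =
    run-from-accepts good i (seen ++ [ e ]) rest _
      (λ s f r q → h s f r (trans q (++-assoc seen [ e ] rest))) I₁′ I₂′
      (subst (y ∈ˡ_) (sym (++-assoc seen [ e ] rest)) m) g
    where
    he = h seen e rest refl
    I₁′ : ∀ {y} → y ∈ next (seen ++ [ e ]) A e → good y ≡ true
    I₁′ {y} m with bool-cases (accepts (seen ++ [ e ]) e ∧ indep M (A ∪ ⁅ e ⁆))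
    ... | inj₂ q rewrite q = I₁ m
    ... | inj₁ q rewrite q with x∈p∪q⁻ A ⁅ e ⁆ m
    ... | inj₁ a = I₁ a
    ... | inj₂ b rewrite x∈⁅y⁆⇒x≡y e b = trans (sym he) (∧₁ q)
    I₂′ : ∀ {y} → y ∈ˡ seen ++ [ e ] → good y ≡ true → y ∈ next (seen ++ [ e ]) A e
    I₂′ {y} m g with bool-cases (accepts (seen ++ [ e ]) e ∧ indep M (A ∪ ⁅ e ⁆)) | ∈-++⁻ seen m
    ... | inj₁ q | inj₁ a rewrite q = p⊆p∪q ⁅ e ⁆ (I₂ a g)
    ... | inj₁ q | inj₂ (here refl) rewrite q = x∈p∪q⁺ (inj₂ (x∈⁅x⁆ e))
    ... | inj₂ q | inj₁ a rewrite q = I₂ a g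
    ... | inj₂ q | inj₂ (here refl) = true≢false (∧-intro (trans he g)
            (indep-⊆ M (∪⁅⁆-⊆ (λ m → ∈-comp⁺ (I₁ m)) (∈-comp⁺ g)) i)) q

  execute-accepts : (good : Fin n → Bool) → indep M ⁅ good ∣⁆ ≡ true → ∀ π →
    (∀ s e r → s ++ e ∷ r ≡ π → accepts (s ++ [ e ]) e ≡ good e) →
    ∀ {y} → y ∈ˡ π → good y ≡ true → y ∈ execute M σ D π
  execute-accepts good i π h {y} m g = subst (y ∈_) (sym (execute≡run-from π))
    (run-from-accepts good i [] π ⊥ h (λ m → ⊥-elim (∉⊥ m)) (λ ()) m g)

module _ {n : ℕ} (M : Matroid n) (σ : Permutation′ n) (λ̂ : ℕ → ℕ) (λ-mono : ∀ {a b} → a ≤ b → λ̂ a ≤ λ̂ b)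
         (c : List Colour) (j : ℕ) (π : List (Fin n)) (π↭ : π ↭ allFin n) (len : length c ≡ n) where

  private
    w : List Colour
    w = arrange c
    U θ : Vec Bool n
    U = paint proj₁ (zip π w)
    θ = paint proj₂ (zip π w)
    module O = Outcome M σ λ̂ λ-mono U θ (arrival π)
    open Span M

    unique : Unique π
    unique = PermSetoid.Unique-resp-↭ (setoid (Fin n)) (↭⇒↭ₛ (↭-sym π↭)) (allFin⁺ n)

    all∈ : ∀ y → y ∈ˡ π
    all∈ y = ∈-resp-↭ (↭-sym π↭) (∈-allFin y)

    len-π : length π ≡ n
    len-π = trans (↭-length π↭) (length-tabulate id)

    len-w : length w ≡ length π
    len-w = trans (sym (↭-length (arrange-↭ c))) (trans len (sym len-π))

    U-arrival : ∀ y → lookup U y ≡ proj₁ (nth w (arrival π y))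
    U-arrival y = trans (lookup∘tabulate _ y) (look-arrival proj₁ w unique len-w (all∈ y))

    θ-arrival : ∀ y → lookup θ y ≡ proj₂ (nth w (arrival π y))
    θ-arrival y = trans (lookup∘tabulate _ y) (look-arrival proj₂ w unique len-w (all∈ y))

    -- Read contrapositively: when a candidate is judged, Q and S have been revealed completely.
    T-late : ∀ {e y} → O.isT e ≡ true → arrival π e ≤ arrival π y → O.isT y ≡ true
    T-late {e} {y} t l = trans (cong₂ _∧_ (U-arrival y) (θ-arrival y))
      (arrange-suffix c l (subst (arrival π y <_) (sym len-w) (arrival-< (all∈ y)))
        (trans (sym (cong₂ _∧_ (U-arrival e) (θ-arrival e))) t))

    module _ (s : List (Fin n)) (e : Fin n) (r : List (Fin n)) (eq : s ++ e ∷ r ≡ π) where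

      p : List (Fin n)
      p = s ++ [ e ]

      eq′ : π ≡ p ++ r
      eq′ = trans (sym eq) (sym (++-assoc s [ e ] r))

      unique′ : Unique (p ++ r)
      unique′ = subst Unique eq′ unique

      arrival-at : ∀ i → arrival π (List.lookup p i) ≡ toℕ i
      arrival-at i = trans (cong (λ q → arrival q (List.lookup p i)) eq′) (arrival-lookup p r unique′ i)

      at-prefix : ∀ {y} → arrival π y < length p → y ∈ˡ p
      at-prefix {y} l = arrival-prefix p (subst (y ∈ˡ_) eq′ (all∈ y)) (subst (λ q → arrival q y < length p) eq′ l)

      arrival-e : suc (arrival π e) ≡ length p
      arrival-e = let (x , a , b) = last-index s e in
        trans (cong suc (trans (cong (arrival π) (sym a)) (arrival-at x))) b

      before-e : ∀ {y} → arrival π y ≤ arrival π e → y ∈ˡ p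
      before-e l = at-prefix (≤-trans (s≤s l) (≤-reflexive arrival-e))

      ∑-seen : ∀ f → (∀ y → y ∉ˡ p → f y ≡ 0) → ∑ p f ≡ ∑ (allFin n) f
      ∑-seen f z = begin
        ∑ p f         ≡⟨ sym (+-identityʳ _) ⟩
        ∑ p f + 0     ≡⟨ cong (∑ p f +_) (sym rest-zero) ⟩
        ∑ p f + ∑ r f ≡⟨ sym (∑-++ p r f) ⟩
        ∑ (p ++ r) f  ≡⟨ cong (λ q → ∑ q f) (sym eq′) ⟩
        ∑ π f         ≡⟨ ∑-↭ f π↭ ⟩
        ∑ (allFin n) f ∎
        where
        open ≡-Reasoning
        disjoint : ∀ (p r : List (Fin n)) → Unique (p ++ r) → All (_∉ˡ p) r
        disjoint []      r u        = Allₘ.universal (λ _ ()) r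
        disjoint (x ∷ p) r (u ∷ us) = Allₘ.zipWith
          (λ { {y} (x≢ , y∉) (here q) → x≢ (sym q) ; {y} (x≢ , y∉) (there m) → y∉ m })
          (Allₘ.tabulate (λ m → Allₘ.lookup u (∈-++⁺ʳ p m)) , disjoint p r us)
        rest-zero : ∑ r f ≡ 0
        rest-zero = trans (∑-congAll (disjoint p r unique′) z) (∑-zero r)

      -- `viewed` passes from arrival positions to elements, `restricted` from the prefix to the
      -- ground set. The latter needs Q and S inside the prefix, which is guaranteed only for a
      -- candidate; any other `e` is rejected by both rules outright.
      accepts-eq : accepts M σ (decider λ̂ c j) p e ≡ O.decide j e
      accepts-eq = trans viewed restricted
        where
        x = proj₁ (last-index s e)
        viewed : accepts M σ (decider λ̂ c j) p e ≡
                 Rule.decide λ̂ p indList O.better (lookup U) (lookup θ) O.earlier j e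
        viewed = begin
          decider λ̂ c j (length p) (cmpView σ p) (indView M p)
            ≡⟨ decider-last λ̂ c j (cmpView σ p) (indView M p) x (proj₂ (proj₂ (last-index s e))) ⟩
          viewRule λ̂ c j (length p) (cmpView σ p) (indView M p) x
            ≡⟨ sym (Reindex.decide-map (List.lookup p) λ̂ (allFin (length p)) _ indList _ O.better _ _ (lookup U) (lookup θ) _ O.earlier
                 (λ I → cong (indep M) (sym (image-fromList p I))) (λ _ _ → refl)
                 (λ i → trans (U-arrival _) (cong (proj₁ ∘ nth w) (arrival-at i)))
                 (λ i → trans (θ-arrival _) (cong (proj₂ ∘ nth w) (arrival-at i)))
                 (λ i i′ → cong₂ (λ a b → does (a ℕ.<? b)) (arrival-at i) (arrival-at i′)) j x) ⟩
          Rule.decide λ̂ (map (List.lookup p) (allFin (length p))) indList O.better (lookup U) (lookup θ) O.earlier j (List.lookup p x)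
            ≡⟨ cong₂ (λ q y → Rule.decide λ̂ q indList O.better (lookup U) (lookup θ) O.earlier j y)
                 (map-lookup-allFin p) (proj₁ (proj₂ (last-index s e))) ⟩
          Rule.decide λ̂ p indList O.better (lookup U) (lookup θ) O.earlier j e ∎
          where open ≡-Reasoning
        restricted : Rule.decide λ̂ p indList O.better (lookup U) (lookup θ) O.earlier j e ≡ O.decide j e
        restricted with bool-cases (O.isT e)
        ... | inj₂ nt rewrite nt = refl
        ... | inj₁ t = Restrict.decide-restrict M λ̂ p O.better (lookup U) (lookup θ) O.earlier ∑-seen
              (λ {y} q → late (λ ty → true≢false (∧₁ {lookup U y} ty) q))
              (λ {y} u b → late (λ ty → true≢false (∧₂ {lookup U y} ty) b))
              j e (λ {y} l → before-e (<⇒≤ (does-true (arrival π y ℕ.<? arrival π e) l)))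
          where
          late : ∀ {y} → ¬ (O.isT y ≡ true) → y ∈ˡ p
          late {y} ¬t = before-e (≮⇒≥ λ l → ¬t (T-late {e} {y} t (<⇒≤ l)))

  execute-decides : ∀ {e} → Outcome.decide M σ λ̂ λ-mono (paint proj₁ (zip π (arrange c))) (paint proj₂ (zip π (arrange c))) (arrival π) j e ≡ true →
                    e ∈ execute M σ (decider λ̂ c j) π
  execute-decides {e} = execute-accepts M σ (decider λ̂ c j) (O.decide j)
    (O.accept-indep (λ {x} {y} → arrival-inj (all∈ x) (all∈ y)) (λ x → subst (arrival π x <_) len-π (arrival-< (all∈ x))) (j % suc O.scales))
    π accepts-eq (all∈ e)

-- Arithmetic of dyadic blocks

∑< : ℕ → (ℕ → ℕ) → ℕ
∑< zero    f = 0
∑< (suc J) f = ∑< J f + f J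

-- An odd `b` is the second of its pair. So for an element in an upper half, the end of its block is
-- the same at two consecutive scales.
⌊/2⌋-odd : ∀ a b → even b ≡ false → ⌊ a /2⌋ ≤ ⌊ b /2⌋ → a ≤ b
⌊/2⌋-odd zero          b             o l = z≤n
⌊/2⌋-odd (suc zero)    (suc b)       o l = s≤s z≤n
⌊/2⌋-odd (suc (suc a)) (suc (suc b)) o l = s≤s (s≤s (⌊/2⌋-odd a b o (≤-pred l)))

⌊/2⌋-even : ∀ a b → even a ≡ true → even b ≡ true → ⌊ a /2⌋ ≡ ⌊ b /2⌋ → a ≡ b
⌊/2⌋-even zero          zero          p q e = refl
⌊/2⌋-even zero          (suc zero)    p () e
⌊/2⌋-even zero          (suc (suc b)) p q ()
⌊/2⌋-even (suc (suc a)) (suc (suc b)) p q e = cong (2 +_) (⌊/2⌋-even a b p q (suc-injective e))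

⌊/2⌋-cancel-< : ∀ {a b} → ⌊ a /2⌋ < ⌊ b /2⌋ → a < b
⌊/2⌋-cancel-< l = ≰⇒> (λ k → <⇒≱ l (⌊n/2⌋-mono k))

log-halve : ∀ s a → ⌊log₂ halve s a ⌋ ≡ ⌊log₂ a ⌋ ∸ s
log-halve zero    a = refl
log-halve (suc s) a = trans (⌊log₂⌊n/2⌋⌋≡⌊log₂n⌋∸1 (halve s a))
  (trans (cong (_∸ 1) (log-halve s a)) (trans (∸-+-assoc ⌊log₂ a ⌋ s 1) (cong (⌊log₂ a ⌋ ∸_) (+-comm s 1))))

halve-log : ∀ a → halve (suc ⌊log₂ a ⌋) a ≡ 0
halve-log a = small (halve ⌊log₂ a ⌋ a) (trans (log-halve ⌊log₂ a ⌋ a) (n∸n≡0 ⌊log₂ a ⌋))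
  where
  small : ∀ b → ⌊log₂ b ⌋ ≡ 0 → ⌊ b /2⌋ ≡ 0
  small zero          e = refl
  small (suc zero)    e = refl
  small (suc (suc b)) e = ⊥-elim (1+n≰n (≤-trans (⌊log₂⌋-mono-≤ {2} {suc (suc b)} (s≤s (s≤s z≤n))) (≤-reflexive e)))

∑-allFin-suc : ∀ n (f : Fin (suc n) → ℕ) → ∑ (allFin (suc n)) f ≡ f zero + ∑ (allFin n) (f ∘ suc)
∑-allFin-suc n f = cong (f zero +_) (trans (cong (λ l → ∑ l f) (sym (map-tabulate id suc))) (∑-map suc (allFin n) f))

∑-single : ∀ {n} (x : Fin n) → ∑ (allFin n) (λ z → ⟦ does (z Fin.≟ x) ⟧) ≡ 1
∑-single {suc n} zero    = trans (∑-allFin-suc n (λ z → ⟦ does (z Fin.≟ zero) ⟧)) (cong suc (∑-zero (allFin n)))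
∑-single {suc n} (suc x) = trans (∑-allFin-suc n (λ z → ⟦ does (z Fin.≟ suc x) ⟧)) (∑-single x)

pos-injective : ∀ {n} (σ : Permutation′ n) {x y} → pos σ x ≡ pos σ y → x ≡ y
pos-injective σ q = trans (sym (inverseʳ σ)) (trans (cong (σ ⟨$⟩ʳ_) (Finₚ.toℕ-injective q)) (inverseʳ σ))

-- Exchange and telescoping for a fixed first sample

module FixedQ {n : ℕ} (M : Matroid n) (σ : Permutation′ n) (λ̂ : ℕ → ℕ) (λ-mono : ∀ {a b} → a ≤ b → λ̂ a ≤ λ̂ b)
              (U : Vec Bool n) where

  open Span M

  module O (θ : Vec Bool n) (arr : Fin n → ℕ) = Outcome M σ λ̂ λ-mono U θ arr

  private
    -- Levels and blocks depend on `U` only, so arbitrary bits and arrival times serve as arguments.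
    module L = Outcome M σ λ̂ λ-mono U U (λ _ → 0)
  open L using (better; greedy; count; total; level; top; scales; block; level<top) public

  sample cand : Vec Bool n → Fin n → Bool
  sample θ y = lookup U y ∧ not (lookup θ y)
  cand   θ y = lookup U y ∧ lookup θ y

  reach : ℕ → Vec Bool n → Fin n → Bool
  reach s θ e = span (λ y → sample θ y ∧ does (block s y ℕ.≤? block s e)) e ∨ does (halve s top ℕ.≤? block s e)

  -- An overestimate of what blocks `e` that mentions no arrival times: S before the block at scale
  -- `suc s`, and all other candidates of the half block of `e`, early or late, eligible or not.
  before around obstacle : ℕ → Vec Bool n → Fin n → Fin n → Bool
  before   s θ e y = sample θ y ∧ does (block (suc s) y ℕ.<? block (suc s) e)
  around   s θ e y = cand θ y ∧ (does (block s y ℕ.≟ block s e) ∧ not (does (y Fin.≟ e)))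
  obstacle s θ e y = before s θ e y ∨ around s θ e y

  -- At scale s + 1 the element e can only be lost to the candidates of its own half block.
  safe : ℕ → Vec Bool n → Fin n → Bool
  safe s θ e = even (block s e) ∧ (reach (suc s) θ e ∧ not (span (obstacle s θ e) e))

  -- Rivals lie in the lower half of the block, as does `e`; hence they share its block at scale `s`
  -- and belong to `around`.
  safe-accepted : ∀ {s θ e} arr → cand θ e ≡ true → safe s θ e ≡ true → O.accept θ arr (suc s) e ≡ true
  safe-accepted {s} {θ} {e} arr t sf = ∧-intro {P.eligible (suc s) e} {not (span (P.blocked (suc s) e) e)}
      (∧-intro {P.isT e} {P.lower (suc s) e ∧ reach (suc s) θ e} t (∧-intro {even (block s e)} {reach (suc s) θ e} ev rc))
      (cong not (blocked-free (span (P.blocked (suc s) e) e) refl))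
    where
    module P = O θ arr
    ev = ∧₁ {even (block s e)} sf
    rc = ∧₁ {reach (suc s) θ e} (∧₂ {even (block s e)} sf)
    ns = not-true (∧₂ {reach (suc s) θ e} (∧₂ {even (block s e)} sf))
    sub : ∀ {y} → P.blocked (suc s) e y ≡ true → obstacle s θ e y ≡ true
    sub {y} b with ∨-true {P.sampleBelow (suc s) e y} b
    ... | inj₁ sb = ∨-introˡ {before s θ e y} sb
    ... | inj₂ rv = ∨-introʳ (before s θ e y) {around s θ e y}
      (∧-intro {cand θ y} {does (block s y ℕ.≟ block s e) ∧ not (does (y Fin.≟ e))}
        (∧₁ {P.isT y} el)
        (∧-intro {does (block s y ℕ.≟ block s e)} {not (does (y Fin.≟ e))}
          (true-does (block s y ℕ.≟ block s e) (⌊/2⌋-even (block s y) (block s e)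
            (∧₁ {P.lower (suc s) y} (∧₂ {P.isT y} el)) ev
            (does-true (block (suc s) y ℕ.≟ block (suc s) e) (∧₂ {P.earlier y e} ee))))
          ne))
      where
      el = ∧₁ {P.eligible (suc s) y} rv
      ee = ∧₂ {P.eligible (suc s) y} rv
      ne : not (does (y Fin.≟ e)) ≡ true
      ne with y Fin.≟ e
      ... | no _ = refl
      ... | yes refl = contradiction (does-true (arr e ℕ.<? arr e) (∧₁ {P.earlier e e} ee)) (<-irrefl refl)
    blocked-free : ∀ b → span (P.blocked (suc s) e) e ≡ b → b ≡ false
    blocked-free false _ = refl
    blocked-free true  q = true≢false (span-⊆ {P.blocked (suc s) e} {obstacle s θ e} (λ {y} → sub {y}) q) ns

  -- Flips everything from the start of the block on, except `e`, which must remain a candidate.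
  mask : ℕ → Fin n → Vec Bool n
  mask s e = tabulate (λ y → does (block (suc s) e ℕ.≤? block (suc s) y) ∧ not (does (y Fin.≟ e)))

  swapped : ℕ → Fin n → Vec Bool n → Vec Bool n
  swapped s e θ = zipWith _xor_ (mask s e) θ

  swapped-lookup : ∀ s e θ y → lookup (swapped s e θ) y ≡
                   (does (block (suc s) e ℕ.≤? block (suc s) y) ∧ not (does (y Fin.≟ e))) xor lookup θ y
  swapped-lookup s e θ y = trans (lookup-zipWith _xor_ y (mask s e) θ)
    (cong (_xor lookup θ y) (lookup∘tabulate _ y))

  swapped-self : ∀ s e θ → lookup (swapped s e θ) e ≡ lookup θ e
  swapped-self s e θ with does (block (suc s) e ℕ.≤? block (suc s) e) | e Fin.≟ e | swapped-lookup s e θ e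
  ... | _     | no ¬q | _ = contradiction refl ¬q
  ... | false | yes _ | q = q
  ... | true  | yes _ | q = q

  -- Exchanging S and T beyond the block start turns the obstacle into a part of S.
  obstacle-sample : ∀ s e θ {y} → obstacle s θ e y ≡ true →
                    sample (swapped s e θ) y ∧ does (block s y ℕ.≤? block s e) ≡ true
  obstacle-sample s e θ {y} o with ∨-true {before s θ e y} o
  ... | inj₁ b = ∧-intro {sample (swapped s e θ) y} {does (block s y ℕ.≤? block s e)}
        (trans (cong (λ t → lookup U y ∧ not t) same) sm)
        (true-does (block s y ℕ.≤? block s e) (<⇒≤ (⌊/2⌋-cancel-< lt)))
    where
    sm = ∧₁ {sample θ y} b
    lt = does-true (block (suc s) y ℕ.<? block (suc s) e) (∧₂ {sample θ y} b)
    same : lookup (swapped s e θ) y ≡ lookup θ y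
    same with bool-cases (does (block (suc s) e ℕ.≤? block (suc s) y))
    ... | inj₁ q = contradiction (does-true (block (suc s) e ℕ.≤? block (suc s) y) q) (<⇒≱ lt)
    ... | inj₂ q = trans (swapped-lookup s e θ y) (cong (λ t → (t ∧ not (does (y Fin.≟ e))) xor lookup θ y) q)
  ... | inj₂ a = ∧-intro {sample (swapped s e θ) y} {does (block s y ℕ.≤? block s e)}
        (∧-intro {lookup U y} {not (lookup (swapped s e θ) y)} u (cong not flipped))
        (true-does (block s y ℕ.≤? block s e) (≤-reflexive eq))
    where
    u  = ∧₁ {lookup U y} (∧₁ {cand θ y} a)
    t  = ∧₂ {lookup U y} (∧₁ {cand θ y} a)
    eq = does-true (block s y ℕ.≟ block s e) (∧₁ {does (block s y ℕ.≟ block s e)} (∧₂ {cand θ y} a))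
    ne = ∧₂ {does (block s y ℕ.≟ block s e)} (∧₂ {cand θ y} a)
    flipped : lookup (swapped s e θ) y ≡ false
    flipped = trans (swapped-lookup s e θ y) (cong₂ _xor_
      (∧-intro {does (block (suc s) e ℕ.≤? block (suc s) y)} {not (does (y Fin.≟ e))}
        (true-does (block (suc s) e ℕ.≤? block (suc s) y) (≤-reflexive (cong ⌊_/2⌋ (sym eq)))) ne) t)

  -- A reached but unsafe `e` in a lower half is spanned by its obstacle. After the exchange the
  -- obstacle is part of S up to the middle of the block, that is, up to the end of the block at
  -- scale `s`.
  reach-step : ∀ s e θ → ⟦ lookup θ e ∧ reach (suc s) θ e ⟧ ≤
               ⟦ lookup θ e ∧ safe s θ e ⟧ + ⟦ lookup (swapped s e θ) e ∧ reach s (swapped s e θ) e ⟧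
               ⊎ even (block s e) ≡ false
  reach-step s e θ with bool-cases (even (block s e))
  ... | inj₂ o  = inj₂ o
  ... | inj₁ ev with bool-cases (lookup θ e ∧ reach (suc s) θ e)
  ... | inj₂ z = inj₁ (≤-trans (≤-reflexive (cong ⟦_⟧ z)) z≤n)
  ... | inj₁ h with bool-cases (span (obstacle s θ e) e)
  ... | inj₂ ns = inj₁ (≤-trans (⟦⟧-mono {lookup θ e ∧ reach (suc s) θ e} {lookup θ e ∧ safe s θ e} (λ _ →
          ∧-intro {lookup θ e} {safe s θ e} (∧₁ {lookup θ e} h)
            (∧-intro {even (block s e)} {reach (suc s) θ e ∧ not (span (obstacle s θ e) e)} ev
              (∧-intro {reach (suc s) θ e} {not (span (obstacle s θ e) e)} (∧₂ {lookup θ e} h) (cong not ns)))))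
          (m≤m+n ⟦ lookup θ e ∧ safe s θ e ⟧ _))
  ... | inj₁ sp = inj₁ (≤-trans (⟦⟧-mono {lookup θ e ∧ reach (suc s) θ e}
          {lookup (swapped s e θ) e ∧ reach s (swapped s e θ) e} (λ _ →
          ∧-intro {lookup (swapped s e θ) e} {reach s (swapped s e θ) e}
            (trans (swapped-self s e θ) (∧₁ {lookup θ e} h))
            (∨-introˡ {span (λ y → sample (swapped s e θ) y ∧ does (block s y ℕ.≤? block s e)) e}
              (span-⊆ {obstacle s θ e} {λ y → sample (swapped s e θ) y ∧ does (block s y ℕ.≤? block s e)}
                (λ {y} → obstacle-sample s e θ {y}) sp))))
          (m≤n+m _ ⟦ lookup θ e ∧ safe s θ e ⟧))

  reach-odd : ∀ s e θ → even (block s e) ≡ false → reach (suc s) θ e ≡ true → reach s θ e ≡ true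
  reach-odd s e θ o r with ∨-true {span (λ y → sample θ y ∧ does (block (suc s) y ℕ.≤? block (suc s) e)) e} r
  ... | inj₁ sp = ∨-introˡ {span (λ y → sample θ y ∧ does (block s y ℕ.≤? block s e)) e}
      (span-⊆ {λ y → sample θ y ∧ does (block (suc s) y ℕ.≤? block (suc s) e)} {λ y → sample θ y ∧ does (block s y ℕ.≤? block s e)}
        (λ {y} h → ∧-intro {sample θ y} {does (block s y ℕ.≤? block s e)} (∧₁ {sample θ y} h)
          (true-does (block s y ℕ.≤? block s e) (⌊/2⌋-odd (block s y) (block s e) o
            (does-true (block (suc s) y ℕ.≤? block (suc s) e) (∧₂ {sample θ y} h))))) sp)
  ... | inj₂ t = ∨-introʳ (span (λ y → sample θ y ∧ does (block s y ℕ.≤? block s e)) e)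
      (true-does (halve s top ℕ.≤? block s e) (⌊/2⌋-odd (halve s top) (block s e) o
        (does-true (halve (suc s) top ℕ.≤? block (suc s) e) t)))

  private
    ∑θ : (Vec Bool n → ℕ) → ℕ
    ∑θ = ∑ (vecs coin n)

  reach-sum : ∀ s e → ∑θ (λ θ → ⟦ lookup θ e ∧ reach (suc s) θ e ⟧) ≤
              ∑θ (λ θ → ⟦ lookup θ e ∧ reach s θ e ⟧) + ∑θ (λ θ → ⟦ lookup θ e ∧ safe s θ e ⟧)
  reach-sum s e with bool-cases (even (block s e))
  ... | inj₂ o = ≤-trans (∑-mono (vecs coin n) (λ θ → ⟦⟧-mono {lookup θ e ∧ reach (suc s) θ e} {lookup θ e ∧ reach s θ e} (λ h →
          ∧-intro {lookup θ e} {reach s θ e} (∧₁ {lookup θ e} h) (reach-odd s e θ o (∧₂ {lookup θ e} h)))))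
        (m≤m+n _ _)
  ... | inj₁ ev = begin
    ∑θ (λ θ → ⟦ lookup θ e ∧ reach (suc s) θ e ⟧)
      ≤⟨ ∑-mono (vecs coin n) (λ θ → pick θ (reach-step s e θ)) ⟩
    ∑θ (λ θ → f (swapped s e θ) + g θ)
      ≡⟨ ∑-+ (vecs coin n) (λ θ → f (swapped s e θ)) g ⟩
    ∑θ (λ θ → f (swapped s e θ)) + ∑θ g
      ≡⟨ cong (_+ ∑θ g) (∑-coin-xor (mask s e) f) ⟩
    ∑θ f + ∑θ g ∎
    where
    open ≤-Reasoning
    f g : Vec Bool n → ℕ
    f θ = ⟦ lookup θ e ∧ reach s θ e ⟧
    g θ = ⟦ lookup θ e ∧ safe s θ e ⟧
    pick : ∀ θ → ⟦ lookup θ e ∧ reach (suc s) θ e ⟧ ≤ g θ + f (swapped s e θ) ⊎ even (block s e) ≡ false →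
           ⟦ lookup θ e ∧ reach (suc s) θ e ⟧ ≤ f (swapped s e θ) + g θ
    pick θ (inj₁ l) = ≤-trans l (≤-reflexive (+-comm (g θ) (f (swapped s e θ))))
    pick θ (inj₂ o) = true≢false ev o

  reach-telescope : ∀ J e → ∑θ (λ θ → ⟦ lookup θ e ∧ reach J θ e ⟧) ≤
                    ∑θ (λ θ → ⟦ lookup θ e ∧ reach 0 θ e ⟧) + ∑< J (λ s → ∑θ (λ θ → ⟦ lookup θ e ∧ safe s θ e ⟧))
  reach-telescope zero    e = m≤m+n _ 0
  reach-telescope (suc J) e = ≤-trans (reach-sum J e) (≤-trans (+-monoˡ-≤ _ (reach-telescope J e))
    (≤-reflexive (+-assoc (∑θ (λ θ → ⟦ lookup θ e ∧ reach 0 θ e ⟧)) _ _)))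

  -- At the top scale the only block counts as the last one, so every element is reached there and
  -- the telescope starts from probability one.
  safe-total : ∀ e → ∑θ (λ θ → ⟦ lookup θ e ⟧) ≤
               ∑θ (λ θ → ⟦ lookup θ e ∧ reach 0 θ e ⟧) + ∑< scales (λ s → ∑θ (λ θ → ⟦ lookup θ e ∧ safe s θ e ⟧))
  safe-total e = ≤-trans (∑-mono (vecs coin n) (λ θ → ⟦⟧-mono {lookup θ e} {lookup θ e ∧ reach scales θ e} (λ t →
      ∧-intro {lookup θ e} {reach scales θ e} t
        (∨-introʳ (span (λ y → sample θ y ∧ does (block scales y ℕ.≤? block scales e)) e)
          (true-does (halve scales top ℕ.≤? block scales e) (≤-trans (≤-reflexive (halve-log top)) z≤n))))))
    (reach-telescope scales e)

  reach₀-span : ∀ {θ e} → reach 0 θ e ≡ true → span (λ y → sample θ y ∧ does (level y ℕ.≤? level e)) e ≡ true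
  reach₀-span {θ} {e} r with ∨-true {span (λ y → sample θ y ∧ does (level y ℕ.≤? level e)) e} r
  ... | inj₁ sp = sp
  ... | inj₂ t  = contradiction (does-true (top ℕ.≤? level e) t) (<⇒≱ (level<top e))

  others : Fin n → Fin n → Fin n → Bool
  others x e y = better y x ∧ not (does (y Fin.≟ e))

  not-self : ∀ {θ e y} → lookup θ e ≡ true → sample θ y ≡ true → not (does (y Fin.≟ e)) ≡ true
  not-self {θ} {e} {y} t s with y Fin.≟ e
  ... | no _     = refl
  ... | yes refl = true≢false t (not-true (∧₂ {lookup U e} s))

  better-trans : ∀ {x y z} → better x y ≡ true → better y z ≡ true → better x z ≡ true
  better-trans {x} {y} {z} a b = true-does (pos σ x ℕ.<? pos σ z)
    (<-trans (does-true (pos σ x ℕ.<? pos σ y) a) (does-true (pos σ y ℕ.<? pos σ z) b))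

  -- The element `x` lies between `e` and `y` in the order, so it is counted for `y` and not for
  -- `e`.
  count-suc : ∀ {e x y} → greedy x ≡ true → better e x ≡ true → better x y ≡ true → suc (count e) ≤ count y
  count-suc {e} {x} {y} gx ex xy = begin
    suc (count e)
      ≡⟨ cong (_+ count e) (sym (∑-single x)) ⟩
    ∑ (allFin n) (λ z → ⟦ does (z Fin.≟ x) ⟧) + count e
      ≡⟨ sym (∑-+ (allFin n) (λ z → ⟦ does (z Fin.≟ x) ⟧) (λ z → ⟦ greedy z ∧ better z e ⟧)) ⟩
    ∑ (allFin n) (λ z → ⟦ does (z Fin.≟ x) ⟧ + ⟦ greedy z ∧ better z e ⟧)
      ≤⟨ ∑-mono (allFin n) pt ⟩
    count y ∎
    where
    open ≤-Reasoning
    pt : ∀ z → ⟦ does (z Fin.≟ x) ⟧ + ⟦ greedy z ∧ better z e ⟧ ≤ ⟦ greedy z ∧ better z y ⟧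
    pt z with z Fin.≟ x
    ... | no _ = ⟦⟧-mono {greedy z ∧ better z e} {greedy z ∧ better z y} (λ h → let (g , b) = ∧-true {greedy z} h in
            ∧-intro {greedy z} {better z y} g (better-trans {z} {e} {y} b (better-trans {e} {x} {y} ex xy)))
    ... | yes refl with bool-cases (greedy z ∧ better z e)
    ... | inj₂ q = subst (λ b → suc ⟦ b ⟧ ≤ ⟦ greedy z ∧ better z y ⟧) (sym q)
            (⟦⟧-mono {true} {greedy z ∧ better z y} (λ _ → ∧-intro {greedy z} {better z y} gx xy))
    ... | inj₁ q = contradiction (<-trans (does-true (pos σ e ℕ.<? pos σ z) ex)
            (does-true (pos σ z ℕ.<? pos σ e) (∧₂ {greedy z} q))) (<-irrefl refl)

  -- If the first element x completing a circuit through e is in Q, then no level up to that of e reaches x.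
  reach₀-guarded : ∀ {θ e x} → lookup U e ≡ true → lookup θ e ≡ true → lookup U x ≡ false → better e x ≡ true →
                   span (others x e) x ≡ false → span (others x e) e ≡ false →
                   λ̂ (count e) < λ̂ (suc (count e)) → reach 0 θ e ≡ false
  reach₀-guarded {θ} {e} {x} ue te ux ex fx fe strict with bool-cases (reach 0 θ e)
  ... | inj₂ f = f
  ... | inj₁ r = true≢false (span-⊆ {λ y → sample θ y ∧ does (level y ℕ.≤? level e)} {others x e} (λ {y} → sub {y}) (reach₀-span {θ} {e} r)) fe
    where
    -- Since `e` is not in Q, the elements of Q before `x` are among `others x e`, which do not span
    -- `x`.
    gx : greedy x ≡ true
    gx with bool-cases (span (λ z → not (lookup U z) ∧ better z x) x)
    ... | inj₂ f = ∧-intro {not (lookup U x)} {not (span (λ z → not (lookup U z) ∧ better z x) x)} (cong not ux) (cong not f)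
    ... | inj₁ t = true≢false (span-⊆ {λ z → not (lookup U z) ∧ better z x} {others x e} (λ {z} h →
            let (q , b) = ∧-true {not (lookup U z)} h in ∧-intro {better z x} {not (does (z Fin.≟ e))} b (ne z q)) t) fx
      where
      ne : ∀ z → not (lookup U z) ≡ true → not (does (z Fin.≟ e)) ≡ true
      ne z q with z Fin.≟ e
      ... | no _     = refl
      ... | yes refl = true≢false ue (not-true q)
    sub : ∀ {y} → sample θ y ∧ does (level y ℕ.≤? level e) ≡ true → others x e y ≡ true
    sub {y} h = ∧-intro {better y x} {not (does (y Fin.≟ e))} yx (not-self {θ} {e} {y} te sm)
      where
      sm = ∧₁ {sample θ y} h
      lv = does-true (level y ℕ.≤? level e) (∧₂ {sample θ y} h)
      y≢x : y ≢ x
      y≢x refl = true≢false (∧₁ {lookup U y} sm) ux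
      yx : better y x ≡ true
      yx with pos σ y ℕ.<? pos σ x
      ... | yes l = true-does (pos σ y ℕ.<? pos σ x) l
      -- An element after `x` has the greedy element `x` in front of it, and the strict jump of `λ̂`
      -- at the count of `e` puts its level above that of `e`.
      ... | no ¬l = contradiction (≤-trans strict (λ-mono (count-suc {e} {x} {y} gx ex
            (true-does (pos σ x ℕ.<? pos σ y) (≤∧≢⇒< (≮⇒≥ ¬l) (λ q → y≢x (pos-injective σ (sym q))))))))
            (≤⇒≯ lv)

  reach₀-coloop : ∀ {θ e} → lookup θ e ≡ true → span (λ y → not (does (y Fin.≟ e))) e ≡ false → reach 0 θ e ≡ false
  reach₀-coloop {θ} {e} te fe with bool-cases (reach 0 θ e)
  ... | inj₂ f = f
  ... | inj₁ r = true≢false (span-⊆ {λ y → sample θ y ∧ does (level y ℕ.≤? level e)} {λ y → not (does (y Fin.≟ e))}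
          (λ {y} h → not-self {θ} {e} {y} te (∧₁ {sample θ y} h)) (reach₀-span {θ} {e} r)) fe

  -- Scale 0: greedy selection inside one level, after contracting the previous levels.

  fast : ℕ → Vec Bool n → Fin n → Bool
  fast κ θ e = cand θ e ∧ span (λ y → sample θ y ∧ does (level y ℕ.≤? κ)) e

  module _ (θ : Vec Bool n) (arr : Fin n → ℕ) (κ : ℕ) where
    private module P = O θ arr

    accepted : Fin n → Bool
    accepted x = P.accept 0 x ∧ does (level x ℕ.≟ κ)

    module _ (R : Subset n) (low : ∀ {y} → level y < κ → span (lookup R) y ≡ true) where

      hull : Subset n
      hull = ⁅ (λ y → lookup R y ∨ accepted y) ∣⁆

      hull-lookup : ∀ y → lookup hull y ≡ lookup R y ∨ accepted y
      hull-lookup y = lookup∘tabulate _ y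

      -- Induction on the arrival time: a rejected eligible element is spanned by S of lower level,
      -- which lies in the span of `R`, and by earlier eligible elements of its own level.
      eligible-spanned : ∀ {x} → Acc _<_ (arr x) → P.eligible 0 x ≡ true → level x ≡ κ → span (lookup hull) x ≡ true
      eligible-spanned {x} (acc rs) el q with bool-cases (P.accept 0 x)
      ... | inj₁ a = ⇒span (inj₁ (trans (hull-lookup x) (∨-introʳ (lookup R x) (∧-intro {P.accept 0 x} {does (level x ℕ.≟ κ)} a (true-does (level x ℕ.≟ κ) q)))))
      ... | inj₂ na = span-trans {lookup hull} {P.blocked 0 x} (λ {y} → sub {y}) blk
        where
        blk : span (P.blocked 0 x) x ≡ true
        blk with bool-cases (span (P.blocked 0 x) x)
        ... | inj₁ b  = b
        ... | inj₂ nb = true≢false (∧-intro {P.eligible 0 x} {not (span (P.blocked 0 x) x)} el (cong not nb)) na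
        sub : ∀ {y} → P.blocked 0 x y ≡ true → span (lookup hull) y ≡ true
        sub {y} b with ∨-true {P.sampleBelow 0 x y} b
        ... | inj₁ sb = span-⊆ {lookup R} {lookup hull} (λ {z} h → trans (hull-lookup z) (∨-introˡ h))
                (low (≤-trans (does-true (level y ℕ.<? level x) (∧₂ {P.isS y} sb)) (≤-reflexive q)))
        ... | inj₂ rv = eligible-spanned {y}
                (rs (does-true (arr y ℕ.<? arr x) (∧₁ {P.earlier y x} (∧₂ {P.eligible 0 y} rv))))
                (∧₁ {P.eligible 0 y} rv)
                (trans (does-true (level y ℕ.≟ level x) (∧₂ {P.earlier y x} (∧₂ {P.eligible 0 y} rv))) q)

      -- The fast elements of level below `κ` are independent in the span of `R`, and those of level
      -- `κ` in the span of `R` and the accepted ones. Each of the two parts costs one copy of the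
      -- size of `R`.
      fast-size : ∀ (E : Subset n) → Ind E → (∀ {e} → e ∈ E → level e ≤ κ) →
                  ∑ (allFin n) (λ e → ⟦ lookup E e ∧ fast κ θ e ⟧) ≤ ∑ (allFin n) (λ x → ⟦ accepted x ⟧) + (∣ R ∣ + ∣ R ∣)
      fast-size E iE lvE = begin
        ∑ (allFin n) (λ e → ⟦ lookup E e ∧ fast κ θ e ⟧)
          ≤⟨ ∑-mono (allFin n) split ⟩
        ∑ (allFin n) (λ e → ⟦ lookup lo e ⟧ + ⟦ lookup hi e ⟧)
          ≡⟨ ∑-+ (allFin n) (λ e → ⟦ lookup lo e ⟧) (λ e → ⟦ lookup hi e ⟧) ⟩
        ∑ (allFin n) (λ e → ⟦ lookup lo e ⟧) + ∑ (allFin n) (λ e → ⟦ lookup hi e ⟧)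
          ≡⟨ cong₂ _+_ (sym (∣∣≡∑ lo)) (sym (∣∣≡∑ hi)) ⟩
        ∣ lo ∣ + ∣ hi ∣
          ≤⟨ +-mono-≤ (spanned-size {lo} {R} (indep-⊆ M lo⊆ iE) lo-span) (spanned-size {hi} {hull} (indep-⊆ M hi⊆ iE) hi-span) ⟩
        ∣ R ∣ + ∣ hull ∣
          ≤⟨ +-monoʳ-≤ ∣ R ∣ hull-size ⟩
        ∣ R ∣ + (∣ R ∣ + ∑ (allFin n) (λ x → ⟦ accepted x ⟧))
          ≡⟨ trans (sym (+-assoc ∣ R ∣ ∣ R ∣ _)) (+-comm (∣ R ∣ + ∣ R ∣) _) ⟩
        ∑ (allFin n) (λ x → ⟦ accepted x ⟧) + (∣ R ∣ + ∣ R ∣) ∎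
        where
        open ≤-Reasoning
        loᵇ hiᵇ : Fin n → Bool
        loᵇ e = (lookup E e ∧ fast κ θ e) ∧ does (level e ℕ.<? κ)
        hiᵇ e = (lookup E e ∧ fast κ θ e) ∧ does (level e ℕ.≟ κ)
        lo hi : Subset n
        lo = ⁅ loᵇ ∣⁆
        hi = ⁅ hiᵇ ∣⁆
        inE : ∀ {e} → lookup E e ∧ fast κ θ e ≡ true → e ∈ E
        inE {e} h = lookup⇒∈ (∧₁ {lookup E e} h)
        lo⊆ : lo ⊆ E
        lo⊆ {e} m = inE {e} (∧₁ {lookup E e ∧ fast κ θ e} (∈-comp⁻ {f = loᵇ} m))
        hi⊆ : hi ⊆ E
        hi⊆ {e} m = inE {e} (∧₁ {lookup E e ∧ fast κ θ e} (∈-comp⁻ {f = hiᵇ} m))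
        lo-span : ∀ {e} → e ∈ lo → span (lookup R) e ≡ true
        lo-span {e} m = low (does-true (level e ℕ.<? κ) (∧₂ {lookup E e ∧ fast κ θ e} (∈-comp⁻ {f = loᵇ} m)))
        hi-span : ∀ {e} → e ∈ hi → span (lookup hull) e ≡ true
        hi-span {e} m = eligible-spanned {e} (<-wellFounded (arr e)) el lev
          where
          h = ∧-true {lookup E e ∧ fast κ θ e} (∈-comp⁻ {f = hiᵇ} m)
          lev = does-true (level e ℕ.≟ κ) (proj₂ h)
          fs = ∧-true {cand θ e} (∧₂ {lookup E e} (proj₁ h))
          el : P.eligible 0 e ≡ true
          el = ∧-intro {P.isT e} {true ∧ (span (P.sampleUpTo 0 e) e ∨ does (halve 0 top ℕ.≤? level e))} (proj₁ fs)
            (∨-introˡ {span (P.sampleUpTo 0 e) e} (subst (λ l → span (λ y → sample θ y ∧ does (level y ℕ.≤? l)) e ≡ true) (sym lev) (proj₂ fs)))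
        split : ∀ e → ⟦ lookup E e ∧ fast κ θ e ⟧ ≤ ⟦ lookup lo e ⟧ + ⟦ lookup hi e ⟧
        split e rewrite lookup∘tabulate loᵇ e | lookup∘tabulate hiᵇ e = by-level (bool-cases (lookup E e ∧ fast κ θ e)) (level e ℕ.≟ κ)
          where
          X = lookup E e ∧ fast κ θ e
          by-level : (X ≡ true) ⊎ (X ≡ false) → Dec (level e ≡ κ) → ⟦ X ⟧ ≤ ⟦ loᵇ e ⟧ + ⟦ hiᵇ e ⟧
          by-level (inj₂ q) _       = ≤-trans (≤-reflexive (cong ⟦_⟧ q)) z≤n
          by-level (inj₁ q) (yes v) = ≤-trans (⟦⟧-mono {X} {hiᵇ e} (λ _ →
            ∧-intro {X} {does (level e ℕ.≟ κ)} q (true-does (level e ℕ.≟ κ) v))) (m≤n+m ⟦ hiᵇ e ⟧ ⟦ loᵇ e ⟧)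
          by-level (inj₁ q) (no ¬v) = ≤-trans (⟦⟧-mono {X} {loᵇ e} (λ _ →
            ∧-intro {X} {does (level e ℕ.<? κ)} q (true-does (level e ℕ.<? κ) (≤∧≢⇒< (lvE (inE {e} q)) ¬v)))) (m≤m+n ⟦ loᵇ e ⟧ ⟦ hiᵇ e ⟧)
        hull-size : ∣ hull ∣ ≤ ∣ R ∣ + ∑ (allFin n) (λ x → ⟦ accepted x ⟧)
        hull-size = begin
          ∣ hull ∣ ≡⟨ ∣∣≡∑ hull ⟩
          ∑ (allFin n) (λ y → ⟦ lookup hull y ⟧) ≤⟨ ∑-mono (allFin n) (λ y → subst (λ b → ⟦ b ⟧ ≤ ⟦ lookup R y ⟧ + ⟦ accepted y ⟧) (sym (hull-lookup y)) (or≤ (lookup R y) (accepted y))) ⟩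
          ∑ (allFin n) (λ y → ⟦ lookup R y ⟧ + ⟦ accepted y ⟧) ≡⟨ ∑-+ (allFin n) (λ y → ⟦ lookup R y ⟧) (λ y → ⟦ accepted y ⟧) ⟩
          ∑ (allFin n) (λ y → ⟦ lookup R y ⟧) + ∑ (allFin n) (λ y → ⟦ accepted y ⟧) ≡⟨ cong (_+ _) (sym (∣∣≡∑ R)) ⟩
          ∣ R ∣ + ∑ (allFin n) (λ x → ⟦ accepted x ⟧) ∎
          where
          or≤ : ∀ a b → ⟦ a ∨ b ⟧ ≤ ⟦ a ⟧ + ⟦ b ⟧
          or≤ true  b = s≤s z≤n
          or≤ false b = ≤-refl

-- The greedy base, its prefixes and circuit-closing elements

module Optimum {n : ℕ} (M : Matroid n) (σ : Permutation′ n) where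

  open Span M

  before? : ℕ → Fin n → Bool
  before? k y = does (pos σ y ℕ.<? k)

  -- The greedy base without the fold: an element belongs to it when the better ones do not span it.
  opt : Fin n → Bool
  opt e = not (span (before? (pos σ e)) e)

  pos-< : ∀ x → pos σ x < n
  pos-< x = Finₚ.toℕ<n (σ ⟨$⟩ˡ x)

  at : ∀ {k} → k < n → Σ[ x ∈ Fin n ] pos σ x ≡ k
  at {k} l = σ ⟨$⟩ʳ fromℕ< l , trans (cong toℕ (inverseˡ σ)) (Finₚ.toℕ-fromℕ< l)

  opt-not-spanned : ∀ {e} → opt e ≡ true → span (before? (pos σ e)) e ≡ false
  opt-not-spanned o = not-true o

  private
    step : Subset n → Fin n → Subset n
    step S e = if indep M (S ∪ ⁅ e ⁆) then S ∪ ⁅ e ⁆ else S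

    data Consecutive : ℕ → List (Fin n) → Set where
      []  : ∀ {k} → Consecutive k []
      _∷_ : ∀ {k e xs} → pos σ e ≡ k → Consecutive (suc k) xs → Consecutive k (e ∷ xs)

    consecutive : ∀ m (f : Fin m → Fin n) k → (∀ i → pos σ (f i) ≡ k + toℕ i) → Consecutive k (List.tabulate f)
    consecutive zero    f k h = []
    consecutive (suc m) f k h = trans (h zero) (+-identityʳ k) ∷
      consecutive m (f ∘ suc) (suc k) (λ i → trans (h (suc i)) (+-suc k (toℕ i)))

    -- The greedy set spans all positions handled so far. A new element spanned by its predecessors
    -- would therefore be spanned by `A` and could not be added.
    greedy-opt : ∀ {k xs} → Consecutive k xs → ∀ A → (∀ {y} → y ∈ A → pos σ y < k) →
                 (∀ {y} → pos σ y < k → span (lookup A) y ≡ true) →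
                 Ind A → (∀ {y} → y ∈ A → opt y ≡ true) → ∀ {y} → y ∈ foldl step A xs → opt y ≡ true
    greedy-opt [] A _ _ _ o m = o m
    greedy-opt {k} {e ∷ xs} (q ∷ c) A low sp i o m with bool-cases (indep M (A ∪ ⁅ e ⁆))
    ... | inj₂ d rewrite d = greedy-opt c A (λ y∈ → m≤n⇒m≤1+n (low y∈)) sp′ i o m
      where
      sp′ : ∀ {y} → pos σ y < suc k → span (lookup A) y ≡ true
      sp′ {y} l with pos σ y ℕ.≟ k
      ... | no ¬q = sp (≤∧≢⇒< (≤-pred l) ¬q)
      ... | yes q′ rewrite pos-injective σ {y} {e} (trans q′ (sym q)) =
            ⇒span (inj₂ (A , (λ m → ∈⇒lookup m) , i , (λ ind → true≢false ind d)))
    ... | inj₁ ie rewrite ie = greedy-opt c (A ∪ ⁅ e ⁆) low′ sp′ ie o′ m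
      where
      low′ : ∀ {y} → y ∈ A ∪ ⁅ e ⁆ → pos σ y < suc k
      low′ {y} y∈ with x∈p∪q⁻ A ⁅ e ⁆ y∈
      ... | inj₁ a = m≤n⇒m≤1+n (low a)
      ... | inj₂ b rewrite x∈⁅y⁆⇒x≡y e b = s≤s (≤-reflexive q)
      sp′ : ∀ {y} → pos σ y < suc k → span (lookup (A ∪ ⁅ e ⁆)) y ≡ true
      sp′ {y} l with pos σ y ℕ.≟ k
      ... | no ¬q = span-⊆ {lookup A} {lookup (A ∪ ⁅ e ⁆)} (λ h → ∈⇒lookup (p⊆p∪q ⁅ e ⁆ (lookup⇒∈ {p = A} h))) (sp (≤∧≢⇒< (≤-pred l) ¬q))
      ... | yes q′ rewrite pos-injective σ {y} {e} (trans q′ (sym q)) = ⇒span (inj₁ (∈⇒lookup {p = A ∪ ⁅ e ⁆} (x∈p∪q⁺ (inj₂ (x∈⁅x⁆ e)))))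
      free : ¬ (span (before? (pos σ e)) e ≡ true)
      free s with span⇒ (span-trans {lookup A} {before? (pos σ e)} (λ {y} h → sp (≤-trans (does-true (pos σ y ℕ.<? pos σ e) h) (≤-reflexive q))) s)
      ... | inj₁ a = <-irrefl q (low (lookup⇒∈ {p = A} a))
      ... | inj₂ (I , I⊆ , _ , d) = d (indep-⊆ M (∪⁅⁆-⊆ (λ y∈ → p⊆p∪q ⁅ e ⁆ (lookup⇒∈ {p = A} (I⊆ y∈))) (x∈p∪q⁺ (inj₂ (x∈⁅x⁆ e)))) ie)
      o′ : ∀ {y} → y ∈ A ∪ ⁅ e ⁆ → opt y ≡ true
      o′ {y} y∈ with x∈p∪q⁻ A ⁅ e ⁆ y∈
      ... | inj₁ a = o a
      ... | inj₂ b rewrite x∈⁅y⁆⇒x≡y e b with bool-cases (span (before? (pos σ e)) e)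
      ... | inj₁ s = contradiction s free
      ... | inj₂ f = cong not f

  ∈OPT⇒opt : ∀ {e} → e ∈ OPT M σ → opt e ≡ true
  ∈OPT⇒opt {e} m = greedy-opt
    (subst (Consecutive 0) (sym (map-tabulate id (σ ⟨$⟩ʳ_)))
      (consecutive n (σ ⟨$⟩ʳ_) 0 (λ i → cong toℕ (inverseˡ σ))))
    ⊥ (λ y∈ → ⊥-elim (∉⊥ y∈)) (λ ()) (indep-∅ M) (λ y∈ → ⊥-elim (∉⊥ y∈)) m

  optBefore : ℕ → Subset n
  optBefore k = ⁅ (λ y → opt y ∧ before? k y) ∣⁆

  ∈optBefore⁻ : ∀ {k y} → y ∈ optBefore k → opt y ≡ true × pos σ y < k
  ∈optBefore⁻ {k} {y} m = let (o , b) = ∧-true {opt y} (∈-comp⁻ {f = λ y → opt y ∧ before? k y} m) in o , does-true (pos σ y ℕ.<? k) b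

  ∈optBefore⁺ : ∀ {k y} → opt y ≡ true → pos σ y < k → y ∈ optBefore k
  ∈optBefore⁺ {k} {y} o l = ∈-comp⁺ (∧-intro {opt y} {before? k y} o (true-does (pos σ y ℕ.<? k) l))

  avoiding-independent : (A : Fin n → Bool) → (∀ {x} → A x ≡ true → span (λ y → A y ∧ before? (pos σ x) y) x ≡ false) → Ind ⁅ A ∣⁆
  avoiding-independent A h = independent A (pos σ) (λ _ _ → pos-injective σ)
    (λ {x} a s → true≢false (⇒span (span-mono (λ {y} (ay , l) → ∧-intro {A y} {before? (pos σ x) y} ay (true-does (pos σ y ℕ.<? pos σ x) l)) s)) (h a))
    n (λ {x} _ → pos-< x)

  optBefore-ind : ∀ k → Ind (optBefore k)
  optBefore-ind k = avoiding-independent (λ y → opt y ∧ before? k y) (λ {x} a → sub x (opt-not-spanned (∧₁ {opt x} a)))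
    where
    sub : ∀ x → span (before? (pos σ x)) x ≡ false → span (λ y → (opt y ∧ before? k y) ∧ before? (pos σ x) y) x ≡ false
    sub x f with bool-cases (span (λ y → (opt y ∧ before? k y) ∧ before? (pos σ x) y) x)
    ... | inj₂ g = g
    ... | inj₁ t = true≢false (span-⊆ {λ y → (opt y ∧ before? k y) ∧ before? (pos σ x) y} {before? (pos σ x)}
                     (λ {y} e → ∧₂ {opt y ∧ before? k y} e) t) f

  optBefore-spans : ∀ k {x} → pos σ x < k → span (lookup (optBefore k)) x ≡ true
  optBefore-spans k {x} l = go (<-wellFounded (pos σ x)) l
    where
    go : ∀ {x} → Acc _<_ (pos σ x) → pos σ x < k → span (lookup (optBefore k)) x ≡ true
    go {x} (acc rs) l with bool-cases (span (before? (pos σ x)) x)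
    ... | inj₂ f = ⇒span (inj₁ (∈⇒lookup {p = optBefore k} (∈optBefore⁺ {k} {x} (cong not f) l)))
    ... | inj₁ t = span-trans {lookup (optBefore k)} {before? (pos σ x)}
            (λ {y} b → let l′ = does-true (pos σ y ℕ.<? pos σ x) b in go {y} (rs l′) (<-trans l′ l)) t

  ∑-pos : ∀ k → ∑ (allFin n) (λ y → ⟦ does (pos σ y ℕ.≟ k) ⟧) ≤ 1
  ∑-pos k with k ℕ.<? n
  ... | no ¬l = ≤-trans (∑-mono (allFin n) none) (≤-trans (≤-reflexive (∑-zero (allFin n))) z≤n)
    where
    none : ∀ y → ⟦ does (pos σ y ℕ.≟ k) ⟧ ≤ 0
    none y with bool-cases (does (pos σ y ℕ.≟ k))
    ... | inj₂ f = ≤-reflexive (cong ⟦_⟧ f)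
    ... | inj₁ t = contradiction (subst (_< n) (does-true (pos σ y ℕ.≟ k) t) (pos-< y)) ¬l
  ... | yes l = ≤-trans (∑-mono (allFin n) (λ y → ⟦⟧-mono {does (pos σ y ℕ.≟ k)} {does (y Fin.≟ x)} (λ h →
          true-does (y Fin.≟ x) (pos-injective σ (trans (does-true (pos σ y ℕ.≟ k) h) (sym q)))))) (≤-reflexive (∑-single x))
    where
    x = proj₁ (at l)
    q = proj₂ (at l)

  optBefore-step : ∀ k → ∣ optBefore (suc k) ∣ ≤ suc ∣ optBefore k ∣
  optBefore-step k = begin
    ∣ optBefore (suc k) ∣
      ≡⟨ ∣∣≡∑ (optBefore (suc k)) ⟩
    ∑ (allFin n) (λ y → ⟦ lookup (optBefore (suc k)) y ⟧)
      ≤⟨ ∑-mono (allFin n) pt ⟩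
    ∑ (allFin n) (λ y → ⟦ does (pos σ y ℕ.≟ k) ⟧ + ⟦ lookup (optBefore k) y ⟧)
      ≡⟨ ∑-+ (allFin n) (λ y → ⟦ does (pos σ y ℕ.≟ k) ⟧) (λ y → ⟦ lookup (optBefore k) y ⟧) ⟩
    ∑ (allFin n) (λ y → ⟦ does (pos σ y ℕ.≟ k) ⟧) + ∑ (allFin n) (λ y → ⟦ lookup (optBefore k) y ⟧)
      ≤⟨ +-mono-≤ (∑-pos k) (≤-reflexive (sym (∣∣≡∑ (optBefore k)))) ⟩
    suc ∣ optBefore k ∣ ∎
    where
    open ≤-Reasoning
    pt : ∀ y → ⟦ lookup (optBefore (suc k)) y ⟧ ≤ ⟦ does (pos σ y ℕ.≟ k) ⟧ + ⟦ lookup (optBefore k) y ⟧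
    pt y with pos σ y ℕ.≟ k
    ... | yes q rewrite true-does (pos σ y ℕ.≟ k) q = ≤-trans (⟦⟧-mono {lookup (optBefore (suc k)) y} {true} (λ _ → refl)) (s≤s z≤n)
    ... | no ¬q = ≤-trans (⟦⟧-mono {lookup (optBefore (suc k)) y} {lookup (optBefore k) y} (λ h →
            let (o , l) = ∈optBefore⁻ {suc k} {y} (lookup⇒∈ h) in
            ∈⇒lookup {p = optBefore k} (∈optBefore⁺ {k} {y} o (≤∧≢⇒< (≤-pred l) ¬q)))) (m≤n+m _ ⟦ does (pos σ y ℕ.≟ k) ⟧)

  optBefore-zero : ∣ optBefore 0 ∣ ≡ 0
  optBefore-zero = trans (∣∣≡∑ (optBefore 0)) (trans (∑-cong (allFin n) none) (∑-zero (allFin n)))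
    where
    none : ∀ y → ⟦ lookup (optBefore 0) y ⟧ ≡ 0
    none y with bool-cases (lookup (optBefore 0) y)
    ... | inj₂ f = cong ⟦_⟧ f
    ... | inj₁ t with proj₂ (∈optBefore⁻ {0} {y} (lookup⇒∈ t))
    ... | ()

  -- Discrete intermediate values, as the rank of a prefix grows by at most one per position. It
  -- supplies prefixes of prescribed rank.
  optBefore-ivt : ∀ k {m} → m ≤ ∣ optBefore k ∣ → Σ[ k′ ∈ ℕ ] (k′ ≤ k × ∣ optBefore k′ ∣ ≡ m)
  optBefore-ivt zero    l = 0 , z≤n , trans optBefore-zero (sym (n≤0⇒n≡0 (≤-trans l (≤-reflexive optBefore-zero))))
  optBefore-ivt (suc k) {m} l with m ℕ.≤? ∣ optBefore k ∣
  ... | yes l′ = let (k′ , a , b) = optBefore-ivt k l′ in k′ , m≤n⇒m≤1+n a , b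
  ... | no ¬l′ = suc k , ≤-refl , ≤-antisym (≤-trans (optBefore-step k) (≰⇒> ¬l′)) l

  optBefore-⊂ : ∀ {k e} → e ∈ optBefore k → ∣ optBefore (pos σ e) ∣ < ∣ optBefore k ∣
  optBefore-⊂ {k} {e} m = p⊂q⇒∣p∣<∣q∣
    ((λ {y} y∈ → let (o , l) = ∈optBefore⁻ {pos σ e} {y} y∈ in ∈optBefore⁺ {k} {y} o (<-trans l (proj₂ (∈optBefore⁻ {k} {e} m))))
    , e , m , (λ e∈ → <-irrefl refl (proj₂ (∈optBefore⁻ {pos σ e} {e} e∈))))

  rank-bound : ∀ {ρ} → HasRank M ρ → ∀ {A} → Ind A → ∣ A ∣ ≤ ρ
  rank-bound (_ , _ , h) = h _

  -- The first element closing a circuit through an optimal element e.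
  data Guard (e : Fin n) : Set where
    coloop : span (λ y → not (does (y Fin.≟ e))) e ≡ false → Guard e
    guard  : ∀ x → pos σ e < pos σ x →
             span (λ y → before? (pos σ x) y ∧ not (does (y Fin.≟ e))) x ≡ false →
             span (λ y → before? (pos σ x) y ∧ not (does (y Fin.≟ e))) e ≡ false → Guard e

  -- Lengthen the prefix with `e` removed until it spans `e`; the element added at that moment is
  -- the guard. Were it spanned by the shorter prefix, adding it would not have enlarged the
  -- closure.
  guarded : ∀ {e} → opt e ≡ true → Guard e
  guarded {e} o = search n ≤-refl (λ {y} h → ∧-intro {before? n y} {not (does (y Fin.≟ e))} (true-does (pos σ y ℕ.<? n) (pos-< y)) h)
    where
    Y : ℕ → Fin n → Bool
    Y k y = before? k y ∧ not (does (y Fin.≟ e))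
    zero-free : span (Y 0) e ≡ true → Guard e
    zero-free t = true≢false (span-⊆ {Y 0} {before? (pos σ e)} (λ ()) t) (opt-not-spanned {e} o)
    found : ∀ {k} → k < n → span (Y k) e ≡ false → span (Y (suc k)) e ≡ true → Guard e
    found {k} k<n f t with at k<n
    ... | x , refl = guard x ex (fx (bool-cases (span (Y (pos σ x)) x))) f
      where
      -- Otherwise the prefix that spans `e` consists of elements better than `e`, against its
      -- optimality.
      ex : pos σ e < pos σ x
      ex = ≰⇒> λ xe → true≢false (span-⊆ {Y (suc (pos σ x))} {before? (pos σ e)} (λ {y} h →
             true-does (pos σ y ℕ.<? pos σ e) (≤∧≢⇒< (≤-trans (≤-pred (does-true (pos σ y ℕ.<? suc (pos σ x)) (∧₁ {before? (suc (pos σ x)) y} h))) xe)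
               (λ q → ne {y} (∧₂ {before? (suc (pos σ x)) y} h) (pos-injective σ q)))) t) (opt-not-spanned {e} o)
        where
        ne : ∀ {y} → not (does (y Fin.≟ e)) ≡ true → y ≢ e
        ne {y} h refl = true≢false (true-does (y Fin.≟ y) refl) (not-true h)
      fx : (span (Y (pos σ x)) x ≡ true) ⊎ (span (Y (pos σ x)) x ≡ false) → span (Y (pos σ x)) x ≡ false
      fx (inj₂ g) = g
      fx (inj₁ g) = true≢false (span-trans {Y (pos σ x)} {Y (suc (pos σ x))} (λ {y} h → spanY {y} h) t) f
        where
        spanY : ∀ {y} → Y (suc (pos σ x)) y ≡ true → span (Y (pos σ x)) y ≡ true
        spanY {y} h with pos σ y ℕ.≟ pos σ x
        ... | yes q rewrite pos-injective σ {y} {x} q = g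
        ... | no ¬q = ⇒span (inj₁ (∧-intro {before? (pos σ x) y} {not (does (y Fin.≟ e))}
                (true-does (pos σ y ℕ.<? pos σ x) (≤∧≢⇒< (≤-pred (does-true (pos σ y ℕ.<? suc (pos σ x)) (∧₁ {before? (suc (pos σ x)) y} h))) ¬q))
                (∧₂ {before? (suc (pos σ x)) y} h)))
    search : ∀ k → k ≤ n → (∀ {y} → not (does (y Fin.≟ e)) ≡ true → Y k y ≡ true) → Guard e
    search k k≤n all with bool-cases (span (Y k) e)
    ... | inj₂ f = coloop (free (bool-cases (span (λ y → not (does (y Fin.≟ e))) e)))
      where
      free : _ ⊎ _ → span (λ y → not (does (y Fin.≟ e))) e ≡ false
      free (inj₂ g) = g
      free (inj₁ g) = true≢false (span-⊆ {λ y → not (does (y Fin.≟ e))} {Y k} (λ {y} → all {y}) g) f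
    ... | inj₁ t = descend k k≤n t
      where
      descend : ∀ k → k ≤ n → span (Y k) e ≡ true → Guard e
      descend zero    l t = zero-free t
      descend (suc k) l t with bool-cases (span (Y k) e)
      ... | inj₁ t′ = descend k (<⇒≤ l) t′
      ... | inj₂ f  = found l f t

-- Counts in the first sample against ranks of prefixes

module LevelBounds {n : ℕ} (M : Matroid n) (σ : Permutation′ n) (λ̂ : ℕ → ℕ) (λ-mono : ∀ {a b} → a ≤ b → λ̂ a ≤ λ̂ b)
                   (U : Vec Bool n) where
  open Span M
  open Optimum M σ
  open FixedQ M σ λ̂ λ-mono U

  greedy-sub-ind : (A : Fin n → Bool) → (∀ {y} → A y ≡ true → greedy y ≡ true) → Ind ⁅ A ∣⁆
  greedy-sub-ind A sub = avoiding-independent A free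
    where
    free : ∀ {x} → A x ≡ true → span (λ y → A y ∧ before? (pos σ x) y) x ≡ false
    free {x} a with bool-cases (span (λ y → A y ∧ before? (pos σ x) y) x)
    ... | inj₂ f = f
    ... | inj₁ t = true≢false (span-⊆ {λ y → A y ∧ before? (pos σ x) y} {λ z → not (lookup U z) ∧ better z x}
            (λ {y} h → let (ay , b) = ∧-true {A y} h in
              ∧-intro {not (lookup U y)} {better y x} (∧₁ {not (lookup U y)} (sub ay)) b) t)
            (not-true (∧₂ {not (lookup U x)} (sub a)))

  total≤rank : ∀ {ρ} → HasRank M ρ → total ≤ ρ
  total≤rank hr = ≤-trans (≤-reflexive (trans (∑-cong (allFin n) (λ y → cong ⟦_⟧ (sym (lookup∘tabulate greedy y)))) (sym (∣∣≡∑ ⁅ greedy ∣⁆))))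
    (rank-bound hr (greedy-sub-ind greedy (λ h → h)))

  count<prefix : ∀ {k e} → e ∈ optBefore k → count e < ∣ optBefore k ∣
  count<prefix {k} {e} m = ≤-<-trans
    (≤-trans (≤-reflexive (trans (∑-cong (allFin n) (λ y → cong ⟦_⟧ (sym (lookup∘tabulate A y)))) (sym (∣∣≡∑ ⁅ A ∣⁆))))
      (spanned-size {⁅ A ∣⁆} {optBefore (pos σ e)} (greedy-sub-ind A (λ {y} h → ∧₁ {greedy y} h))
        (λ {y} y∈ → optBefore-spans (pos σ e) (does-true (pos σ y ℕ.<? pos σ e) (∧₂ {greedy y} (∈-comp⁻ {f = A} y∈))))))
    (optBefore-⊂ {k} {e} m)
    where
    A : Fin n → Bool
    A y = greedy y ∧ better y e

  -- An optimal element that falls into Q is not spanned by better elements of Q either, so it is in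
  -- the greedy base of Q. Many such elements push everything after the prefix to high levels.
  prefix≤count : ∀ k {y} → k ≤ pos σ y → ∑ (allFin n) (λ z → ⟦ lookup (optBefore k) z ∧ not (lookup U z) ⟧) ≤ count y
  prefix≤count k {y} l = ∑-mono (allFin n) (λ z → ⟦⟧-mono {lookup (optBefore k) z ∧ not (lookup U z)} {greedy z ∧ better z y} (pt z))
    where
    pt : ∀ z → lookup (optBefore k) z ∧ not (lookup U z) ≡ true → greedy z ∧ better z y ≡ true
    pt z h = ∧-intro {greedy z} {better z y}
      (∧-intro {not (lookup U z)} {not (span (λ x → not (lookup U x) ∧ better x z) z)} (proj₂ h′)
        (cong not (free (bool-cases (span (λ x → not (lookup U x) ∧ better x z) z)))))
      (true-does (pos σ z ℕ.<? pos σ y) (<-≤-trans (proj₂ m) l))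
      where
      h′ = ∧-true {lookup (optBefore k) z} h
      m = ∈optBefore⁻ {k} {z} (lookup⇒∈ (proj₁ h′))
      free : _ ⊎ _ → span (λ x → not (lookup U x) ∧ better x z) z ≡ false
      free (inj₂ f) = f
      free (inj₁ t) = true≢false (span-⊆ {λ x → not (lookup U x) ∧ better x z} {before? (pos σ z)}
        (λ {x} q → ∧₂ {not (lookup U x)} q) t) (opt-not-spanned {z} (proj₁ m))

-- Averages over colours, scales and arrival orders

*-leftComm : ∀ a b c → a * (b * c) ≡ b * (a * c)
*-leftComm = solve-∀

*-interchange : ∀ a b c d → a * b * (c * d) ≡ a * c * (b * d)
*-interchange = solve-∀

∑<-mono : ∀ J {f g : ℕ → ℕ} → (∀ s → s < J → f s ≤ g s) → ∑< J f ≤ ∑< J g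
∑<-mono zero    h = z≤n
∑<-mono (suc J) h = +-mono-≤ (∑<-mono J (λ s l → h s (m≤n⇒m≤1+n l))) (h J ≤-refl)

∑<-cong : ∀ J {f g : ℕ → ℕ} → (∀ s → s < J → f s ≡ g s) → ∑< J f ≡ ∑< J g
∑<-cong J h = ≤-antisym (∑<-mono J (λ s l → ≤-reflexive (h s l))) (∑<-mono J (λ s l → ≤-reflexive (sym (h s l))))

∑<-+ : ∀ a b f → ∑< (a + b) f ≡ ∑< a f + ∑< b (λ j → f (a + j))
∑<-+ a zero    f = trans (cong (λ t → ∑< t f) (+-identityʳ a)) (sym (+-identityʳ _))
∑<-+ a (suc b) f = trans (cong (λ t → ∑< t f) (+-suc a b)) (trans (cong (_+ f (a + b)) (∑<-+ a b f)) (+-assoc (∑< a f) _ _))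

∑<-suc : ∀ J f → ∑< (suc J) f ≡ f 0 + ∑< J (f ∘ suc)
∑<-suc J f = ∑<-+ 1 J f

∑<-swap : {A : Set} (J : ℕ) (xs : List A) (f : ℕ → A → ℕ) → ∑< J (λ s → ∑ xs (f s)) ≡ ∑ xs (λ x → ∑< J (λ s → f s x))
∑<-swap zero    xs f = sym (∑-zero xs)
∑<-swap (suc J) xs f = trans (cong (_+ ∑ xs (f J)) (∑<-swap J xs f)) (sym (∑-+ xs (λ x → ∑< J (λ s → f s x)) (f J)))

∑<-*ˡ : ∀ k J f → ∑< J (λ s → k * f s) ≡ k * ∑< J f
∑<-*ˡ k zero    f = sym (*-zeroʳ k)
∑<-*ˡ k (suc J) f = trans (cong (_+ k * f J) (∑<-*ˡ k J f)) (sym (*-distribˡ-+ k (∑< J f) (f J)))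

∑-downFrom : ∀ N f → ∑ (downFrom N) f ≡ ∑< N f
∑-downFrom zero    f = refl
∑-downFrom (suc N) f = trans (cong (f N +_) (∑-downFrom N f)) (+-comm (f N) _)

∑<-mod : ∀ k J f → ∑< (k * suc J) (λ j → f (j % suc J)) ≡ k * ∑< (suc J) f
∑<-mod zero    J f = refl
∑<-mod (suc k) J f = begin
  ∑< (suc J + k * suc J) (λ j → f (j % suc J))
    ≡⟨ ∑<-+ (suc J) (k * suc J) _ ⟩
  ∑< (suc J) (λ j → f (j % suc J)) + ∑< (k * suc J) (λ j → f ((suc J + j) % suc J))
    ≡⟨ cong₂ _+_ (∑<-cong (suc J) (λ j l → cong f (m<n⇒m%n≡m l)))
         (∑<-cong (k * suc J) (λ j _ → cong f (trans (cong (_% suc J) (+-comm (suc J) j)) ([m+n]%n≡m%n j (suc J))))) ⟩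
  ∑< (suc J) f + ∑< (k * suc J) (λ j → f (j % suc J))
    ≡⟨ cong (∑< (suc J) f +_) (∑<-mod k J f) ⟩
  ∑< (suc J) f + k * ∑< (suc J) f ∎
  where open ≡-Reasoning

∑-downFrom-mod : ∀ N k J f → k * suc J ≤ N → k * ∑< (suc J) f ≤ ∑ (downFrom N) (λ j → f (j % suc J))
∑-downFrom-mod N k J f l = begin
  k * ∑< (suc J) f                                  ≡⟨ sym (∑<-mod k J f) ⟩
  ∑< (k * suc J) (λ j → f (j % suc J))              ≤⟨ m≤m+n _ _ ⟩
  ∑< (k * suc J) (λ j → f (j % suc J)) + ∑< (N ∸ k * suc J) (λ j → f ((k * suc J + j) % suc J))
                                                    ≡⟨ sym (∑<-+ (k * suc J) (N ∸ k * suc J) _) ⟩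
  ∑< (k * suc J + (N ∸ k * suc J)) (λ j → f (j % suc J)) ≡⟨ cong (λ t → ∑< t (λ j → f (j % suc J))) (m+[n∸m]≡n l) ⟩
  ∑< N (λ j → f (j % suc J))                        ≡⟨ sym (∑-downFrom N _) ⟩
  ∑ (downFrom N) (λ j → f (j % suc J))              ∎
  where open ≤-Reasoning

⟦∧⟧ : ∀ a b → ⟦ a ∧ b ⟧ ≡ ⟦ a ⟧ * ⟦ b ⟧
⟦∧⟧ true  b = sym (*-identityˡ ⟦ b ⟧)
⟦∧⟧ false b = refl

⟦⟧≤1 : ∀ b → ⟦ b ⟧ ≤ 1
⟦⟧≤1 true  = ≤-refl
⟦⟧≤1 false = z≤n

-- Q is dense so that Markov's inequality, applied to two prefixes at once, leaves a likely event.
sampling : List Bool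
sampling = true ∷ replicate 15 false

palette : List Colour
palette = pairs sampling coin

module Marginals (n : ℕ) where

  ∑U ∑θ : (Vec Bool n → ℕ) → ℕ
  ∑U = ∑ (vecs sampling n)
  ∑θ = ∑ (vecs coin n)

  #U #θ : ℕ
  #U = length (vecs sampling n)
  #θ = length (vecs coin n)

  U-marginal : ∀ e → 16 * ∑U (λ U → ⟦ lookup U e ⟧) ≡ #U
  U-marginal e = trans (cong (16 *_) (∑-cong (vecs sampling n) (λ U → sym (*-identityʳ ⟦ lookup U e ⟧))))
    (trans (∑-independent sampling e ⟦_⟧ (λ _ → 1) (λ _ _ → refl)) (trans (*-identityˡ _) (sym (length≡∑ (vecs sampling n)))))

  θ-marginal : ∀ e → 2 * ∑θ (λ θ → ⟦ lookup θ e ⟧) ≡ #θ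
  θ-marginal e = trans (cong (2 *_) (∑-cong (vecs coin n) (λ θ → sym (*-identityʳ ⟦ lookup θ e ⟧))))
    (trans (∑-independent coin e ⟦_⟧ (λ _ → 1) (λ _ _ → refl)) (trans (*-identityˡ _) (sym (length≡∑ (vecs coin n)))))

  U-pair : ∀ {x e} (φ : Bool → ℕ) → x ≢ e →
           16 * ∑U (λ U → φ (lookup U x) * ⟦ lookup U e ⟧) ≡ ∑ sampling φ * ∑U (λ U → ⟦ lookup U e ⟧)
  U-pair {x} {e} φ x≢e = ∑-independent sampling x φ (λ U → ⟦ lookup U e ⟧)
    (λ U p → cong ⟦_⟧ (lookup∘update′ (x≢e ∘ sym) U p))

  -- Given that `e` is outside Q, another element is outside with probability 1/16 and `e` itself
  -- with probability 1; the 15 makes up the difference.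
  U-pair-≤ : ∀ x e → 16 * ∑U (λ U → ⟦ lookup U x ⟧ * ⟦ lookup U e ⟧) ≤
             (1 + 15 * ⟦ does (x Fin.≟ e) ⟧) * ∑U (λ U → ⟦ lookup U e ⟧)
  U-pair-≤ x e with x Fin.≟ e
  ... | no x≢e   = ≤-reflexive (U-pair ⟦_⟧ x≢e)
  ... | yes refl = *-monoʳ-≤ 16 (∑-mono (vecs sampling n) (λ U → ≤-trans (*-monoˡ-≤ ⟦ lookup U x ⟧ (⟦⟧≤1 (lookup U x))) (≤-reflexive (*-identityˡ _))))

  -- Markov's inequality for the part of I outside Q.
  U-concentration : ∀ (I : Subset n) b e → ∣ I ∣ ≡ 2 * b → 1 ≤ b →
    (16 * suc b) * ∑U (λ U → ⟦ not (does (b ℕ.≤? ∑ (allFin n) (λ z → ⟦ lookup I z ∧ not (lookup U z) ⟧))) ⟧ * ⟦ lookup U e ⟧)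
      ≤ (2 * b + 15) * ∑U (λ U → ⟦ lookup U e ⟧)
  U-concentration I b e size 1≤b = begin
    (16 * suc b) * ∑U (λ U → bad U * ⟦ lookup U e ⟧)
      ≡⟨ trans (*-assoc 16 (suc b) _) (cong (16 *_) (sym (∑-*ˡ (suc b) (vecs sampling n) _))) ⟩
    16 * ∑U (λ U → suc b * (bad U * ⟦ lookup U e ⟧))
      ≤⟨ *-monoʳ-≤ 16 (∑-mono (vecs sampling n) markov) ⟩
    16 * ∑U (λ U → ∑ (allFin n) (λ z → ⟦ lookup I z ⟧ * (⟦ lookup U z ⟧ * ⟦ lookup U e ⟧)))
      ≡⟨ cong (16 *_) (trans (∑-swap (vecs sampling n) (allFin n) _) (∑-cong (allFin n) (λ z → ∑-*ˡ ⟦ lookup I z ⟧ (vecs sampling n) _))) ⟩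
    16 * ∑ (allFin n) (λ z → ⟦ lookup I z ⟧ * ∑U (λ U → ⟦ lookup U z ⟧ * ⟦ lookup U e ⟧))
      ≡⟨ sym (∑-*ˡ 16 (allFin n) _) ⟩
    ∑ (allFin n) (λ z → 16 * (⟦ lookup I z ⟧ * ∑U (λ U → ⟦ lookup U z ⟧ * ⟦ lookup U e ⟧)))
      ≤⟨ ∑-mono (allFin n) pointwise ⟩
    ∑ (allFin n) (λ z → (⟦ lookup I z ⟧ + 15 * ⟦ does (z Fin.≟ e) ⟧) * a)
      ≡⟨ ∑-*ʳ a (allFin n) _ ⟩
    ∑ (allFin n) (λ z → ⟦ lookup I z ⟧ + 15 * ⟦ does (z Fin.≟ e) ⟧) * a
      ≡⟨ cong (_* a) (trans (∑-+ (allFin n) _ _) (cong₂ _+_ (trans (sym (∣∣≡∑ I)) size)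
           (trans (∑-*ˡ 15 (allFin n) _) (cong (15 *_) (∑-single e))))) ⟩
    (2 * b + 15) * a ∎
    where
    open ≤-Reasoning
    a : ℕ
    a = ∑U (λ U → ⟦ lookup U e ⟧)
    inQ outQ : Vec Bool n → ℕ
    inQ  U = ∑ (allFin n) (λ z → ⟦ lookup I z ∧ not (lookup U z) ⟧)
    outQ U = ∑ (allFin n) (λ z → ⟦ lookup I z ⟧ * ⟦ lookup U z ⟧)
    bad : Vec Bool n → ℕ
    bad U = ⟦ not (does (b ℕ.≤? inQ U)) ⟧
    split : ∀ U → outQ U + inQ U ≡ 2 * b
    split U = trans (sym (∑-+ (allFin n) _ _)) (trans (∑-cong (allFin n) (λ z → parts (lookup I z) (lookup U z))) (trans (sym (∣∣≡∑ I)) size))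
      where
      parts : ∀ i u → ⟦ i ⟧ * ⟦ u ⟧ + ⟦ i ∧ not u ⟧ ≡ ⟦ i ⟧
      parts true  true  = refl
      parts true  false = refl
      parts false u     = refl
    -- With fewer than `b` of the `2 * b` elements in Q, at least `suc b` are outside.
    many : ∀ U → suc b * bad U ≤ outQ U
    many U with bool-cases (does (b ℕ.≤? inQ U))
    ... | inj₁ t = ≤-trans (≤-reflexive (trans (cong (λ g → suc b * ⟦ not g ⟧) t) (*-zeroʳ (suc b)))) z≤n
    ... | inj₂ f = ≤-trans (≤-reflexive (trans (cong (λ g → suc b * ⟦ not g ⟧) f) (*-identityʳ (suc b))))
          (+-cancelʳ-≤ (inQ U) (suc b) (outQ U) (begin
            suc b + inQ U  ≡⟨ sym (+-suc b (inQ U)) ⟩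
            b + suc (inQ U) ≤⟨ +-monoʳ-≤ b (≰⇒> (λ l → true≢false (true-does (b ℕ.≤? inQ U) l) f)) ⟩
            b + b           ≡⟨ cong (b +_) (sym (+-identityʳ b)) ⟩
            2 * b           ≡⟨ sym (split U) ⟩
            outQ U + inQ U  ∎))
    markov : ∀ U → suc b * (bad U * ⟦ lookup U e ⟧) ≤ ∑ (allFin n) (λ z → ⟦ lookup I z ⟧ * (⟦ lookup U z ⟧ * ⟦ lookup U e ⟧))
    markov U = begin
      suc b * (bad U * ⟦ lookup U e ⟧) ≡⟨ sym (*-assoc (suc b) (bad U) _) ⟩
      suc b * bad U * ⟦ lookup U e ⟧   ≤⟨ *-monoˡ-≤ ⟦ lookup U e ⟧ (many U) ⟩
      outQ U * ⟦ lookup U e ⟧          ≡⟨ sym (∑-*ʳ ⟦ lookup U e ⟧ (allFin n) _) ⟩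
      ∑ (allFin n) (λ z → ⟦ lookup I z ⟧ * ⟦ lookup U z ⟧ * ⟦ lookup U e ⟧) ≡⟨ ∑-cong (allFin n) (λ z → *-assoc ⟦ lookup I z ⟧ _ _) ⟩
      ∑ (allFin n) (λ z → ⟦ lookup I z ⟧ * (⟦ lookup U z ⟧ * ⟦ lookup U e ⟧)) ∎
    pointwise : ∀ z → 16 * (⟦ lookup I z ⟧ * ∑U (λ U → ⟦ lookup U z ⟧ * ⟦ lookup U e ⟧)) ≤ (⟦ lookup I z ⟧ + 15 * ⟦ does (z Fin.≟ e) ⟧) * a
    pointwise z = begin
      16 * (⟦ lookup I z ⟧ * m)                              ≡⟨ *-leftComm 16 ⟦ lookup I z ⟧ m ⟩
      ⟦ lookup I z ⟧ * (16 * m)                              ≤⟨ *-monoʳ-≤ ⟦ lookup I z ⟧ (U-pair-≤ z e) ⟩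
      ⟦ lookup I z ⟧ * ((1 + 15 * δ) * a)                    ≡⟨ sym (*-assoc ⟦ lookup I z ⟧ (1 + 15 * δ) a) ⟩
      ⟦ lookup I z ⟧ * (1 + 15 * δ) * a                      ≤⟨ *-monoˡ-≤ a (indicator-≤ (lookup I z)) ⟩
      (⟦ lookup I z ⟧ + 15 * δ) * a                          ∎
      where
      m δ : ℕ
      m = ∑U (λ U → ⟦ lookup U z ⟧ * ⟦ lookup U e ⟧)
      δ = ⟦ does (z Fin.≟ e) ⟧
      indicator-≤ : ∀ i → ⟦ i ⟧ * (1 + 15 * δ) ≤ ⟦ i ⟧ + 15 * δ
      indicator-≤ false = z≤n
      indicator-≤ true  = ≤-reflexive (*-identityˡ _)

module Runs {n : ℕ} (M : Matroid n) (σ : Permutation′ n) (λ̂ : ℕ → ℕ) (λ-mono : ∀ {a b} → a ≤ b → λ̂ a ≤ λ̂ b) (N : ℕ) where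

  open Span M
  open Optimum M σ
  open Marginals n
  module Q (U : Vec Bool n) = FixedQ M σ λ̂ λ-mono U

  runs : (Subset n → ℕ) → ℕ
  runs X = ∑ (words palette n) (λ c → ∑ (downFrom N) (λ j → ∑ (perms (allFin n)) (λ π → X (execute M σ (decider λ̂ c j) π))))

  -- The bound `G` sees only the colours of the elements and not their arrival times; this is why
  -- the sum over the orders collapses to a factor.
  runs-lower : ∀ (X : Subset n → ℕ) (G : ℕ → Vec Bool n → Vec Bool n → ℕ) →
    (∀ c j π → length c ≡ n → π ↭ allFin n →
      G j (paint proj₁ (zip π (arrange c))) (paint proj₂ (zip π (arrange c))) ≤ X (execute M σ (decider λ̂ c j) π)) →
    length (perms (allFin n)) * ∑ (downFrom N) (λ j → ∑U (λ U → ∑θ (G j U))) ≤ runs X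
  runs-lower X G h = begin
    P * ∑ (downFrom N) (λ j → ∑U (λ U → ∑θ (G j U)))
      ≡⟨ sym (∑-*ˡ P (downFrom N) _) ⟩
    ∑ (downFrom N) (λ j → P * ∑U (λ U → ∑θ (G j U)))
      ≡⟨ ∑-cong (downFrom N) (λ j → sym (exchange j)) ⟩
    ∑ (downFrom N) (λ j → ∑ (words palette n) (λ c → ∑ (perms (allFin n)) (λ π → F j (zip π (arrange c)))))
      ≡⟨ ∑-swap (downFrom N) (words palette n) _ ⟩
    ∑ (words palette n) (λ c → ∑ (downFrom N) (λ j → ∑ (perms (allFin n)) (λ π → F j (zip π (arrange c)))))
      ≤⟨ ∑-monoAll (words-length palette n) (λ c l → ∑-mono (downFrom N) (λ j → ∑-monoAll (perms-↭ (allFin n)) (λ π p → h c j π l p))) ⟩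
    runs X ∎
    where
    open ≤-Reasoning
    P = length (perms (allFin n))
    F : ℕ → List (Fin n × Colour) → ℕ
    F j al = G j (paint proj₁ al) (paint proj₂ al)
    exchange : ∀ j → ∑ (words palette n) (λ c → ∑ (perms (allFin n)) (λ π → F j (zip π (arrange c)))) ≡ P * ∑U (λ U → ∑θ (G j U))
    exchange j = trans
      (subst (λ m → ∑ (words palette m) (λ c → ∑ (perms (allFin n)) (λ π → F j (zip π (arrange c)))) ≡
                    P * ∑ (words palette m) (λ c → F j (zip (allFin n) c)))
        (length-tabulate {n = n} id)
        (∑-words-perms palette (allFin n) arrange arrange-↭ (F j) (λ p → cong₂ (G j) (paint-↭ proj₁ p) (paint-↭ proj₂ p))))
      (cong (P *_) (trans (∑-cong (words palette n) (λ c → cong₂ (G j) (paint-allFin proj₁ n c) (paint-allFin proj₂ n c)))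
        (∑-words-vecs sampling coin n (G j))))

  -- The scale is uniform up to a factor: every residue occurs k times among N ≥ k w seeds.
  average-scale : ∀ k (g : Vec Bool n → Vec Bool n → ℕ → ℕ) → (∀ U → k * suc (Q.scales U) ≤ N) →
    k * ∑U (λ U → ∑< (suc (Q.scales U)) (λ s → ∑θ (λ θ → g U θ s))) ≤
    ∑ (downFrom N) (λ j → ∑U (λ U → ∑θ (λ θ → g U θ (j % suc (Q.scales U)))))
  average-scale k g enough = begin
    k * ∑U (λ U → ∑< (suc (Q.scales U)) (λ s → ∑θ (λ θ → g U θ s)))
      ≡⟨ sym (∑-*ˡ k (vecs sampling n) _) ⟩
    ∑U (λ U → k * ∑< (suc (Q.scales U)) (λ s → ∑θ (λ θ → g U θ s)))
      ≤⟨ ∑-mono (vecs sampling n) (λ U → ∑-downFrom-mod N k (Q.scales U) (λ s → ∑θ (λ θ → g U θ s)) (enough U)) ⟩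
    ∑U (λ U → ∑ (downFrom N) (λ j → ∑θ (λ θ → g U θ (j % suc (Q.scales U)))))
      ≡⟨ ∑-swap (vecs sampling n) (downFrom N) _ ⟩
    ∑ (downFrom N) (λ j → ∑U (λ U → ∑θ (λ θ → g U θ (j % suc (Q.scales U))))) ∎
    where open ≤-Reasoning

  safeCount : Vec Bool n → Fin n → ℕ
  safeCount U e = ∑< (Q.scales U) (λ s → ∑θ (λ θ → ⟦ lookup θ e ∧ Q.safe U s θ e ⟧))

  half : Fin n → ℕ
  half e = ∑θ (λ θ → ⟦ lookup θ e ⟧)

  -- The event that `e` is outside Q while its guard, if there is one, is in Q. Its probability is
  -- at least 15/16 times 1/16, whence the constants below.
  guardEvent : ∀ {e} → Guard e → Vec Bool n → ℕ
  guardEvent {e} (coloop _)      U = ⟦ lookup U e ⟧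
  guardEvent {e} (guard x _ _ _) U = ⟦ not (lookup U x) ⟧ * ⟦ lookup U e ⟧

  guardEvent-sum : ∀ {e} (g : Guard e) → 15 * #U ≤ 256 * ∑U (guardEvent g)
  guardEvent-sum {e} (coloop _) = begin
    15 * #U                              ≤⟨ *-monoˡ-≤ #U (m≤m+n 15 1) ⟩
    16 * #U                              ≡⟨ cong (16 *_) (sym (U-marginal e)) ⟩
    16 * (16 * ∑U (λ U → ⟦ lookup U e ⟧)) ≡⟨ sym (*-assoc 16 16 (∑U (λ U → ⟦ lookup U e ⟧))) ⟩
    256 * ∑U (λ U → ⟦ lookup U e ⟧)       ∎
    where open ≤-Reasoning
  guardEvent-sum {e} (guard x l fx fe) = begin
    15 * #U                              ≡⟨ cong (15 *_) (sym (U-marginal e)) ⟩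
    15 * (16 * a)                        ≡⟨ *-leftComm 15 16 a ⟩
    16 * (15 * a)                        ≡⟨ cong (16 *_) (sym (U-pair (⟦_⟧ ∘ not) (λ q → <-irrefl (cong (pos σ) (sym q)) l))) ⟩
    16 * (16 * ∑U (guardEvent {e} (guard x l fx fe))) ≡⟨ sym (*-assoc 16 16 (∑U (guardEvent {e} (guard x l fx fe)))) ⟩
    256 * ∑U (guardEvent {e} (guard x l fx fe)) ∎
    where
    open ≤-Reasoning
    a = ∑U (λ U → ⟦ lookup U e ⟧)

  module _ {e : Fin n} (g : Guard e) (gap : ∀ U → λ̂ (Q.count U e) < λ̂ (suc (Q.count U e))) where

    -- On the event no splitting with `e` in T reaches `e` at scale 0, so the subtracted term of
    -- `safe-total` vanishes.
    guardEvent-safe : ∀ U → guardEvent g U * half e ≤ ⟦ lookup U e ⟧ * safeCount U e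
    guardEvent-safe U with bool-cases (lookup U e)
    ... | inj₂ f = ≤-trans (≤-reflexive (cong (_* half e) (zero-event g))) z≤n
      where
      zero-event : ∀ g → guardEvent {e} g U ≡ 0
      zero-event (coloop _)      = cong ⟦_⟧ f
      zero-event (guard x _ _ _) = trans (cong (λ b → ⟦ not (lookup U x) ⟧ * ⟦ b ⟧) f) (*-zeroʳ ⟦ not (lookup U x) ⟧)
    ... | inj₁ ue = begin
        guardEvent g U * half e         ≤⟨ by-event g refl ⟩
        safeCount U e                   ≡⟨ sym (*-identityˡ _) ⟩
        1 * safeCount U e               ≡⟨ cong (λ b → ⟦ b ⟧ * safeCount U e) (sym ue) ⟩
        ⟦ lookup U e ⟧ * safeCount U e ∎
      where
      open ≤-Reasoning
      from-unreached : (∀ θ → lookup θ e ≡ true → Q.reach U 0 θ e ≡ false) → half e ≤ safeCount U e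
      from-unreached h = ≤-trans (Q.safe-total U e) (≤-reflexive (cong (_+ safeCount U e)
        (trans (∑-cong (vecs coin n) none) (∑-zero (vecs coin n)))))
        where
        none : ∀ θ → ⟦ lookup θ e ∧ Q.reach U 0 θ e ⟧ ≡ 0
        none θ with bool-cases (lookup θ e)
        ... | inj₂ f = cong (λ b → ⟦ b ∧ Q.reach U 0 θ e ⟧) f
        ... | inj₁ t = trans (cong (λ b → ⟦ b ∧ Q.reach U 0 θ e ⟧) t) (cong ⟦_⟧ (h θ t))
      by-event : ∀ g′ → g ≡ g′ → guardEvent g′ U * half e ≤ safeCount U e
      by-event (coloop f) _ = ≤-trans (≤-reflexive (trans (cong (λ b → ⟦ b ⟧ * half e) ue) (*-identityˡ _)))
        (from-unreached (λ θ t → Q.reach₀-coloop U {θ} {e} t f))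
      by-event (guard x l fx fe) _ with bool-cases (lookup U x)
      ... | inj₁ t = ≤-trans (≤-reflexive (cong (λ b → ⟦ not b ⟧ * ⟦ lookup U e ⟧ * half e) t)) z≤n
      ... | inj₂ ux = ≤-trans (≤-reflexive (trans (cong₂ (λ a b → ⟦ not a ⟧ * ⟦ b ⟧ * half e) ux ue) (*-identityˡ _)))
              (from-unreached (λ θ t → Q.reach₀-guarded U {θ} {e} {x} ue t ux (true-does (pos σ e ℕ.<? pos σ x) l) fx fe (gap U)))

    guarded-sum : 15 * (#U * #θ) ≤ 512 * ∑U (λ U → ⟦ lookup U e ⟧ * safeCount U e)
    guarded-sum = begin
      15 * (#U * #θ)                            ≡⟨ sym (*-assoc 15 #U #θ) ⟩
      15 * #U * #θ                              ≤⟨ *-monoˡ-≤ #θ (guardEvent-sum g) ⟩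
      256 * ∑U (guardEvent g) * #θ              ≡⟨ cong (256 * ∑U (guardEvent g) *_) (sym (θ-marginal e)) ⟩
      256 * ∑U (guardEvent g) * (2 * half e)    ≡⟨ *-interchange 256 (∑U (guardEvent g)) 2 (half e) ⟩
      512 * (∑U (guardEvent g) * half e)        ≡⟨ cong (512 *_) (sym (∑-*ʳ (half e) (vecs sampling n) (guardEvent g))) ⟩
      512 * ∑U (λ U → guardEvent g U * half e)  ≤⟨ *-monoʳ-≤ 512 (∑-mono (vecs sampling n) guardEvent-safe) ⟩
      512 * ∑U (λ U → ⟦ lookup U e ⟧ * safeCount U e) ∎
      where open ≤-Reasoning

∑-≥ : ∀ {n} (f : Fin n → ℕ) e → f e ≤ ∑ (allFin n) f
∑-≥ {n} f e = begin
  f e                                                    ≡⟨ sym (*-identityʳ (f e)) ⟩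
  f e * 1                                                ≡⟨ cong (f e *_) (sym (∑-single e)) ⟩
  f e * ∑ (allFin n) (λ z → ⟦ does (z Fin.≟ e) ⟧)        ≡⟨ sym (∑-*ˡ (f e) (allFin n) _) ⟩
  ∑ (allFin n) (λ z → f e * ⟦ does (z Fin.≟ e) ⟧)        ≤⟨ ∑-mono (allFin n) pt ⟩
  ∑ (allFin n) f                                         ∎
  where
  open ≤-Reasoning
  pt : ∀ z → f e * ⟦ does (z Fin.≟ e) ⟧ ≤ f z
  pt z with z Fin.≟ e
  ... | yes refl = ≤-reflexive (*-identityʳ (f e))
  ... | no _     = ≤-trans (≤-reflexive (*-zeroʳ (f e))) z≤n

∑-∧ˡ : {A : Set} (xs : List A) (b : Bool) (f : A → Bool) → ∑ xs (λ x → ⟦ b ∧ f x ⟧) ≡ ⟦ b ⟧ * ∑ xs (λ x → ⟦ f x ⟧)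
∑-∧ˡ xs b f = trans (∑-cong xs (λ x → ⟦∧⟧ b (f x))) (∑-*ˡ ⟦ b ⟧ xs _)

-- The ratio of `2 * b + 15` to `16 * suc b` decreases in `b`: it is 17/32 at 1 and 31/144, below
-- 7/32, at 8.
markov-1 : ∀ {b x a} → 1 ≤ b → (16 * suc b) * x ≤ (2 * b + 15) * a → 32 * x ≤ 17 * a
markov-1 {b} {x} {a} 1≤b l = *-cancelˡ-≤ (suc b) (begin
  suc b * (32 * x)             ≡⟨ lhs (suc b) x ⟩
  2 * ((16 * suc b) * x)       ≤⟨ *-monoʳ-≤ 2 l ⟩
  2 * ((2 * b + 15) * a)       ≡⟨ rhs b a ⟩
  (4 * b + 17 + 13) * a        ≤⟨ *-monoˡ-≤ a (+-monoʳ-≤ (4 * b + 17) (m≤m*n 13 b {{ℕ.>-nonZero 1≤b}})) ⟩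
  (4 * b + 17 + 13 * b) * a    ≡⟨ fin b a ⟩
  suc b * (17 * a)             ∎)
  where
  open ≤-Reasoning
  lhs : ∀ c x → c * (32 * x) ≡ 2 * ((16 * c) * x)
  lhs = solve-∀
  rhs : ∀ b a → 2 * ((2 * b + 15) * a) ≡ (4 * b + 17 + 13) * a
  rhs = solve-∀
  fin : ∀ b a → (4 * b + 17 + 13 * b) * a ≡ suc b * (17 * a)
  fin = solve-∀

markov-8 : ∀ {b x a} → 8 ≤ b → (16 * suc b) * x ≤ (2 * b + 15) * a → 32 * x ≤ 7 * a
markov-8 {b} {x} {a} 8≤b l = *-cancelˡ-≤ (suc b) (begin
  suc b * (32 * x)             ≡⟨ lhs (suc b) x ⟩
  2 * ((16 * suc b) * x)       ≤⟨ *-monoʳ-≤ 2 l ⟩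
  2 * ((2 * b + 15) * a)       ≡⟨ rhs b a ⟩
  (4 * b + 7 + 23) * a         ≤⟨ *-monoˡ-≤ a (+-monoʳ-≤ (4 * b + 7) (≤-trans (m≤m+n 23 1) (*-monoʳ-≤ 3 8≤b))) ⟩
  (4 * b + 7 + 3 * b) * a      ≡⟨ fin b a ⟩
  suc b * (7 * a)              ∎)
  where
  open ≤-Reasoning
  lhs : ∀ c x → c * (32 * x) ≡ 2 * ((16 * c) * x)
  lhs = solve-∀
  rhs : ∀ b a → 2 * ((2 * b + 15) * a) ≡ (4 * b + 7 + 23) * a
  rhs = solve-∀
  fin : ∀ b a → (4 * b + 7 + 3 * b) * a ≡ suc b * (7 * a)
  fin = solve-∀

-- Expected gain of elements and of prefixes

module Bounds {n : ℕ} (M : Matroid n) (σ : Permutation′ n) (λ̂ : ℕ → ℕ) (λ-mono : ∀ {a b} → a ≤ b → λ̂ a ≤ λ̂ b) (N k : ℕ)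
              (enough : ∀ U → k * suc (FixedQ.scales M σ λ̂ λ-mono U) ≤ N) where

  open Span M
  open Optimum M σ
  open Marginals n
  open Runs M σ λ̂ λ-mono N
  module LB (U : Vec Bool n) = LevelBounds M σ λ̂ λ-mono U

  P : ℕ
  P = length (perms (allFin n))

  payoff-runs : ∀ (X : Subset n → ℕ) (g : Vec Bool n → Vec Bool n → ℕ → ℕ) →
    (∀ U θ arr s S → (∀ {x} → Q.O.accept U θ arr s x ≡ true → x ∈ S) → g U θ s ≤ X S) →
    P * (k * ∑U (λ U → ∑< (suc (Q.scales U)) (λ s → ∑θ (λ θ → g U θ s)))) ≤ runs X
  payoff-runs X g h = ≤-trans (*-monoʳ-≤ P (average-scale k g enough))
    (runs-lower X (λ j U θ → g U θ (j % suc (Q.scales U)))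
      (λ c j π l p → h _ _ (arrival π) _ _ (execute-decides M σ λ̂ λ-mono c j π p l)))

  single : Fin n → Vec Bool n → Vec Bool n → ℕ → ℕ
  single e U θ zero    = 0
  single e U θ (suc s) = ⟦ lookup U e ∧ (lookup θ e ∧ Q.safe U s θ e) ⟧

  single-sum : ∀ e U → ∑< (suc (Q.scales U)) (λ s → ∑θ (λ θ → single e U θ s)) ≡ ⟦ lookup U e ⟧ * safeCount U e
  single-sum e U = trans (∑<-suc (Q.scales U) _) (trans (cong₂ _+_ (∑-zero (vecs coin n)) refl)
    (trans (∑<-cong (Q.scales U) (λ s _ → ∑-∧ˡ (vecs coin n) (lookup U e) (λ θ → lookup θ e ∧ Q.safe U s θ e)))
      (∑<-*ˡ ⟦ lookup U e ⟧ (Q.scales U) _)))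

  single-accepted : ∀ e U θ arr s S → (∀ {x} → Q.O.accept U θ arr s x ≡ true → x ∈ S) → single e U θ s ≤ ⟦ lookup S e ⟧
  single-accepted e U θ arr zero    S h = z≤n
  single-accepted e U θ arr (suc s) S h = ⟦⟧-mono {lookup U e ∧ (lookup θ e ∧ Q.safe U s θ e)} {lookup S e} (λ q →
    let (u , q′) = ∧-true {lookup U e} q ; (t , sf) = ∧-true {lookup θ e} q′ in
    ∈⇒lookup (h (Q.safe-accepted U {s} {θ} {e} arr (∧-intro {lookup U e} {lookup θ e} u t) sf)))

  single-runs : ∀ {e} → Guard e → (∀ U → λ̂ (Q.count U e) < λ̂ (suc (Q.count U e))) →
                k * (15 * (#U * #θ)) * P ≤ 512 * runs (λ S → ⟦ lookup S e ⟧)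
  single-runs {e} g gap = begin
    k * (15 * (#U * #θ)) * P
      ≤⟨ *-monoˡ-≤ P (*-monoʳ-≤ k (guarded-sum g gap)) ⟩
    k * (512 * V) * P
      ≡⟨ regroup k V P ⟩
    512 * (P * (k * V))
      ≡⟨ cong (λ v → 512 * (P * (k * v))) (sym (∑-cong (vecs sampling n) (single-sum e))) ⟩
    512 * (P * (k * ∑U (λ U → ∑< (suc (Q.scales U)) (λ s → ∑θ (λ θ → single e U θ s)))))
      ≤⟨ *-monoʳ-≤ 512 (payoff-runs _ (single e) (single-accepted e)) ⟩
    512 * runs (λ S → ⟦ lookup S e ⟧) ∎
    where
    open ≤-Reasoning
    V = ∑U (λ U → ⟦ lookup U e ⟧ * safeCount U e)
    regroup : ∀ k v p → k * (512 * v) * p ≡ 512 * (p * (k * v))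
    regroup = solve-∀

  within : ℕ → Subset n → ℕ
  within l S = ∑ (allFin n) (λ x → ⟦ lookup S x ∧ before? l x ⟧)

  runs-mono : ∀ {X Y : Subset n → ℕ} → (∀ S → X S ≤ Y S) → runs X ≤ runs Y
  runs-mono h = ∑-mono (words palette n) (λ c → ∑-mono (downFrom N) (λ j → ∑-mono (perms (allFin n)) (λ π → h _)))

  single-within : ∀ {l e} → pos σ e < l → ∀ S → ⟦ lookup S e ⟧ ≤ within l S
  single-within {l} {e} p S = ≤-trans
    (⟦⟧-mono {lookup S e} {lookup S e ∧ before? l e} (λ q → ∧-intro {lookup S e} {before? l e} q (true-does (pos σ e ℕ.<? l) p)))
    (∑-≥ (λ x → ⟦ lookup S x ∧ before? l x ⟧) e)

  -- kE, kR, kK cut off prefixes of rank b₂, 2 b₁, 2 b₂; κ is the last level lying before kK when Q is typical.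
  module _ (l kE kR kK κ b₁ b₂ : ℕ) (E≤ : kE ≤ l) (K≤ : kK ≤ l)
           (sizeE : ∣ optBefore kE ∣ ≡ b₂) (sizeR : ∣ optBefore kR ∣ ≡ 2 * b₁) (sizeK : ∣ optBefore kK ∣ ≡ 2 * b₂)
           (1≤b₁ : 1 ≤ b₁) (8≤b₂ : 8 ≤ b₂)
           (λ≤κ : ∀ {a} → a < b₂ → λ̂ a ≤ κ) (κ-cut : ∀ {a} → λ̂ a ≤ κ → a < b₂) (κ-low : ∀ {a} → λ̂ a < κ → a < b₁) where

    E R K : Subset n
    E = optBefore kE
    R = optBefore kR
    K = optBefore kK

    hits : Subset n → Vec Bool n → ℕ
    hits I U = ∑ (allFin n) (λ z → ⟦ lookup I z ∧ not (lookup U z) ⟧)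

    enoughK enoughR good : Vec Bool n → Bool
    enoughK U = does (b₂ ℕ.≤? hits K U)
    enoughR U = does (b₁ ℕ.≤? hits R U)
    good    U = enoughK U ∧ enoughR U

    -- A guaranteed number of accepted elements before `l` in terms of colours only. Scale 0
    -- contributes the excess left by `fast-size`, for typical Q; the other scales contribute the
    -- safe elements of `E`.
    payoff : Vec Bool n → Vec Bool n → ℕ → ℕ
    payoff U θ zero    = ⟦ good U ⟧ * (∑ (allFin n) (λ e → ⟦ lookup E e ∧ Q.fast U κ θ e ⟧) ∸ (∣ R ∣ + ∣ R ∣))
    payoff U θ (suc s) = ∑ (allFin n) (λ e → ⟦ lookup E e ⟧ * single e U θ (suc s))

    -- At scale 0 with typical Q, levels below `κ` occur only before `kR`, so `R` spans them, and
    -- level `κ` occurs only before `kK`, so all that is accepted there counts for the prefix `l`.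
    payoff-accepted : ∀ U θ arr s S → (∀ {x} → Q.O.accept U θ arr s x ≡ true → x ∈ S) → payoff U θ s ≤ within l S
    payoff-accepted U θ arr (suc s) S h = ∑-mono (allFin n) pt
      where
      pt : ∀ e → ⟦ lookup E e ⟧ * single e U θ (suc s) ≤ ⟦ lookup S e ∧ before? l e ⟧
      pt e with bool-cases (lookup E e)
      ... | inj₂ f = ≤-trans (≤-reflexive (cong (λ b → ⟦ b ⟧ * single e U θ (suc s)) f)) z≤n
      ... | inj₁ t = begin
        ⟦ lookup E e ⟧ * single e U θ (suc s) ≡⟨ trans (cong (λ b → ⟦ b ⟧ * single e U θ (suc s)) t) (*-identityˡ _) ⟩
        single e U θ (suc s)                  ≤⟨ single-accepted e U θ arr (suc s) S h ⟩
        ⟦ lookup S e ⟧                        ≤⟨ ⟦⟧-mono {lookup S e} {lookup S e ∧ before? l e} (λ q → ∧-intro {lookup S e} {before? l e} q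
                                                  (true-does (pos σ e ℕ.<? l) (<-≤-trans (proj₂ (∈optBefore⁻ {kE} {e} (lookup⇒∈ t))) E≤))) ⟩
        ⟦ lookup S e ∧ before? l e ⟧          ∎
        where open ≤-Reasoning
    payoff-accepted U θ arr zero S h with bool-cases (good U)
    ... | inj₂ f = ≤-trans (≤-reflexive (cong (λ b → ⟦ b ⟧ * (∑ (allFin n) (λ e → ⟦ lookup E e ∧ Q.fast U κ θ e ⟧) ∸ (∣ R ∣ + ∣ R ∣))) f)) z≤n
    ... | inj₁ t = begin
        ⟦ good U ⟧ * (F ∸ (∣ R ∣ + ∣ R ∣)) ≡⟨ trans (cong (λ b → ⟦ b ⟧ * (F ∸ (∣ R ∣ + ∣ R ∣))) t) (*-identityˡ _) ⟩
        F ∸ (∣ R ∣ + ∣ R ∣)                ≤⟨ m≤n+o⇒m∸n≤o F (∣ R ∣ + ∣ R ∣) (≤-trans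
                                              (Q.fast-size U θ arr κ R low E (optBefore-ind kE) lvE) (≤-reflexive (+-comm A (∣ R ∣ + ∣ R ∣)))) ⟩
        A                                  ≤⟨ ∑-mono (allFin n) (λ x → ⟦⟧-mono {Q.accepted U θ arr κ x} {lookup S x ∧ before? l x} (inside x)) ⟩
        within l S                         ∎
      where
      open ≤-Reasoning
      F = ∑ (allFin n) (λ e → ⟦ lookup E e ∧ Q.fast U κ θ e ⟧)
      A = ∑ (allFin n) (λ x → ⟦ Q.accepted U θ arr κ x ⟧)
      hitK = does-true (b₂ ℕ.≤? hits K U) (∧₁ {enoughK U} t)
      hitR = does-true (b₁ ℕ.≤? hits R U) (∧₂ {enoughK U} t)
      -- An element at or after `kR` has count at least `b₁`, too many for a level below `κ`.
      low : ∀ {y} → Q.level U y < κ → span (lookup R) y ≡ true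
      low {y} lt = optBefore-spans kR (≰⇒> (λ p → <⇒≱ (κ-low lt) (≤-trans hitR (LB.prefix≤count U kR {y} p))))
      lvE : ∀ {e} → e ∈ E → Q.level U e ≤ κ
      lvE {e} m = λ≤κ (≤-trans (LB.count<prefix U {kE} {e} m) (≤-reflexive sizeE))
      inside : ∀ x → Q.accepted U θ arr κ x ≡ true → lookup S x ∧ before? l x ≡ true
      inside x a = ∧-intro {lookup S x} {before? l x} (∈⇒lookup (h (∧₁ {Q.O.accept U θ arr 0 x} a)))
        (true-does (pos σ x ℕ.<? l) (<-≤-trans (≰⇒> (λ p → <⇒≱ (κ-cut (≤-reflexive lev)) (≤-trans hitK (LB.prefix≤count U kK {x} p)))) K≤))
        where lev = does-true (Q.level U x ℕ.≟ κ) (∧₂ {Q.O.accept U θ arr 0 x} a)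

    weighted : Vec Bool n → ℕ
    weighted U = ∑ (allFin n) (λ e → ⟦ lookup E e ⟧ * (⟦ lookup U e ⟧ * half e))

    total-payoff : Vec Bool n → ℕ
    total-payoff U = ∑< (suc (Q.scales U)) (λ s → ∑θ (λ θ → payoff U θ s))

    slow-sum : ∀ U → ∑ (allFin n) (λ e → ⟦ lookup E e ⟧ * (⟦ lookup U e ⟧ * safeCount U e)) ≡
                     ∑< (Q.scales U) (λ s → ∑θ (λ θ → payoff U θ (suc s)))
    slow-sum U = begin
      ∑ (allFin n) (λ e → ⟦ lookup E e ⟧ * (⟦ lookup U e ⟧ * safeCount U e))
        ≡⟨ ∑-cong (allFin n) (λ e → cong (⟦ lookup E e ⟧ *_) (trans (sym (single-sum e U)) (trans (∑<-suc (Q.scales U) _) (cong₂ _+_ (∑-zero (vecs coin n)) refl)))) ⟩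
      ∑ (allFin n) (λ e → ⟦ lookup E e ⟧ * ∑< (Q.scales U) (λ s → ∑θ (λ θ → single e U θ (suc s))))
        ≡⟨ ∑-cong (allFin n) (λ e → sym (∑<-*ˡ ⟦ lookup E e ⟧ (Q.scales U) _)) ⟩
      ∑ (allFin n) (λ e → ∑< (Q.scales U) (λ s → ⟦ lookup E e ⟧ * ∑θ (λ θ → single e U θ (suc s))))
        ≡⟨ sym (∑<-swap (Q.scales U) (allFin n) _) ⟩
      ∑< (Q.scales U) (λ s → ∑ (allFin n) (λ e → ⟦ lookup E e ⟧ * ∑θ (λ θ → single e U θ (suc s))))
        ≡⟨ ∑<-cong (Q.scales U) (λ s _ → trans (∑-cong (allFin n) (λ e → sym (∑-*ˡ ⟦ lookup E e ⟧ (vecs coin n) _))) (∑-swap (allFin n) (vecs coin n) _)) ⟩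
      ∑< (Q.scales U) (λ s → ∑θ (λ θ → payoff U θ (suc s))) ∎
      where open ≡-Reasoning

    -- Sum `safe-total` over `E`. The term at scale 0 counts fast elements, so scale 0 pays for it
    -- up to twice the size of `R` for each splitting.
    weighted-payoff : ∀ U → ⟦ good U ⟧ * weighted U ≤ total-payoff U + (∣ R ∣ + ∣ R ∣) * #θ
    weighted-payoff U with bool-cases (good U)
    ... | inj₂ f = ≤-trans (≤-reflexive (cong (λ b → ⟦ b ⟧ * weighted U) f)) z≤n
    ... | inj₁ t = begin
        ⟦ good U ⟧ * weighted U
          ≡⟨ trans (cong (λ b → ⟦ b ⟧ * weighted U) t) (*-identityˡ _) ⟩
        weighted U
          ≤⟨ ∑-mono (allFin n) (λ e → *-monoʳ-≤ ⟦ lookup E e ⟧ (*-monoʳ-≤ ⟦ lookup U e ⟧ (Q.safe-total U e))) ⟩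
        ∑ (allFin n) (λ e → ⟦ lookup E e ⟧ * (⟦ lookup U e ⟧ * (reached e + safeCount U e)))
          ≡⟨ ∑-cong (allFin n) (λ e → distribute ⟦ lookup E e ⟧ ⟦ lookup U e ⟧ (reached e) (safeCount U e)) ⟩
        ∑ (allFin n) (λ e → ⟦ lookup E e ⟧ * (⟦ lookup U e ⟧ * reached e) + ⟦ lookup E e ⟧ * (⟦ lookup U e ⟧ * safeCount U e))
          ≡⟨ ∑-+ (allFin n) _ _ ⟩
        ∑ (allFin n) (λ e → ⟦ lookup E e ⟧ * (⟦ lookup U e ⟧ * reached e)) + ∑ (allFin n) (λ e → ⟦ lookup E e ⟧ * (⟦ lookup U e ⟧ * safeCount U e))
          ≤⟨ +-mono-≤ fast-part (≤-reflexive (slow-sum U)) ⟩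
        (∑θ (λ θ → payoff U θ 0) + (∣ R ∣ + ∣ R ∣) * #θ) + slow
          ≡⟨ rearrange (∑θ (λ θ → payoff U θ 0)) ((∣ R ∣ + ∣ R ∣) * #θ) slow ⟩
        (∑θ (λ θ → payoff U θ 0) + slow) + (∣ R ∣ + ∣ R ∣) * #θ
          ≡⟨ cong (_+ (∣ R ∣ + ∣ R ∣) * #θ) (sym (∑<-suc (Q.scales U) _)) ⟩
        total-payoff U + (∣ R ∣ + ∣ R ∣) * #θ ∎
      where
      open ≤-Reasoning
      reached : Fin n → ℕ
      reached e = ∑θ (λ θ → ⟦ lookup θ e ∧ Q.reach U 0 θ e ⟧)
      slow : ℕ
      slow = ∑< (Q.scales U) (λ s → ∑θ (λ θ → payoff U θ (suc s)))
      distribute : ∀ a b c d → a * (b * (c + d)) ≡ a * (b * c) + a * (b * d)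
      distribute = solve-∀
      rearrange : ∀ a b c → (a + b) + c ≡ (a + c) + b
      rearrange = solve-∀
      reached-fast : ∀ e θ → ⟦ lookup E e ⟧ * (⟦ lookup U e ⟧ * ⟦ lookup θ e ∧ Q.reach U 0 θ e ⟧) ≤ ⟦ lookup E e ∧ Q.fast U κ θ e ⟧
      reached-fast e θ = ≤-trans
        (≤-reflexive (trans (cong (⟦ lookup E e ⟧ *_) (sym (⟦∧⟧ (lookup U e) (lookup θ e ∧ Q.reach U 0 θ e)))) (sym (⟦∧⟧ (lookup E e) (lookup U e ∧ (lookup θ e ∧ Q.reach U 0 θ e))))))
        (⟦⟧-mono {lookup E e ∧ (lookup U e ∧ (lookup θ e ∧ Q.reach U 0 θ e))} {lookup E e ∧ Q.fast U κ θ e} imp)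
        where
        imp : lookup E e ∧ (lookup U e ∧ (lookup θ e ∧ Q.reach U 0 θ e)) ≡ true → lookup E e ∧ Q.fast U κ θ e ≡ true
        imp q = ∧-intro {lookup E e} {Q.fast U κ θ e} inE (∧-intro {Q.cand U θ e} {span (λ y → Q.sample U θ y ∧ does (Q.level U y ℕ.≤? κ)) e}
            (∧-intro {lookup U e} {lookup θ e} u t′)
            (span-⊆ {λ y → Q.sample U θ y ∧ does (Q.level U y ℕ.≤? Q.level U e)} {λ y → Q.sample U θ y ∧ does (Q.level U y ℕ.≤? κ)}
              (λ {y} z → let (sm , le) = ∧-true {Q.sample U θ y} z in
                ∧-intro {Q.sample U θ y} {does (Q.level U y ℕ.≤? κ)} sm (true-does (Q.level U y ℕ.≤? κ)
                  (≤-trans (does-true (Q.level U y ℕ.≤? Q.level U e) le)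
                    (λ≤κ (≤-trans (LB.count<prefix U {kE} {e} (lookup⇒∈ inE)) (≤-reflexive sizeE))))))
              (Q.reach₀-span U {θ} {e} r)))
          where
          inE = ∧₁ {lookup E e} q
          q₁ = ∧₂ {lookup E e} q
          u  = ∧₁ {lookup U e} q₁
          q₂ = ∧₂ {lookup U e} q₁
          t′ = ∧₁ {lookup θ e} q₂
          r  = ∧₂ {lookup θ e} q₂
      fast-part : ∑ (allFin n) (λ e → ⟦ lookup E e ⟧ * (⟦ lookup U e ⟧ * reached e)) ≤ ∑θ (λ θ → payoff U θ 0) + (∣ R ∣ + ∣ R ∣) * #θ
      fast-part = begin
        ∑ (allFin n) (λ e → ⟦ lookup E e ⟧ * (⟦ lookup U e ⟧ * reached e))
          ≡⟨ ∑-cong (allFin n) (λ e → trans (cong (⟦ lookup E e ⟧ *_) (sym (∑-*ˡ ⟦ lookup U e ⟧ (vecs coin n) _))) (sym (∑-*ˡ ⟦ lookup E e ⟧ (vecs coin n) _))) ⟩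
        ∑ (allFin n) (λ e → ∑θ (λ θ → ⟦ lookup E e ⟧ * (⟦ lookup U e ⟧ * ⟦ lookup θ e ∧ Q.reach U 0 θ e ⟧)))
          ≡⟨ ∑-swap (allFin n) (vecs coin n) _ ⟩
        ∑θ (λ θ → ∑ (allFin n) (λ e → ⟦ lookup E e ⟧ * (⟦ lookup U e ⟧ * ⟦ lookup θ e ∧ Q.reach U 0 θ e ⟧)))
          ≤⟨ ∑-mono (vecs coin n) (λ θ → ≤-trans (∑-mono (allFin n) (λ e → reached-fast e θ)) (excess θ)) ⟩
        ∑θ (λ θ → payoff U θ 0 + (∣ R ∣ + ∣ R ∣))
          ≡⟨ trans (∑-+ (vecs coin n) _ _) (cong (∑θ (λ θ → payoff U θ 0) +_) (trans (∑-const (vecs coin n) _) (*-comm #θ _))) ⟩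
        ∑θ (λ θ → payoff U θ 0) + (∣ R ∣ + ∣ R ∣) * #θ ∎
        where
        excess : ∀ θ → ∑ (allFin n) (λ e → ⟦ lookup E e ∧ Q.fast U κ θ e ⟧) ≤ payoff U θ 0 + (∣ R ∣ + ∣ R ∣)
        excess θ = ≤-trans (m≤n+m∸n F (∣ R ∣ + ∣ R ∣)) (≤-reflexive (trans (+-comm (∣ R ∣ + ∣ R ∣) _)
          (cong (_+ (∣ R ∣ + ∣ R ∣)) (sym (trans (cong (λ b → ⟦ b ⟧ * (F ∸ (∣ R ∣ + ∣ R ∣))) t) (*-identityˡ _))))))
          where F = ∑ (allFin n) (λ e → ⟦ lookup E e ∧ Q.fast U κ θ e ⟧)

    module _ (e : Fin n) where
      private
        a goodU badK badR : ℕ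
        a = ∑U (λ U → ⟦ lookup U e ⟧)
        goodU = ∑U (λ U → ⟦ good U ⟧ * ⟦ lookup U e ⟧)
        badK = ∑U (λ U → ⟦ not (enoughK U) ⟧ * ⟦ lookup U e ⟧)
        badR = ∑U (λ U → ⟦ not (enoughR U) ⟧ * ⟦ lookup U e ⟧)

      union : a ≤ goodU + (badK + badR)
      union = begin
        a ≤⟨ ∑-mono (vecs sampling n) (λ U → pt (enoughK U) (enoughR U) ⟦ lookup U e ⟧) ⟩
        ∑U (λ U → ⟦ good U ⟧ * ⟦ lookup U e ⟧ + (⟦ not (enoughK U) ⟧ * ⟦ lookup U e ⟧ + ⟦ not (enoughR U) ⟧ * ⟦ lookup U e ⟧))
          ≡⟨ trans (∑-+ (vecs sampling n) _ _) (cong (goodU +_) (∑-+ (vecs sampling n) _ _)) ⟩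
        goodU + (badK + badR) ∎
        where
        open ≤-Reasoning
        pt : ∀ p q x → x ≤ ⟦ p ∧ q ⟧ * x + (⟦ not p ⟧ * x + ⟦ not q ⟧ * x)
        pt true  true  x = ≤-reflexive (sym (trans (+-identityʳ (1 * x)) (*-identityˡ x)))
        pt true  false x = ≤-reflexive (sym (*-identityˡ x))
        pt false q     x = ≤-trans (≤-reflexive (sym (*-identityˡ x))) (m≤m+n (1 * x) _)

      -- Given that `e` is outside Q, the two Markov bounds 7/32 and 17/32 add up to 3/4, which
      -- leaves probability at least 1/4.
      typical : a ≤ 4 * goodU
      typical = *-cancelˡ-≤ 8 (+-cancelʳ-≤ (24 * a) (8 * a) (8 * (4 * goodU)) (begin
        8 * a + 24 * a                              ≡⟨ r₁ a ⟩
        32 * a                                      ≤⟨ *-monoʳ-≤ 32 union ⟩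
        32 * (goodU + (badK + badR))                ≡⟨ r₂ goodU badK badR ⟩
        8 * (4 * goodU) + (32 * badK + 32 * badR)   ≤⟨ +-monoʳ-≤ (8 * (4 * goodU)) (+-mono-≤
             (markov-8 {b₂} 8≤b₂ (U-concentration K b₂ e sizeK (≤-trans (s≤s z≤n) 8≤b₂)))
             (markov-1 {b₁} 1≤b₁ (U-concentration R b₁ e sizeR 1≤b₁))) ⟩
        8 * (4 * goodU) + (7 * a + 17 * a)          ≡⟨ cong (8 * (4 * goodU) +_) (r₃ a) ⟩
        8 * (4 * goodU) + 24 * a ∎))
        where
        open ≤-Reasoning
        r₁ : ∀ a → 8 * a + 24 * a ≡ 32 * a
        r₁ = solve-∀
        r₂ : ∀ g x y → 32 * (g + (x + y)) ≡ 8 * (4 * g) + (32 * x + 32 * y)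
        r₂ = solve-∀
        r₃ : ∀ a → 7 * a + 17 * a ≡ 24 * a
        r₃ = solve-∀

      -- The factor is 16 for `e` outside Q, times 4 for typical Q, times 2 for the fair bit.
      typical-half : #U * #θ ≤ 128 * (goodU * half e)
      typical-half = begin
        #U * #θ                    ≡⟨ cong₂ _*_ (sym (U-marginal e)) (sym (θ-marginal e)) ⟩
        16 * a * (2 * half e)      ≤⟨ *-monoˡ-≤ (2 * half e) (*-monoʳ-≤ 16 typical) ⟩
        16 * (4 * goodU) * (2 * half e) ≡⟨ r goodU (half e) ⟩
        128 * (goodU * half e)     ∎
        where
        open ≤-Reasoning
        r : ∀ g h → 16 * (4 * g) * (2 * h) ≡ 128 * (g * h)
        r = solve-∀

    S : ℕ
    S = ∑U total-payoff

    weighted-sum : b₂ * (#U * #θ) ≤ 128 * (S + (∣ R ∣ + ∣ R ∣) * #θ * #U)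
    weighted-sum = begin
      b₂ * (#U * #θ)
        ≡⟨ cong (_* (#U * #θ)) (trans (sym sizeE) (∣∣≡∑ E)) ⟩
      ∑ (allFin n) (λ e → ⟦ lookup E e ⟧) * (#U * #θ)
        ≡⟨ sym (∑-*ʳ (#U * #θ) (allFin n) _) ⟩
      ∑ (allFin n) (λ e → ⟦ lookup E e ⟧ * (#U * #θ))
        ≤⟨ ∑-mono (allFin n) (λ e → *-monoʳ-≤ ⟦ lookup E e ⟧ (typical-half e)) ⟩
      ∑ (allFin n) (λ e → ⟦ lookup E e ⟧ * (128 * (∑U (λ U → ⟦ good U ⟧ * ⟦ lookup U e ⟧) * half e)))
        ≡⟨ ∑-cong (allFin n) (λ e → trans (*-leftComm ⟦ lookup E e ⟧ 128 _) (cong (128 *_) (pull e))) ⟩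
      ∑ (allFin n) (λ e → 128 * ∑U (λ U → ⟦ good U ⟧ * (⟦ lookup E e ⟧ * (⟦ lookup U e ⟧ * half e))))
        ≡⟨ ∑-*ˡ 128 (allFin n) _ ⟩
      128 * ∑ (allFin n) (λ e → ∑U (λ U → ⟦ good U ⟧ * (⟦ lookup E e ⟧ * (⟦ lookup U e ⟧ * half e))))
        ≡⟨ cong (128 *_) (trans (∑-swap (allFin n) (vecs sampling n) _) (∑-cong (vecs sampling n) (λ U → ∑-*ˡ ⟦ good U ⟧ (allFin n) _))) ⟩
      128 * ∑U (λ U → ⟦ good U ⟧ * weighted U)
        ≤⟨ *-monoʳ-≤ 128 (∑-mono (vecs sampling n) weighted-payoff) ⟩
      128 * ∑U (λ U → total-payoff U + (∣ R ∣ + ∣ R ∣) * #θ)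
        ≡⟨ cong (128 *_) (trans (∑-+ (vecs sampling n) _ _) (cong (S +_) (trans (∑-const (vecs sampling n) _) (*-comm #U _)))) ⟩
      128 * (S + (∣ R ∣ + ∣ R ∣) * #θ * #U) ∎
      where
      open ≤-Reasoning
      pull : ∀ e → ⟦ lookup E e ⟧ * (∑U (λ U → ⟦ good U ⟧ * ⟦ lookup U e ⟧) * half e) ≡
                   ∑U (λ U → ⟦ good U ⟧ * (⟦ lookup E e ⟧ * (⟦ lookup U e ⟧ * half e)))
      pull e = trans (cong (⟦ lookup E e ⟧ *_) (sym (∑-*ʳ (half e) (vecs sampling n) _)))
        (trans (sym (∑-*ˡ ⟦ lookup E e ⟧ (vecs sampling n) _))
          (∑-cong (vecs sampling n) (λ U → r ⟦ lookup E e ⟧ ⟦ good U ⟧ ⟦ lookup U e ⟧ (half e))))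
        where
        r : ∀ a g u h → a * (g * u * h) ≡ g * (a * (u * h))
        r = solve-∀

    -- Origin of the base: the loss is 128 times `4 * b₁`, which is half of `b₂`. Doubling
    -- `weighted-sum` and cancelling one copy absorbs it.
    payoff-large : b₂ ≡ 1024 * b₁ → b₂ * (#U * #θ) ≤ 256 * S
    payoff-large q = +-cancelʳ-≤ x x (256 * S) (begin
      x + x                                        ≤⟨ +-mono-≤ weighted-sum weighted-sum ⟩
      y + y                                        ≡⟨ cong (λ r → 128 * (S + (r + r) * #θ * #U) + 128 * (S + (r + r) * #θ * #U)) {∣ R ∣} {2 * b₁} sizeR ⟩
      128 * (S + (2 * b₁ + 2 * b₁) * #θ * #U) + 128 * (S + (2 * b₁ + 2 * b₁) * #θ * #U)
                                                   ≡⟨ r b₁ S #θ #U ⟩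
      256 * S + 1024 * b₁ * (#U * #θ)              ≡⟨ cong (λ b → 256 * S + b * (#U * #θ)) {1024 * b₁} {b₂} (sym q) ⟩
      256 * S + x ∎)
      where
      open ≤-Reasoning
      x y : ℕ
      x = b₂ * (#U * #θ)
      y = 128 * (S + (∣ R ∣ + ∣ R ∣) * #θ * #U)
      r : ∀ b s t u → 128 * (s + (2 * b + 2 * b) * t * u) + 128 * (s + (2 * b + 2 * b) * t * u) ≡ 256 * s + 1024 * b * (u * t)
      r = solve-∀

    prefix-runs : b₂ ≡ 1024 * b₁ → k * (b₂ * (#U * #θ)) * P ≤ 256 * runs (within l)
    prefix-runs q = begin
      k * (b₂ * (#U * #θ)) * P   ≤⟨ *-monoˡ-≤ P (*-monoʳ-≤ k (payoff-large q)) ⟩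
      k * (256 * S) * P          ≡⟨ r k S P ⟩
      256 * (P * (k * S))        ≤⟨ *-monoʳ-≤ 256 (payoff-runs (within l) payoff payoff-accepted) ⟩
      256 * runs (within l)      ∎
      where
      open ≤-Reasoning
      r : ∀ k s p → k * (256 * s) * p ≡ 256 * (p * (k * s))
      r = solve-∀

-- Logarithms and geometric classes

2*⌊n/2⌋≤n : ∀ n → 2 * ⌊ n /2⌋ ≤ n
2*⌊n/2⌋≤n zero          = z≤n
2*⌊n/2⌋≤n (suc zero)    = z≤n
2*⌊n/2⌋≤n (suc (suc n)) = ≤-trans (≤-reflexive (*-suc 2 ⌊ n /2⌋)) (s≤s (s≤s (2*⌊n/2⌋≤n n)))

2^log≤n : ∀ n .{{_ : ℕ.NonZero n}} → 2 ^ ⌊log₂ n ⌋ ≤ n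
2^log≤n n = go n (<-wellFounded n)
  where
  go : ∀ n .{{_ : ℕ.NonZero n}} → Acc _<_ n → 2 ^ ⌊log₂ n ⌋ ≤ n
  go (suc zero) _ = ≤-refl
  go (suc (suc m)) (acc rs) = begin
    2 ^ ⌊log₂ suc (suc m) ⌋               ≡⟨ cong (2 ^_) (sym (m+[n∸m]≡n {1} (⌊log₂⌋-mono-≤ {2} {suc (suc m)} (s≤s (s≤s z≤n))))) ⟩
    2 * 2 ^ (⌊log₂ suc (suc m) ⌋ ∸ 1)     ≡⟨ cong (λ t → 2 * 2 ^ t) (sym (⌊log₂⌊n/2⌋⌋≡⌊log₂n⌋∸1 (suc (suc m)))) ⟩
    2 * 2 ^ ⌊log₂ suc ⌊ m /2⌋ ⌋           ≤⟨ *-monoʳ-≤ 2 (go (suc ⌊ m /2⌋) (rs (⌊n/2⌋<n (suc m)))) ⟩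
    2 * suc ⌊ m /2⌋                       ≤⟨ 2*⌊n/2⌋≤n (suc (suc m)) ⟩
    suc (suc m)                           ∎
    where open ≤-Reasoning

n<2^n : ∀ n → n < 2 ^ n
n<2^n zero    = s≤s z≤n
n<2^n (suc n) = ≤-trans (+-mono-≤ (m^n>0 2 n) (n<2^n n)) (≤-reflexive (cong (2 ^ n +_) (sym (+-identityʳ (2 ^ n)))))

log< : ∀ n → ⌊log₂ suc n ⌋ ≤ n
log< n = ≤-pred (≤-trans (n<2^n ⌊log₂ suc n ⌋) (2^log≤n (suc n)))

log≤ : ∀ n → ⌊log₂ n ⌋ ≤ n
log≤ zero    = z≤n
log≤ (suc n) = m≤n⇒m≤1+n (log< n)

log-suc : ∀ n → ⌊log₂ suc n ⌋ ≤ suc ⌊log₂ n ⌋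
log-suc zero    = z≤n
log-suc (suc n) = ≤-trans (⌊log₂⌋-mono-≤ (≤-trans (s≤s (m≤n+m (suc n) n)) (≤-reflexive (cong (λ t → suc (n + suc t)) (sym (+-identityʳ n))))))
  (≤-reflexive (⌊log₂[2*b]⌋≡1+⌊log₂b⌋ (suc n)))

-- The base is 2^10, whence the division by 10 in class.  It is opaque because the type checker
-- would unfold products by a literal.

opaque
  base : ℕ
  base = 1024

  base≡1024 : base ≡ 1024
  base≡1024 = refl

  base-nonZero : ℕ.NonZero base
  base-nonZero = _

-- Class 0 contains only 0, and class `suc κ` is the interval from `base ^ κ` up to but excluding
-- `base ^ suc κ`. So `class a ≤ κ` is equivalent to `a < base ^ κ`, which `class-cut` and `class-≤`
-- express.
class : ℕ → ℕ
class zero    = 0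
class (suc a) = suc (⌊log₂ suc a ⌋ / 10)

class-mono : ∀ {a b} → a ≤ b → class a ≤ class b
class-mono {zero}          _ = z≤n
class-mono {suc a} {suc b} l = s≤s (/-monoˡ-≤ 10 (⌊log₂⌋-mono-≤ l))

class≤log : ∀ a → class a ≤ suc ⌊log₂ a ⌋
class≤log zero    = z≤n
class≤log (suc a) = s≤s (m/n≤m ⌊log₂ suc a ⌋ 10)

base^ : ∀ κ → base ^ κ ≡ 2 ^ (κ * 10)
base^ κ = trans (trans (cong (_^ κ) base≡1024) (^-*-assoc 2 10 κ)) (cong (2 ^_) (*-comm 10 κ))

class-cut : ∀ {κ} a → class a ≤ κ → a < base ^ κ
class-cut {κ}     zero    _ = m^n>0 base {{base-nonZero}} κ
class-cut {suc κ} (suc a) (s≤s l) = ≰⇒> λ le → <⇒≱ (begin-strict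
    κ                            <⟨ n<1+n κ ⟩
    suc κ                        ≡⟨ sym (m*n/n≡m (suc κ) 10) ⟩
    suc κ * 10 / 10              ≤⟨ /-monoˡ-≤ 10 (begin
      suc κ * 10                   ≡⟨ sym (⌊log₂[2^n]⌋≡n (suc κ * 10)) ⟩
      ⌊log₂ 2 ^ (suc κ * 10) ⌋     ≡⟨ cong ⌊log₂_⌋ (sym (base^ (suc κ))) ⟩
      ⌊log₂ base ^ suc κ ⌋         ≤⟨ ⌊log₂⌋-mono-≤ le ⟩
      ⌊log₂ suc a ⌋                ∎) ⟩
    ⌊log₂ suc a ⌋ / 10           ∎) l
  where open ≤-Reasoning

class-≤ : ∀ {κ} a → a < base ^ κ → class a ≤ κ
class-≤ {κ} zero    _ = z≤n
class-≤ {κ} (suc a) l = m<n*o⇒m/o<n {m = ⌊log₂ suc a ⌋} {n = κ} {o = 10} (≰⇒> λ le → <⇒≱ l (begin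
    base ^ κ            ≡⟨ base^ κ ⟩
    2 ^ (κ * 10)        ≤⟨ ^-monoʳ-≤ 2 le ⟩
    2 ^ ⌊log₂ suc a ⌋   ≤⟨ 2^log≤n (suc a) ⟩
    suc a               ∎))
  where open ≤-Reasoning

words-pos : ∀ {C : Set} (p : C) ps n → 1 ≤ ∑ (words (p ∷ ps) n) (λ _ → 1)
words-pos p ps zero    = ≤-refl
words-pos p ps (suc n) = ≤-trans (words-pos p ps n)
  (≤-trans (m≤m+n _ _) (≤-reflexive (sym (∑-words-suc (p ∷ ps) n (λ _ → 1)))))

perms-pos : ∀ {A : Set} (xs : List A) → 1 ≤ length (perms xs)
perms-pos []       = ≤-refl
perms-pos (x ∷ xs) = begin
  1                                                          ≤⟨ perms-pos xs ⟩
  length (perms xs)                                          ≡⟨ length≡∑ (perms xs) ⟩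
  ∑ (perms xs) (λ _ → 1)                                     ≤⟨ ∑-mono (perms xs) insertions-pos ⟩
  ∑ (perms xs) (λ π → ∑ (insertions x π) (λ _ → 1))          ≡⟨ sym (∑-concatMap (insertions x) (perms xs) _) ⟩
  ∑ (perms (x ∷ xs)) (λ _ → 1)                               ≡⟨ sym (length≡∑ (perms (x ∷ xs))) ⟩
  length (perms (x ∷ xs))                                    ∎
  where
  open ≤-Reasoning
  insertions-pos : ∀ π → 1 ≤ ∑ (insertions x π) (λ _ → 1)
  insertions-pos []      = ≤-refl
  insertions-pos (y ∷ π) = s≤s z≤n

length-downFrom : ∀ N → ∑ (downFrom N) (λ _ → 1) ≡ N
length-downFrom zero    = refl
length-downFrom (suc N) = cong suc (length-downFrom N)

-- Competitive bounds in terms of counts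

module Guarantee {n : ℕ} (M : Matroid n) (σ : Permutation′ n) (λ̂ : ℕ → ℕ) (λ-mono : ∀ {a b} → a ≤ b → λ̂ a ≤ λ̂ b)
                 {ρ : ℕ} (hr : HasRank M ρ) (N : ℕ) (wide : 2 + ⌊log₂ suc (λ̂ ρ) ⌋ ≤ N) where

  open Optimum M σ
  open Marginals n
  open Runs M σ λ̂ λ-mono N using (runs; module Q)

  w k : ℕ
  w = 2 + ⌊log₂ suc (λ̂ ρ) ⌋
  k = N / w

  enough : ∀ U → k * suc (Q.scales U) ≤ N
  enough U = ≤-trans (*-monoʳ-≤ k (s≤s (s≤s (⌊log₂⌋-mono-≤ (s≤s (λ-mono (LevelBounds.total≤rank M σ λ̂ λ-mono U hr)))))))
    (m/n*n≤m N w)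

  open Bounds M σ λ̂ λ-mono N k enough public

  -- By `wide` every residue is hit at least once, so the remainder of `N` modulo `w` costs at most
  -- a factor 2.
  N≤ : N ≤ 2 * w * k
  N≤ = begin
    N                    ≡⟨ m≡m%n+[m/n]*n N w ⟩
    N % w + k * w        ≤⟨ +-monoˡ-≤ (k * w) (<⇒≤ (m%n<n N w)) ⟩
    w + k * w            ≤⟨ +-monoˡ-≤ (k * w) (≤-trans (≤-reflexive (sym (*-identityˡ w))) (*-monoˡ-≤ w (m≥n⇒m/n>0 wide))) ⟩
    k * w + k * w        ≡⟨ r k w ⟩
    2 * w * k            ∎
    where
    open ≤-Reasoning
    r : ∀ k w → k * w + k * w ≡ 2 * w * k
    r = solve-∀

  #runs : ℕ
  #runs = runs (λ _ → 1)

  #words : ∑ (words palette n) (λ _ → 1) ≡ #U * #θ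
  #words = trans (∑-words-vecs sampling coin n (λ _ _ → 1))
    (trans (∑-const (vecs sampling n) (∑θ (λ _ → 1))) (cong (#U *_) (sym (length≡∑ (vecs coin n)))))

  #runs-eq : #runs ≡ (#U * #θ) * (N * P)
  #runs-eq = begin
    ∑ (words palette n) (λ c → ∑ (downFrom N) (λ j → ∑ (perms (allFin n)) (λ _ → 1)))
      ≡⟨ ∑-cong (words palette n) (λ c → trans (∑-cong (downFrom N) (λ j → trans (sym (length≡∑ (perms (allFin n)))) (sym (*-identityˡ P)))) (∑-*ʳ P (downFrom N) (λ _ → 1))) ⟩
    ∑ (words palette n) (λ c → ∑ (downFrom N) (λ _ → 1) * P)
      ≡⟨ ∑-cong (words palette n) (λ c → trans (cong (_* P) (length-downFrom N)) (sym (*-identityˡ (N * P)))) ⟩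
    ∑ (words palette n) (λ c → 1 * (N * P))
      ≡⟨ ∑-*ʳ (N * P) (words palette n) (λ _ → 1) ⟩
    ∑ (words palette n) (λ _ → 1) * (N * P)
      ≡⟨ cong (_* (N * P)) #words ⟩
    (#U * #θ) * (N * P) ∎
    where open ≡-Reasoning

  #runs-≤ : ∀ m {c v} → m * (k * (#U * #θ) * P) ≤ c * v → m * #runs ≤ 2 * w * c * v
  #runs-≤ m {c} {v} h = begin
    m * #runs                           ≡⟨ cong (m *_) #runs-eq ⟩
    m * ((#U * #θ) * (N * P))           ≤⟨ *-monoʳ-≤ m (*-monoʳ-≤ (#U * #θ) (*-monoˡ-≤ P N≤)) ⟩
    m * ((#U * #θ) * (2 * w * k * P))   ≡⟨ r₁ m (#U * #θ) w k P ⟩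
    2 * w * (m * (k * (#U * #θ) * P))   ≤⟨ *-monoʳ-≤ (2 * w) h ⟩
    2 * w * (c * v)                     ≡⟨ sym (*-assoc (2 * w) c v) ⟩
    2 * w * c * v                       ∎
    where
    open ≤-Reasoning
    r₁ : ∀ m x w k p → m * (x * (2 * w * k * p)) ≡ 2 * w * (m * (k * x * p))
    r₁ = solve-∀

  #runs-pos : 1 ≤ #runs
  #runs-pos = ≤-trans (*-mono-≤ (≤-trans (words-pos (true , false) (List.drop 1 palette) n) (≤-reflexive #words))
    (*-mono-≤ (≤-trans (s≤s z≤n) wide) (perms-pos (allFin n)))) (≤-reflexive (sym #runs-eq))

  element-runs : ∀ {e} → opt e ≡ true → (∀ U → λ̂ (Q.count U e) < λ̂ (suc (Q.count U e))) →
                 #runs ≤ 2 * w * 512 * runs (λ S → ⟦ lookup S e ⟧)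
  element-runs {e} o gap = ≤-trans (≤-reflexive (sym (*-identityˡ #runs)))
    (#runs-≤ 1 {512} {runs (λ S → ⟦ lookup S e ⟧)} (≤-trans (≤-trans (≤-reflexive (*-identityˡ _))
      (*-monoˡ-≤ P (*-monoʳ-≤ k (m≤n*m (#U * #θ) 15)))) (single-runs (guarded o) gap)))

module PrefixGuarantee {n : ℕ} (M : Matroid n) (σ : Permutation′ n) {ρ : ℕ} (hr : HasRank M ρ) (N : ℕ)
                       (wide : 2 + ⌊log₂ suc (class ρ) ⌋ ≤ N) where

  open Optimum M σ
  open Marginals n
  open Guarantee M σ class class-mono hr N wide
  open Runs M σ class class-mono N using (runs; module Q)

  private
    unit : ℕ
    unit = k * (#U * #θ) * P

  -- The first optimal element has count 0, and `class` jumps strictly from 0 to 1, so the bound for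
  -- single elements applies to it. It alone pays for all prefixes of rank below `2 * base`.
  small-prefix : ∀ l → 1 ≤ ∣ optBefore l ∣ → unit ≤ 512 * runs (within l)
  small-prefix l 1≤ with optBefore-ivt l 1≤
  ... | l₁ , l₁≤ , size with nonempty? (optBefore l₁)
  ... | no ¬ne = contradiction (trans (sym size) (trans (cong ∣_∣ (Empty-unique ¬ne)) (∣⊥∣≡0 n))) (λ ())
  ... | yes (e , m) = begin
      unit                                  ≤⟨ *-monoˡ-≤ P (*-monoʳ-≤ k (m≤n*m (#U * #θ) 15)) ⟩
      k * (15 * (#U * #θ)) * P              ≤⟨ single-runs (guarded (proj₁ (∈optBefore⁻ {l₁} {e} m))) first ⟩
      512 * runs (λ S → ⟦ lookup S e ⟧)     ≤⟨ *-monoʳ-≤ 512 (runs-mono (single-within (<-≤-trans (proj₂ (∈optBefore⁻ {l₁} {e} m)) l₁≤))) ⟩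
      512 * runs (within l)                 ∎
    where
    open ≤-Reasoning
    first : ∀ U → class (Q.count U e) < class (suc (Q.count U e))
    first U = subst (λ c → class c < class (suc c)) (sym count0) (s≤s z≤n)
      where
      count0 : Q.count U e ≡ 0
      count0 = n≤0⇒n≡0 (≤-pred (≤-trans (LB.count<prefix U {l₁} {e} m) (≤-reflexive size)))

  -- Take for `b₂` the largest power of `base` not exceeding half the rank. Then a prefix of rank
  -- `2 * b₂` fits before `l`, and the rank is at most `2 * base` times `b₂`.
  large-prefix : ∀ l → 2 * base ≤ ∣ optBefore l ∣ → ∣ optBefore l ∣ * unit ≤ 2 * base * 512 * runs (within l)
  large-prefix l big = by-class (class t) refl
    where
    open ≤-Reasoning
    r t : ℕ
    r = ∣ optBefore l ∣
    t = ⌊ r /2⌋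
    base≤t : base ≤ t
    base≤t = ≤-trans (≤-reflexive (sym (⌊2*n/2⌋ base))) (⌊n/2⌋-mono big)
      where
      ⌊2*n/2⌋ : ∀ n → ⌊ 2 * n /2⌋ ≡ n
      ⌊2*n/2⌋ n = trans (cong (λ m → ⌊ n + m /2⌋) (+-identityʳ n)) (sym (n≡⌊n+n/2⌋ n))
    r≤ : ∀ c → t < c → r ≤ 2 * c
    r≤ c lt = ≤-trans (bound r) (*-monoʳ-≤ 2 lt)
      where
      bound : ∀ r → r ≤ 2 * suc ⌊ r /2⌋
      bound zero          = z≤n
      bound (suc zero)    = s≤s z≤n
      bound (suc (suc r)) = ≤-trans (s≤s (s≤s (bound r))) (≤-reflexive (sym (*-suc 2 (suc ⌊ r /2⌋))))
    by-class : ∀ c → class t ≡ c → r * unit ≤ 2 * base * 512 * runs (within l)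
    by-class zero          q = contradiction (class-cut {0} t (≤-reflexive q)) (≤⇒≯ (≤-trans (ℕ.>-nonZero⁻¹ base {{base-nonZero}}) base≤t))
    by-class (suc zero)    q = contradiction (≤-trans (class-cut {1} t (≤-reflexive q)) (≤-reflexive (*-identityʳ base))) (≤⇒≯ base≤t)
    by-class (suc (suc κ)) q = begin
        r * unit                                  ≤⟨ *-monoˡ-≤ unit (r≤ (base * b₂) (class-cut {suc (suc κ)} t (≤-reflexive q))) ⟩
        2 * (base * b₂) * unit                    ≡⟨ regroup base b₂ k (#U * #θ) P ⟩
        2 * base * (k * (b₂ * (#U * #θ)) * P)     ≤⟨ *-monoʳ-≤ (2 * base) (prefix-runs l l₂ l₁ l₃ (suc κ) b₁ b₂ l₂≤ l₃≤ s₂ s₁ s₃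
                                                       (m^n>0 base {{base-nonZero}} κ) 8≤b₂ (λ {a} → class-≤ a) (λ {a} → class-cut a)
                                                       (λ {a} lt → class-cut {κ} a (≤-pred lt)) (cong (_* b₁) {base} {1024} base≡1024)) ⟩
        -- Weakened to the constant of `small-prefix`, so that all prefixes share one factor.
        2 * base * (256 * runs (within l))        ≤⟨ *-monoʳ-≤ (2 * base) (*-monoˡ-≤ (runs (within l)) (m≤m+n 256 256)) ⟩
        2 * base * (512 * runs (within l))        ≡⟨ sym (*-assoc (2 * base) 512 (runs (within l))) ⟩
        2 * base * 512 * runs (within l)          ∎
      where
      b₁ b₂ : ℕ
      b₁ = base ^ κ
      b₂ = base ^ suc κ
      b₂≤t : b₂ ≤ t
      b₂≤t = ≮⇒≥ λ lt → 1+n≰n (≤-trans (≤-reflexive (sym q)) (class-≤ {suc κ} t lt))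
      2b₂≤r : 2 * b₂ ≤ r
      2b₂≤r = ≤-trans (*-monoʳ-≤ 2 b₂≤t) (2*⌊n/2⌋≤n r)
      b₁≤b₂ : b₁ ≤ b₂
      b₁≤b₂ = m≤n*m b₁ base {{base-nonZero}}
      P₁ = optBefore-ivt l (≤-trans (*-monoʳ-≤ 2 b₁≤b₂) 2b₂≤r)
      P₂ = optBefore-ivt l (≤-trans (m≤n*m b₂ 2) 2b₂≤r)
      P₃ = optBefore-ivt l 2b₂≤r
      l₁ = proj₁ P₁
      s₁ = proj₂ (proj₂ P₁)
      l₂ = proj₁ P₂
      l₂≤ = proj₁ (proj₂ P₂)
      s₂ = proj₂ (proj₂ P₂)
      l₃ = proj₁ P₃
      l₃≤ = proj₁ (proj₂ P₃)
      s₃ = proj₂ (proj₂ P₃)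
      8≤b₂ : 8 ≤ b₂
      8≤b₂ = ≤-trans (≤-trans (m≤m+n 8 1016) (≤-reflexive (sym base≡1024))) (m≤m*n base b₁ {{m^n≢0 base κ {{base-nonZero}}}})
      regroup : ∀ d b k x p → 2 * (d * b) * (k * x * p) ≡ 2 * d * (k * (b * x) * p)
      regroup = solve-∀

  prefix-bound : ∀ l → ∣ optBefore l ∣ * unit ≤ 2 * base * 512 * runs (within l)
  prefix-bound l with 2 * base ℕ.≤? ∣ optBefore l ∣ | 1 ℕ.≤? ∣ optBefore l ∣
  ... | yes big | _     = large-prefix l big
  ... | no _    | no ¬1 = ≤-trans (≤-reflexive (cong (_* unit) (n<1⇒n≡0 (≰⇒> ¬1)))) z≤n
  ... | no ¬big | yes 1≤ = ≤-trans (*-mono-≤ (<⇒≤ (≰⇒> ¬big)) (small-prefix l 1≤)) (≤-reflexive (sym (*-assoc (2 * base) 512 (runs (within l)))))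

  prefix-guarantee : ∀ l → ∣ optBefore l ∣ * #runs ≤ 2 * w * (2 * base * 512) * runs (within l)
  prefix-guarantee l = #runs-≤ ∣ optBefore l ∣ {2 * base * 512} {runs (within l)} (prefix-bound l)

-- Rational arithmetic and Abel summation

toℚᵘ-ℕ→ℚ : ∀ m → toℚᵘ (ℕ→ℚ m) ℚᵘ.≃ ℚᵘ.mkℚᵘ (ℤ.+ m) 0
toℚᵘ-ℕ→ℚ m = ℚₚ.toℚᵘ-fromℚᵘ (ℚᵘ.mkℚᵘ (ℤ.+ m) 0)

ℕ→ℚ-+ : ∀ a b → ℕ→ℚ (a + b) ≡ ℕ→ℚ a ℚ.+ ℕ→ℚ b
ℕ→ℚ-+ a b = ℚₚ.toℚᵘ-injective (begin
  toℚᵘ (ℕ→ℚ (a + b))                                   ≈⟨ toℚᵘ-ℕ→ℚ (a + b) ⟩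
  ℚᵘ.mkℚᵘ (ℤ.+ (a + b)) 0                              ≈⟨ ℚᵘ.*≡* (cong (ℤ._* ℤ.1ℤ) (sym (cong₂ ℤ._+_ (ℤₚ.*-identityʳ (ℤ.+ a)) (ℤₚ.*-identityʳ (ℤ.+ b))))) ⟩
  ℚᵘ.mkℚᵘ (ℤ.+ a) 0 ℚᵘ.+ ℚᵘ.mkℚᵘ (ℤ.+ b) 0             ≈⟨ ℚᵘₚ.≃-sym (ℚᵘₚ.+-cong (toℚᵘ-ℕ→ℚ a) (toℚᵘ-ℕ→ℚ b)) ⟩
  toℚᵘ (ℕ→ℚ a) ℚᵘ.+ toℚᵘ (ℕ→ℚ b)                       ≈⟨ ℚᵘₚ.≃-sym (ℚₚ.toℚᵘ-homo-+ (ℕ→ℚ a) (ℕ→ℚ b)) ⟩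
  toℚᵘ (ℕ→ℚ a ℚ.+ ℕ→ℚ b)                               ∎)
  where open ℚᵘₚ.≃-Reasoning

ℕ→ℚ-* : ∀ a b → ℕ→ℚ (a * b) ≡ ℕ→ℚ a ℚ.* ℕ→ℚ b
ℕ→ℚ-* a b = ℚₚ.toℚᵘ-injective (begin
  toℚᵘ (ℕ→ℚ (a * b))                                   ≈⟨ toℚᵘ-ℕ→ℚ (a * b) ⟩
  ℚᵘ.mkℚᵘ (ℤ.+ (a * b)) 0                              ≈⟨ ℚᵘ.*≡* (cong (ℤ._* ℤ.1ℤ) (ℤₚ.pos-* a b)) ⟩
  ℚᵘ.mkℚᵘ (ℤ.+ a) 0 ℚᵘ.* ℚᵘ.mkℚᵘ (ℤ.+ b) 0             ≈⟨ ℚᵘₚ.≃-sym (ℚᵘₚ.*-cong (toℚᵘ-ℕ→ℚ a) (toℚᵘ-ℕ→ℚ b)) ⟩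
  toℚᵘ (ℕ→ℚ a) ℚᵘ.* toℚᵘ (ℕ→ℚ b)                       ≈⟨ ℚᵘₚ.≃-sym (ℚₚ.toℚᵘ-homo-* (ℕ→ℚ a) (ℕ→ℚ b)) ⟩
  toℚᵘ (ℕ→ℚ a ℚ.* ℕ→ℚ b)                               ∎)
  where open ℚᵘₚ.≃-Reasoning

ℕ→ℚ-inverse : ∀ m → ℕ→ℚ (suc m) ℚ.* (ℤ.+ 1 ℚ./ suc m) ≡ 1ℚ
ℕ→ℚ-inverse m = ℚₚ.toℚᵘ-injective (begin
  toℚᵘ (ℕ→ℚ (suc m) ℚ.* (ℤ.+ 1 ℚ./ suc m))             ≈⟨ ℚₚ.toℚᵘ-homo-* (ℕ→ℚ (suc m)) (ℤ.+ 1 ℚ./ suc m) ⟩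
  toℚᵘ (ℕ→ℚ (suc m)) ℚᵘ.* toℚᵘ (ℤ.+ 1 ℚ./ suc m)       ≈⟨ ℚᵘₚ.*-cong (toℚᵘ-ℕ→ℚ (suc m)) (ℚₚ.toℚᵘ-fromℚᵘ (ℚᵘ.mkℚᵘ (ℤ.+ 1) m)) ⟩
  ℚᵘ.mkℚᵘ (ℤ.+ suc m) 0 ℚᵘ.* ℚᵘ.mkℚᵘ (ℤ.+ 1) m         ≈⟨ ℚᵘ.*≡* (trans (ℤₚ.*-identityʳ _) (trans (ℤₚ.*-identityʳ (ℤ.+ suc m)) (sym (trans (ℤₚ.*-identityˡ _) (ℤₚ.*-identityˡ _))))) ⟩
  ℚᵘ.1ℚᵘ                                               ≈⟨ ℚᵘₚ.≃-refl ⟩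
  toℚᵘ 1ℚ                                              ∎)
  where open ℚᵘₚ.≃-Reasoning

ℕ→ℚ-mono : ∀ {a b} → a ≤ b → ℕ→ℚ a ℚ.≤ ℕ→ℚ b
ℕ→ℚ-mono {a} {b} l = ℚₚ.toℚᵘ-cancel-≤ (ℚᵘₚ.≤-respʳ-≃ (ℚᵘₚ.≃-sym (toℚᵘ-ℕ→ℚ b)) (ℚᵘₚ.≤-respˡ-≃ (ℚᵘₚ.≃-sym (toℚᵘ-ℕ→ℚ a))
  (ℚᵘ.*≤* (ℤₚ.*-monoʳ-≤-nonNeg ℤ.1ℤ (ℤ.+≤+ l)))))

ℕ→ℚ-nonNeg : ∀ m → ℚ.NonNegative (ℕ→ℚ m)
ℕ→ℚ-nonNeg m = ℚ.nonNegative (ℕ→ℚ-mono {0} {m} z≤n)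

1/-nonNeg : ∀ m → ℚ.NonNegative (ℤ.+ 1 ℚ./ suc m)
1/-nonNeg m = ℚ.nonNegative (ℚₚ.toℚᵘ-cancel-≤ (ℚᵘₚ.≤-respʳ-≃ (ℚᵘₚ.≃-sym (ℚₚ.toℚᵘ-fromℚᵘ (ℚᵘ.mkℚᵘ (ℤ.+ 1) m))) (ℚᵘ.*≤* (ℤ.+≤+ z≤n))))

∑ℚ : {A : Set} → List A → (A → ℚ) → ℚ
∑ℚ xs f = sumℚ (map f xs)

∑ℚ-cong : {A : Set} (xs : List A) {f g : A → ℚ} → (∀ x → f x ≡ g x) → ∑ℚ xs f ≡ ∑ℚ xs g
∑ℚ-cong xs e = cong sumℚ (map-cong e xs)

ℚ-+-leftComm : ∀ a b c → a ℚ.+ (b ℚ.+ c) ≡ b ℚ.+ (a ℚ.+ c)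
ℚ-+-leftComm a b c = trans (sym (ℚₚ.+-assoc a b c)) (trans (cong (ℚ._+ c) (ℚₚ.+-comm a b)) (ℚₚ.+-assoc b a c))

∑ℚ-+ : {A : Set} (xs : List A) (f g : A → ℚ) → ∑ℚ xs (λ x → f x ℚ.+ g x) ≡ ∑ℚ xs f ℚ.+ ∑ℚ xs g
∑ℚ-+ []       f g = refl
∑ℚ-+ (x ∷ xs) f g = begin
  (f x ℚ.+ g x) ℚ.+ ∑ℚ xs (λ y → f y ℚ.+ g y) ≡⟨ cong ((f x ℚ.+ g x) ℚ.+_) (∑ℚ-+ xs f g) ⟩
  (f x ℚ.+ g x) ℚ.+ (∑ℚ xs f ℚ.+ ∑ℚ xs g)     ≡⟨ ℚₚ.+-assoc (f x) (g x) _ ⟩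
  f x ℚ.+ (g x ℚ.+ (∑ℚ xs f ℚ.+ ∑ℚ xs g))     ≡⟨ cong (f x ℚ.+_) (ℚ-+-leftComm (g x) (∑ℚ xs f) (∑ℚ xs g)) ⟩
  f x ℚ.+ (∑ℚ xs f ℚ.+ (g x ℚ.+ ∑ℚ xs g))     ≡⟨ sym (ℚₚ.+-assoc (f x) (∑ℚ xs f) _) ⟩
  (f x ℚ.+ ∑ℚ xs f) ℚ.+ (g x ℚ.+ ∑ℚ xs g)     ∎
  where open ≡-Reasoning

∑ℚ-*ʳ : {A : Set} (k : ℚ) (xs : List A) (f : A → ℚ) → ∑ℚ xs (λ x → f x ℚ.* k) ≡ ∑ℚ xs f ℚ.* k
∑ℚ-*ʳ k []       f = sym (ℚₚ.*-zeroˡ k)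
∑ℚ-*ʳ k (x ∷ xs) f = trans (cong (f x ℚ.* k ℚ.+_) (∑ℚ-*ʳ k xs f)) (sym (ℚₚ.*-distribʳ-+ k (f x) (∑ℚ xs f)))

∑ℚ-zero : {A : Set} (xs : List A) → ∑ℚ xs (λ _ → 0ℚ) ≡ 0ℚ
∑ℚ-zero []       = refl
∑ℚ-zero (x ∷ xs) = trans (ℚₚ.+-identityˡ _) (∑ℚ-zero xs)

∑ℚ-↭ : {A : Set} {xs ys : List A} (f : A → ℚ) → xs ↭ ys → ∑ℚ xs f ≡ ∑ℚ ys f
∑ℚ-↭ f ↭refl        = refl
∑ℚ-↭ f (prep x p)   = cong (f x ℚ.+_) (∑ℚ-↭ f p)
∑ℚ-↭ f (swap x y p) = trans (cong (λ t → f x ℚ.+ (f y ℚ.+ t)) (∑ℚ-↭ f p)) (ℚ-+-leftComm (f x) (f y) _)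
∑ℚ-↭ f (↭trans p q) = trans (∑ℚ-↭ f p) (∑ℚ-↭ f q)

∑ℚ-allFin-suc : ∀ n (f : Fin (suc n) → ℚ) → ∑ℚ (allFin (suc n)) f ≡ f zero ℚ.+ ∑ℚ (allFin n) (f ∘ suc)
∑ℚ-allFin-suc n f = cong (λ l → f zero ℚ.+ sumℚ l)
  (trans (cong (map f) (sym (map-tabulate id suc))) (sym (map-∘ (allFin n))))

-- Abel summation; the induction needs the surplus c.
abel : ∀ n (w : Fin n → ℚ) (u v : Fin n → ℕ) (c : ℕ) (W : ℚ) → (∀ i → w i ℚ.≤ W) → (∀ i → 0ℚ ℚ.≤ w i) → 0ℚ ℚ.≤ W →
       (∀ i j → toℕ i < toℕ j → w j ℚ.≤ w i) →
       (∀ l → ∑ (allFin n) (λ i → ⟦ does (toℕ i ℕ.<? l) ⟧ * v i) ≤ c + ∑ (allFin n) (λ i → ⟦ does (toℕ i ℕ.<? l) ⟧ * u i)) →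
       ∑ℚ (allFin n) (λ i → w i ℚ.* ℕ→ℚ (v i)) ℚ.≤ W ℚ.* ℕ→ℚ c ℚ.+ ∑ℚ (allFin n) (λ i → w i ℚ.* ℕ→ℚ (u i))
abel zero w u v c W w≤W w≥0 W≥0 mono pre =
  ℚₚ.≤-trans (ℚₚ.≤-reflexive (sym (ℚₚ.*-zeroˡ (ℕ→ℚ c))))
    (ℚₚ.≤-trans (ℚₚ.*-monoʳ-≤-nonNeg (ℕ→ℚ c) {{ℕ→ℚ-nonNeg c}} W≥0) (ℚₚ.≤-reflexive (sym (ℚₚ.+-identityʳ _))))
abel (suc n) w u v c W w≤W w≥0 W≥0 mono pre = begin
  ∑ℚ (allFin (suc n)) (λ i → w i ℚ.* ℕ→ℚ (v i))
    ≡⟨ ∑ℚ-allFin-suc n (λ i → w i ℚ.* ℕ→ℚ (v i)) ⟩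
  w₀ ℚ.* ℕ→ℚ v₀ ℚ.+ ∑ℚ (allFin n) (λ i → w (suc i) ℚ.* ℕ→ℚ (v (suc i)))
    ≤⟨ ℚₚ.+-monoʳ-≤ (w₀ ℚ.* ℕ→ℚ v₀) (abel n (w ∘ suc) (u ∘ suc) (v ∘ suc) c′ w₀ (λ i → mono zero (suc i) (s≤s z≤n)) (λ i → w≥0 (suc i)) (w≥0 zero)
         (λ i j l → mono (suc i) (suc j) (s≤s l)) pre′) ⟩
  w₀ ℚ.* ℕ→ℚ v₀ ℚ.+ (w₀ ℚ.* ℕ→ℚ c′ ℚ.+ T)
    ≡⟨ sym (ℚₚ.+-assoc (w₀ ℚ.* ℕ→ℚ v₀) (w₀ ℚ.* ℕ→ℚ c′) T) ⟩
  (w₀ ℚ.* ℕ→ℚ v₀ ℚ.+ w₀ ℚ.* ℕ→ℚ c′) ℚ.+ T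
    ≡⟨ cong (ℚ._+ T) (trans (sym (ℚₚ.*-distribˡ-+ w₀ (ℕ→ℚ v₀) (ℕ→ℚ c′))) (trans (cong (w₀ ℚ.*_) carry) (ℚₚ.*-distribˡ-+ w₀ (ℕ→ℚ c) (ℕ→ℚ u₀)))) ⟩
  (w₀ ℚ.* ℕ→ℚ c ℚ.+ w₀ ℚ.* ℕ→ℚ u₀) ℚ.+ T
    ≡⟨ ℚₚ.+-assoc (w₀ ℚ.* ℕ→ℚ c) (w₀ ℚ.* ℕ→ℚ u₀) T ⟩
  w₀ ℚ.* ℕ→ℚ c ℚ.+ (w₀ ℚ.* ℕ→ℚ u₀ ℚ.+ T)
    ≤⟨ ℚₚ.+-monoˡ-≤ (w₀ ℚ.* ℕ→ℚ u₀ ℚ.+ T) (ℚₚ.*-monoʳ-≤-nonNeg (ℕ→ℚ c) {{ℕ→ℚ-nonNeg c}} (w≤W zero)) ⟩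
  W ℚ.* ℕ→ℚ c ℚ.+ (w₀ ℚ.* ℕ→ℚ u₀ ℚ.+ T)
    ≡⟨ cong (W ℚ.* ℕ→ℚ c ℚ.+_) (sym (∑ℚ-allFin-suc n (λ i → w i ℚ.* ℕ→ℚ (u i)))) ⟩
  W ℚ.* ℕ→ℚ c ℚ.+ ∑ℚ (allFin (suc n)) (λ i → w i ℚ.* ℕ→ℚ (u i)) ∎
  where
  open ℚₚ.≤-Reasoning
  w₀ = w zero
  v₀ = v zero
  u₀ = u zero
  -- The surplus handed on, now valued at the weight `w₀`; the prefix hypothesis at length 1 makes
  -- the subtraction exact.
  c′ : ℕ
  c′ = (c + u₀) ∸ v₀
  T = ∑ℚ (allFin n) (λ i → w (suc i) ℚ.* ℕ→ℚ (u (suc i)))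
  prefix : (Fin (suc n) → ℕ) → ℕ → ℕ
  prefix f l = ∑ (allFin n) (λ i → ⟦ does (toℕ i ℕ.<? l) ⟧ * f (suc i))
  expand : ∀ f l → ∑ (allFin (suc n)) (λ i → ⟦ does (toℕ i ℕ.<? suc l) ⟧ * f i) ≡ f zero + prefix f l
  expand f l = trans (∑-allFin-suc n (λ i → ⟦ does (toℕ i ℕ.<? suc l) ⟧ * f i)) (cong (_+ prefix f l) (*-identityˡ (f zero)))
  step : ∀ l → v₀ + prefix v l ≤ (c + u₀) + prefix u l
  step l = ≤-trans (≤-reflexive (sym (expand v l))) (≤-trans (pre (suc l))
    (≤-reflexive (trans (cong (c +_) (expand u l)) (sym (+-assoc c u₀ _)))))
  v₀≤ : v₀ ≤ c + u₀
  v₀≤ = ≤-trans (m≤m+n v₀ (prefix v 0)) (≤-trans (step 0)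
    (≤-reflexive (trans (cong ((c + u₀) +_) (∑-zero (allFin n))) (+-identityʳ (c + u₀)))))
  carry : ℕ→ℚ v₀ ℚ.+ ℕ→ℚ c′ ≡ ℕ→ℚ c ℚ.+ ℕ→ℚ u₀
  carry = trans (sym (ℕ→ℚ-+ v₀ c′)) (trans (cong ℕ→ℚ (m+[n∸m]≡n v₀≤)) (ℕ→ℚ-+ c u₀))
  pre′ : ∀ l → prefix v l ≤ c′ + prefix u l
  pre′ l = +-cancelˡ-≤ v₀ _ _ (≤-trans (step l) (≤-reflexive (trans (cong (_+ prefix u l) (sym (m+[n∸m]≡n v₀≤))) (+-assoc v₀ c′ _))))

mean-bound : ∀ (L : List ℚ) {v : ℚ} (a : ℕ) → 1 ≤ length L → v ℚ.* ℕ→ℚ (length L) ℚ.≤ ℕ→ℚ a ℚ.* sumℚ L → v ℚ.≤ ℕ→ℚ a ℚ.* mean L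
mean-bound (x ∷ xs) {v} a _ h = begin
  v                                             ≡⟨ sym (ℚₚ.*-identityʳ v) ⟩
  v ℚ.* 1ℚ                                      ≡⟨ cong (v ℚ.*_) (sym (ℕ→ℚ-inverse (length xs))) ⟩
  v ℚ.* (ℕ→ℚ (suc (length xs)) ℚ.* r)           ≡⟨ sym (ℚₚ.*-assoc v _ r) ⟩
  v ℚ.* ℕ→ℚ (suc (length xs)) ℚ.* r             ≤⟨ ℚₚ.*-monoʳ-≤-nonNeg r {{1/-nonNeg (length xs)}} h ⟩
  ℕ→ℚ a ℚ.* sumℚ (x ∷ xs) ℚ.* r                 ≡⟨ ℚₚ.*-assoc (ℕ→ℚ a) (sumℚ (x ∷ xs)) r ⟩
  ℕ→ℚ a ℚ.* (sumℚ (x ∷ xs) ℚ.* r)               ∎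
  where
  open ℚₚ.≤-Reasoning
  r = ℤ.+ 1 ℚ./ suc (length xs)

-- The algorithm and its expectation

-- Only `n` is known in advance; as the rank is at most `n`, this exceeds the possible number of
-- scales for both choices of levels.
scaleSeeds : ℕ → ℕ
scaleSeeds n = 4 + n

seedList : ℕ → List (List Colour × ℕ)
seedList n = pairs (words palette n) (downFrom (scaleSeeds n))

seedList-pos : ∀ n → 1 ≤ length (seedList n)
seedList-pos n = begin
  1                                                                       ≤⟨ words-pos (true , false) (List.drop 1 palette) n ⟩
  ∑ (words palette n) (λ _ → 1)                                           ≤⟨ ∑-mono (words palette n) (λ _ → s≤s z≤n) ⟩
  ∑ (words palette n) (λ _ → ∑ (downFrom (scaleSeeds n)) (λ _ → 1))       ≡⟨ sym (∑-pairs (words palette n) (downFrom (scaleSeeds n)) (λ _ → 1)) ⟩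
  ∑ (seedList n) (λ _ → 1)                                                ≡⟨ sym (length≡∑ (seedList n)) ⟩
  length (seedList n) ∎
  where open ≤-Reasoning

#seeds : ∀ n → suc (ℕ.pred (length (seedList n))) ≡ length (seedList n)
#seeds n = suc-pred (length (seedList n)) {{ℕ.>-nonZero (seedList-pos n)}}

seedAt : ∀ n → Fin (suc (ℕ.pred (length (seedList n)))) → List Colour × ℕ
seedAt n i = List.lookup (seedList n) (Fin.cast (#seeds n) i)

algorithm : (ℕ → ℕ) → Algorithm
algorithm λ̂ = record
  { seeds = λ n → ℕ.pred (length (seedList n))
  ; run   = λ n i → decider λ̂ (proj₁ (seedAt n i)) (proj₂ (seedAt n i))
  }

tabulate-lookup-cast : ∀ {A : Set} (L : List A) {m} (eq : m ≡ length L) → map (List.lookup L ∘ Fin.cast eq) (allFin m) ≡ L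
tabulate-lookup-cast L refl = trans (map-cong (λ i → cong (List.lookup L) (Finₚ.cast-is-id refl i)) (allFin (length L)))
  (map-lookup-allFin L)

module Expectation {n : ℕ} (M : Matroid n) (σ : Permutation′ n) (λ̂ : ℕ → ℕ) (λ-mono : ∀ {a b} → a ≤ b → λ̂ a ≤ λ̂ b) where

  open Runs M σ λ̂ λ-mono (scaleSeeds n) using (runs)

  outcomesAt : List Colour × ℕ → List (Subset n)
  outcomesAt (c , j) = map (λ π → execute M σ (decider λ̂ c j) π) (perms (allFin n))

  outcomes : List (Subset n)
  outcomes = concatMap outcomesAt (seedList n)

  ∑-outcomes : ∀ X → ∑ outcomes X ≡ runs X
  ∑-outcomes X = trans (∑-concatMap outcomesAt (seedList n) X)
    (trans (∑-pairs (words palette n) (downFrom (scaleSeeds n)) _)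
      (∑-cong (words palette n) (λ c → ∑-cong (downFrom (scaleSeeds n)) (λ j → ∑-map _ (perms (allFin n)) X))))

  𝔼≡mean : ∀ X → 𝔼 (algorithm λ̂) M σ X ≡ mean (map X outcomes)
  𝔼≡mean X = cong mean (begin
    concatMap (λ s → map (λ arr → X (execute M σ (run (algorithm λ̂) n s) arr)) (perms (allFin n))) (allFin (suc (seeds (algorithm λ̂) n)))
      ≡⟨ concatMap-cong (λ s → map-∘ {g = X} {f = λ arr → execute M σ (run (algorithm λ̂) n s) arr} (perms (allFin n))) (allFin (suc (seeds (algorithm λ̂) n))) ⟩
    concatMap (λ s → map X (outcomesAt (seedAt n s))) (allFin (suc (seeds (algorithm λ̂) n)))
      ≡⟨ sym (concatMap-map (λ s → map X (outcomesAt s)) (seedAt n) (allFin (suc (seeds (algorithm λ̂) n)))) ⟩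
    concatMap (λ s → map X (outcomesAt s)) (map (seedAt n) (allFin (suc (seeds (algorithm λ̂) n))))
      ≡⟨ cong (concatMap (λ s → map X (outcomesAt s))) (tabulate-lookup-cast (seedList n) (#seeds n)) ⟩
    concatMap (λ s → map X (outcomesAt s)) (seedList n)
      ≡⟨ sym (map-concatMap X outcomesAt (seedList n)) ⟩
    map X outcomes ∎)
    where open ≡-Reasoning

  #outcomes : ∀ (X : Subset n → ℚ) → length (map X outcomes) ≡ runs (λ _ → 1)
  #outcomes X = trans (length-map X outcomes) (trans (length≡∑ outcomes) (∑-outcomes (λ _ → 1)))

  ∈?-lookup : ∀ (e : Fin n) (S : Subset n) → does (e ∈? S) ≡ lookup S e
  ∈?-lookup e S = ≡-from-⇔ (λ d → ∈⇒lookup (does-true (e ∈? S) d)) (λ l → true-does (e ∈? S) (lookup⇒∈ l))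

  indicator-lookup : ∀ e S → indicator e S ≡ ℕ→ℚ ⟦ lookup S e ⟧
  indicator-lookup e S rewrite ∈?-lookup e S with lookup S e
  ... | true  = refl
  ... | false = refl

  weight-lookup : ∀ w S → weight w S ≡ ∑ℚ (allFin n) (λ e → w e ℚ.* ℕ→ℚ ⟦ lookup S e ⟧)
  weight-lookup w S = ∑ℚ-cong (allFin n) pt
    where
    pt : ∀ e → (if does (e ∈? S) then w e else 0ℚ) ≡ w e ℚ.* ℕ→ℚ ⟦ lookup S e ⟧
    pt e rewrite ∈?-lookup e S with lookup S e
    ... | true  = sym (ℚₚ.*-identityʳ (w e))
    ... | false = sym (ℚₚ.*-zeroʳ (w e))

  sum-indicator : ∀ e L → sumℚ (map (indicator e) L) ≡ ℕ→ℚ (∑ L (λ S → ⟦ lookup S e ⟧))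
  sum-indicator e []      = refl
  sum-indicator e (S ∷ L) = trans (cong₂ ℚ._+_ (indicator-lookup e S) (sum-indicator e L)) (sym (ℕ→ℚ-+ ⟦ lookup S e ⟧ _))

  sum-weight : ∀ w L → sumℚ (map (weight w) L) ≡ ∑ℚ (allFin n) (λ e → w e ℚ.* ℕ→ℚ (∑ L (λ S → ⟦ lookup S e ⟧)))
  sum-weight w []      = sym (trans (∑ℚ-cong (allFin n) (λ e → ℚₚ.*-zeroʳ (w e))) (∑ℚ-zero (allFin n)))
  sum-weight w (S ∷ L) = trans (cong₂ ℚ._+_ (weight-lookup w S) (sum-weight w L))
    (trans (sym (∑ℚ-+ (allFin n) _ _)) (∑ℚ-cong (allFin n) (λ e →
      trans (sym (ℚₚ.*-distribˡ-+ (w e) (ℕ→ℚ ⟦ lookup S e ⟧) _)) (cong (w e ℚ.*_) (sym (ℕ→ℚ-+ ⟦ lookup S e ⟧ _))))))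

  indicator-bound : ∀ e a → 1 ≤ runs (λ _ → 1) → runs (λ _ → 1) ≤ a * runs (λ S → ⟦ lookup S e ⟧) →
                    1ℚ ℚ.≤ ℕ→ℚ a ℚ.* 𝔼 (algorithm λ̂) M σ (indicator e)
  indicator-bound e a nonempty h = subst (λ m → 1ℚ ℚ.≤ ℕ→ℚ a ℚ.* m) (sym (𝔼≡mean (indicator e)))
    (mean-bound (map (indicator e) outcomes) a (subst (1 ≤_) (sym (#outcomes (indicator e))) nonempty) (begin
      1ℚ ℚ.* ℕ→ℚ (length (map (indicator e) outcomes))   ≡⟨ trans (ℚₚ.*-identityˡ _) (cong ℕ→ℚ (#outcomes (indicator e))) ⟩
      ℕ→ℚ (runs (λ _ → 1))                               ≤⟨ ℕ→ℚ-mono h ⟩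
      ℕ→ℚ (a * runs (λ S → ⟦ lookup S e ⟧))              ≡⟨ ℕ→ℚ-* a _ ⟩
      ℕ→ℚ a ℚ.* ℕ→ℚ (runs (λ S → ⟦ lookup S e ⟧))        ≡⟨ cong (λ m → ℕ→ℚ a ℚ.* ℕ→ℚ m) (sym (∑-outcomes (λ S → ⟦ lookup S e ⟧))) ⟩
      ℕ→ℚ a ℚ.* ℕ→ℚ (∑ outcomes (λ S → ⟦ lookup S e ⟧))  ≡⟨ cong (ℕ→ℚ a ℚ.*_) (sym (sum-indicator e outcomes)) ⟩
      ℕ→ℚ a ℚ.* sumℚ (map (indicator e) outcomes)        ∎))
    where open ℚₚ.≤-Reasoning

  open Optimum M σ

  ranked : map (σ ⟨$⟩ʳ_) (allFin n) ↭ allFin n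
  ranked = ∼bag⇒↭ (unique∧set⇒bag (map⁺ inj (allFin⁺ n)) (allFin⁺ n)
    (λ {x} → mk⇔ (λ _ → ∈-allFin x) (λ _ → subst (λ y → y ∈ˡ map (σ ⟨$⟩ʳ_) (allFin n)) (inverseʳ σ) (∈-map⁺ (σ ⟨$⟩ʳ_) (∈-allFin (σ ⟨$⟩ˡ x))))))
    where
    inj : ∀ {x y} → σ ⟨$⟩ʳ x ≡ σ ⟨$⟩ʳ y → x ≡ y
    inj e = trans (sym (inverseˡ σ)) (trans (cong (σ ⟨$⟩ˡ_) e) (inverseˡ σ))

  ∑-ranked : ∀ f → ∑ (allFin n) (λ i → f (σ ⟨$⟩ʳ i)) ≡ ∑ (allFin n) f
  ∑-ranked f = trans (sym (∑-map (σ ⟨$⟩ʳ_) (allFin n) f)) (∑-↭ f ranked)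

  ∑ℚ-ranked : ∀ f → ∑ℚ (allFin n) (λ i → f (σ ⟨$⟩ʳ i)) ≡ ∑ℚ (allFin n) f
  ∑ℚ-ranked f = trans (cong sumℚ (map-∘ (allFin n))) (∑ℚ-↭ f ranked)

  weight-bound : ∀ a → 1 ≤ runs (λ _ → 1) →
    (∀ l → ∣ optBefore l ∣ * runs (λ _ → 1) ≤ a * runs (λ S → ∑ (allFin n) (λ x → ⟦ lookup S x ∧ before? l x ⟧))) →
    ∀ w → (∀ e → 0ℚ ℚ.≤ w e) → (∀ e f → e ≻[ σ ] f → w f ℚ.≤ w e) →
    weight w (OPT M σ) ℚ.≤ ℕ→ℚ a ℚ.* 𝔼 (algorithm λ̂) M σ (weight w)
  weight-bound a nonempty h w w≥0 mono = subst (λ m → weight w (OPT M σ) ℚ.≤ ℕ→ℚ a ℚ.* m) (sym (𝔼≡mean (weight w)))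
    (mean-bound (map (weight w) outcomes) a (subst (1 ≤_) (sym (#outcomes (weight w))) nonempty) (begin
      weight w (OPT M σ) ℚ.* ℕ→ℚ (length (map (weight w) outcomes))
        ≡⟨ cong₂ ℚ._*_ (weight-lookup w (OPT M σ)) (cong ℕ→ℚ (#outcomes (weight w))) ⟩
      ∑ℚ (allFin n) (λ e → w e ℚ.* ℕ→ℚ ⟦ lookup (OPT M σ) e ⟧) ℚ.* ℕ→ℚ R
        ≡⟨ sym (∑ℚ-*ʳ (ℕ→ℚ R) (allFin n) _) ⟩
      ∑ℚ (allFin n) (λ e → w e ℚ.* ℕ→ℚ ⟦ lookup (OPT M σ) e ⟧ ℚ.* ℕ→ℚ R)
        ≡⟨ ∑ℚ-cong (allFin n) (λ e → trans (ℚₚ.*-assoc (w e) _ _) (cong (w e ℚ.*_) (sym (ℕ→ℚ-* ⟦ lookup (OPT M σ) e ⟧ R)))) ⟩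
      ∑ℚ (allFin n) (λ e → w e ℚ.* ℕ→ℚ (v e))
        ≡⟨ sym (∑ℚ-ranked (λ e → w e ℚ.* ℕ→ℚ (v e))) ⟩
      ∑ℚ (allFin n) (λ i → w (σ ⟨$⟩ʳ i) ℚ.* ℕ→ℚ (v (σ ⟨$⟩ʳ i)))
        -- There is no surplus at the start; the total weight serves as an upper bound of every
        -- single weight.
        ≤⟨ abel n (w ∘ (σ ⟨$⟩ʳ_)) (u ∘ (σ ⟨$⟩ʳ_)) (v ∘ (σ ⟨$⟩ʳ_)) 0 (total w) (λ i → total-≥ (σ ⟨$⟩ʳ i)) (λ i → w≥0 _) total≥0
             (λ i j l → mono _ _ (≤-trans (≤-reflexive (cong suc (pos-σ i))) (≤-trans l (≤-reflexive (sym (pos-σ j)))))) prefixes ⟩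
      total w ℚ.* ℕ→ℚ 0 ℚ.+ ∑ℚ (allFin n) (λ i → w (σ ⟨$⟩ʳ i) ℚ.* ℕ→ℚ (u (σ ⟨$⟩ʳ i)))
        ≡⟨ trans (cong₂ ℚ._+_ (ℚₚ.*-zeroʳ (total w)) refl) (trans (ℚₚ.+-identityˡ _) (∑ℚ-ranked (λ e → w e ℚ.* ℕ→ℚ (u e)))) ⟩
      ∑ℚ (allFin n) (λ e → w e ℚ.* ℕ→ℚ (u e))
        ≡⟨ ∑ℚ-cong (allFin n) (λ e → trans (cong (w e ℚ.*_) (trans (ℕ→ℚ-* a _) (ℚₚ.*-comm (ℕ→ℚ a) _))) (sym (ℚₚ.*-assoc (w e) _ (ℕ→ℚ a)))) ⟩
      ∑ℚ (allFin n) (λ e → w e ℚ.* ℕ→ℚ (∑ outcomes (λ S → ⟦ lookup S e ⟧)) ℚ.* ℕ→ℚ a)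
        ≡⟨ trans (∑ℚ-*ʳ (ℕ→ℚ a) (allFin n) _) (ℚₚ.*-comm _ (ℕ→ℚ a)) ⟩
      ℕ→ℚ a ℚ.* ∑ℚ (allFin n) (λ e → w e ℚ.* ℕ→ℚ (∑ outcomes (λ S → ⟦ lookup S e ⟧)))
        ≡⟨ cong (ℕ→ℚ a ℚ.*_) (sym (sum-weight w outcomes)) ⟩
      ℕ→ℚ a ℚ.* sumℚ (map (weight w) outcomes) ∎))
    where
    open ℚₚ.≤-Reasoning
    R : ℕ
    R = runs (λ _ → 1)
    u v : Fin n → ℕ
    u e = a * ∑ outcomes (λ S → ⟦ lookup S e ⟧)
    v e = ⟦ lookup (OPT M σ) e ⟧ * R
    total : (Fin n → ℚ) → ℚ
    total w = ∑ℚ (allFin n) w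
    ∑ℚ-nonNeg : ∀ xs → 0ℚ ℚ.≤ ∑ℚ xs w
    ∑ℚ-nonNeg []       = ℚₚ.≤-refl
    ∑ℚ-nonNeg (x ∷ xs) = ℚₚ.≤-trans (ℚₚ.≤-reflexive (sym (ℚₚ.+-identityˡ 0ℚ))) (ℚₚ.+-mono-≤ (w≥0 x) (∑ℚ-nonNeg xs))
    total≥0 : 0ℚ ℚ.≤ total w
    total≥0 = ∑ℚ-nonNeg (allFin n)
    ∑ℚ-≥ : ∀ {e xs} → e ∈ˡ xs → w e ℚ.≤ ∑ℚ xs w
    ∑ℚ-≥ {e} {x ∷ xs} (here refl) = ℚₚ.≤-trans (ℚₚ.≤-reflexive (sym (ℚₚ.+-identityʳ (w e)))) (ℚₚ.+-monoʳ-≤ (w e) (∑ℚ-nonNeg xs))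
    ∑ℚ-≥ {e} {x ∷ xs} (there m)   = ℚₚ.≤-trans (∑ℚ-≥ m) (ℚₚ.≤-trans (ℚₚ.≤-reflexive (sym (ℚₚ.+-identityˡ _))) (ℚₚ.+-monoˡ-≤ (∑ℚ xs w) (w≥0 x)))
    total-≥ : ∀ e → w e ℚ.≤ total w
    total-≥ e = ∑ℚ-≥ (∈-allFin e)
    pos-σ : ∀ i → pos σ (σ ⟨$⟩ʳ i) ≡ toℕ i
    pos-σ i = cong toℕ (inverseˡ σ)
    to-pos : ∀ (f : Fin n → ℕ) l → ∑ (allFin n) (λ i → ⟦ does (toℕ i ℕ.<? l) ⟧ * f (σ ⟨$⟩ʳ i)) ≡ ∑ (allFin n) (λ e → ⟦ before? l e ⟧ * f e)
    to-pos f l = trans (∑-cong (allFin n) (λ i → cong (λ t → ⟦ does (t ℕ.<? l) ⟧ * f (σ ⟨$⟩ʳ i)) (sym (pos-σ i))))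
      (∑-ranked (λ e → ⟦ before? l e ⟧ * f e))
    prefixes : ∀ l → ∑ (allFin n) (λ i → ⟦ does (toℕ i ℕ.<? l) ⟧ * v (σ ⟨$⟩ʳ i)) ≤ 0 + ∑ (allFin n) (λ i → ⟦ does (toℕ i ℕ.<? l) ⟧ * u (σ ⟨$⟩ʳ i))
    prefixes l = ≤-trans (≤-reflexive (to-pos v l)) (≤-trans bound (≤-reflexive (sym (to-pos u l))))
      where
      X : Subset n → ℕ
      X S = ∑ (allFin n) (λ x → ⟦ lookup S x ∧ before? l x ⟧)
      opt-part : ∑ (allFin n) (λ e → ⟦ before? l e ⟧ * v e) ≤ ∣ optBefore l ∣ * R
      opt-part = ≤-trans (≤-reflexive (∑-cong (allFin n) (λ e → sym (*-assoc ⟦ before? l e ⟧ ⟦ lookup (OPT M σ) e ⟧ R))))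
        (≤-trans (≤-reflexive (∑-*ʳ R (allFin n) _)) (*-monoˡ-≤ R (≤-trans (∑-mono (allFin n) pt) (≤-reflexive (sym (∣∣≡∑ (optBefore l)))))))
        where
        pt : ∀ e → ⟦ before? l e ⟧ * ⟦ lookup (OPT M σ) e ⟧ ≤ ⟦ lookup (optBefore l) e ⟧
        pt e = ≤-trans (≤-reflexive (sym (⟦∧⟧ (before? l e) (lookup (OPT M σ) e))))
          (⟦⟧-mono {before? l e ∧ lookup (OPT M σ) e} {lookup (optBefore l) e} (λ q → let (b , o) = ∧-true {before? l e} q in
            ∈⇒lookup {p = optBefore l} (∈optBefore⁺ {l} {e} (∈OPT⇒opt (lookup⇒∈ o)) (does-true (pos σ e ℕ.<? l) b))))
      alg-part : a * runs X ≡ ∑ (allFin n) (λ e → ⟦ before? l e ⟧ * u e)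
      alg-part = trans (cong (a *_) (trans (sym (∑-outcomes X)) (trans (∑-swap outcomes (allFin n) _) (∑-cong (allFin n) (λ e →
          trans (∑-cong outcomes (λ S → trans (⟦∧⟧ (lookup S e) (before? l e)) (*-comm ⟦ lookup S e ⟧ ⟦ before? l e ⟧))) (∑-*ˡ ⟦ before? l e ⟧ outcomes _))))))
        (trans (sym (∑-*ˡ a (allFin n) _)) (∑-cong (allFin n) (λ e → *-leftComm a ⟦ before? l e ⟧ _)))
      bound : ∑ (allFin n) (λ e → ⟦ before? l e ⟧ * v e) ≤ ∑ (allFin n) (λ e → ⟦ before? l e ⟧ * u e)
      bound = ≤-trans opt-part (≤-trans (h l) (≤-reflexive alg-part))

-- Numbers of scales and final constants

rank≤n : ∀ {n} {M : Matroid n} {ρ} → HasRank M ρ → ρ ≤ n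
rank≤n (B , (_ , size) , _) = ≤-trans (≤-reflexive (sym size)) (∣p∣≤n B)

probability-scales : ∀ {n ρ} → ρ ≤ n → 2 + ⌊log₂ suc ρ ⌋ ≤ scaleSeeds n
probability-scales {n} {ρ} l = s≤s (s≤s (≤-trans (log< ρ) (≤-trans l (m≤n+m n 2))))

ordinal-scales : ∀ {n ρ} → ρ ≤ n → 2 + ⌊log₂ suc (class ρ) ⌋ ≤ scaleSeeds n
ordinal-scales {n} {ρ} l = s≤s (s≤s (≤-trans (log< (class ρ)) (≤-trans (class≤log ρ) (≤-trans (s≤s (≤-trans (log≤ ρ) l)) (n≤1+n (suc n))))))

probability-factor : ∀ ρ → 2 + ⌊log₂ suc ρ ⌋ ≤ 3 * suc ⌊log₂ ρ ⌋
probability-factor ρ = ≤-trans (s≤s (s≤s (log-suc ρ))) (≤-trans (m≤m+n (3 + x) (x + x)) (≤-reflexive (r x)))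
  where
  x = ⌊log₂ ρ ⌋
  r : ∀ x → 3 + x + (x + x) ≡ 3 * suc x
  r = solve-∀

ordinal-factor : ∀ ρ → 2 + ⌊log₂ suc (class ρ) ⌋ ≤ 4 * suc (loglog₂ ρ)
ordinal-factor ρ = begin
  2 + ⌊log₂ suc (class ρ) ⌋     ≤⟨ s≤s (s≤s (⌊log₂⌋-mono-≤ (s≤s (class≤log ρ)))) ⟩
  2 + ⌊log₂ suc (suc x) ⌋       ≤⟨ s≤s (s≤s (≤-trans (log-suc (suc x)) (s≤s (log-suc x)))) ⟩
  4 + ⌊log₂ x ⌋                 ≤⟨ m≤m+n (4 + ⌊log₂ x ⌋) (⌊log₂ x ⌋ + ⌊log₂ x ⌋ + ⌊log₂ x ⌋) ⟩
  4 + ⌊log₂ x ⌋ + (⌊log₂ x ⌋ + ⌊log₂ x ⌋ + ⌊log₂ x ⌋) ≡⟨ r ⌊log₂ x ⌋ ⟩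
  4 * suc ⌊log₂ x ⌋             ∎
  where
  open ≤-Reasoning
  x = ⌊log₂ ρ ⌋
  r : ∀ y → 4 + y + (y + y + y) ≡ 4 * suc y
  r = solve-∀

theorem2 : (Σ[ C ∈ ℕ ] Σ[ A ∈ Algorithm ]
    ((n : ℕ) (M : Matroid n) (σ : Permutation′ n) (ρ : ℕ) → HasRank M ρ →
    OrdinalCompetitive M σ A (ℕ→ℚ (C * suc (loglog₂ ρ)))))
    ×
    (Σ[ C ∈ ℕ ] Σ[ A ∈ Algorithm ]
    ((n : ℕ) (M : Matroid n) (σ : Permutation′ n) (ρ : ℕ) → HasRank M ρ →
    ProbabilityCompetitive M σ A (ℕ→ℚ (C * suc ⌊log₂ ρ ⌋))))
theorem2 = (8 * (2 * base * 512) , algorithm class , ordinal) , (6 * 512 , algorithm id , probability)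
  where
  -- The leading constants 8 and 6 arise here: the factor 2 of `N≤` times the 4 of `ordinal-factor`
  -- or the 3 of `probability-factor`.
  scaled : ∀ {w m x} c v → w ≤ m * suc x → 2 * w * c * v ≤ 2 * m * c * suc x * v
  scaled {w} {m} {x} c v l = *-monoˡ-≤ v (≤-trans (*-monoˡ-≤ c (*-monoʳ-≤ 2 l)) (≤-reflexive (r m (suc x) c)))
    where
    r : ∀ m y c → 2 * (m * y) * c ≡ 2 * m * c * y
    r = solve-∀
  ordinal : ∀ n (M : Matroid n) (σ : Permutation′ n) ρ → HasRank M ρ →
            OrdinalCompetitive M σ (algorithm class) (ℕ→ℚ (8 * (2 * base * 512) * suc (loglog₂ ρ)))
  ordinal n M σ ρ hr = Expectation.weight-bound M σ class class-mono (8 * (2 * base * 512) * suc (loglog₂ ρ)) G.#runs-pos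
    (λ l → ≤-trans (PG.prefix-guarantee l) (scaled {w} {4} {loglog₂ ρ} (2 * base * 512) _ (ordinal-factor ρ)))
    where
    wide = ordinal-scales {n} (rank≤n {M = M} hr)
    w = 2 + ⌊log₂ suc (class ρ) ⌋
    module G = Guarantee M σ class class-mono hr (scaleSeeds n) wide
    module PG = PrefixGuarantee M σ hr (scaleSeeds n) wide
  probability : ∀ n (M : Matroid n) (σ : Permutation′ n) ρ → HasRank M ρ →
                ProbabilityCompetitive M σ (algorithm id) (ℕ→ℚ (6 * 512 * suc ⌊log₂ ρ ⌋))
  probability n M σ ρ hr e e∈ = Expectation.indicator-bound M σ id id e (6 * 512 * suc ⌊log₂ ρ ⌋) G.#runs-pos
    -- With `id` the levels are the counts themselves, so the strict jump holds at every element.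
    (≤-trans (G.element-runs (Optimum.∈OPT⇒opt M σ e∈) (λ U → ≤-refl)) (scaled {w} {3} {⌊log₂ ρ ⌋} 512 _ (probability-factor ρ)))
    where
    w = 2 + ⌊log₂ suc ρ ⌋
    module G = Guarantee M σ id id hr (scaleSeeds n) (probability-scales {n} (rank≤n {M = M} hr))
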